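{- Suppose that for every $\alpha>0$ we have $pn^\alpha\to\infty$ as $n\to\infty$, and that $q\ln n\to\infty$, where $q=1-p$. Then for every $\varepsilon>0$ there exists $n_0$ such that for all $n\ge n_0$, both $u_3(n,p)$ and $u_3'(n,p)$ are at least $(2-\varepsilon)\log_{\frac{1}{1-p}}(np)$.
   Context: $G(n,p)$ is the Erdős–Rényi random graph on $n$ labelled vertices (vertex set $V$), each edge present independently with probability $p=p(n)$; $\mathbb{P}_{n,p}$ is the corresponding probability and $q=1-p$. A diameter graph in $\mathbb{R}^d$ is a graph $(V,E)$ with $V\subset\mathbb{R}^d$ finite and $E=\{\{\mathbf{x},\mathbf{y}\}\subseteq V: |\mathbf{x}-\mathbf{y}|=\operatorname{diam}V\}$, where $\operatorname{diam}V=\max_{\mathbf{x},\mathbf{y}\in V}|\mathbf{x}-\mathbf{y}|$ (Euclidean norm); a graph is a diameter graph in $\mathbb{R}^d$ if it is isomorphic to one. $u_d(n,p)$ is the largest positive integer $k$ such that $\mathbb{P}_{n,p}\big(\exists W\subseteq V,\ |W|=k,\ G[W]$ is a diameter graph in $\mathbb{R}^d$ and $\chi(G[W])=d+1\big)>\frac12$, where $G[W]$ is the induced subgraph; if no such $k$ exists, $u_d(n,p)=0$. $u_d'(n,p)$ is defined identically with the additional requirement that $G[W]$ be connected. -}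

module Defs where

open import Algebra.Bundles using (CommutativeRing; Semiring)
import Algebra.Definitions.RawSemiring as RawSemiringOps
import Algebra.Properties.AbelianGroup as AbelianGroupProperties
import Algebra.Properties.Monoid.Sum as MonoidSum
import Algebra.Properties.Ring as RingProperties
open import Axiom.ExcludedMiddle using (ExcludedMiddle)
open import Data.Bool.Base using (if_then_else_)
open import Data.Empty using (⊥)
open import Data.Fin.Base using (Fin; zero; suc; toℕ)
open import Data.Fin.Subset using (Subset; inside; outside; _∈_; ∣_∣)
open import Data.Nat.Base as ℕ using (ℕ; zero; suc; _!)
open import Data.Product.Base using (Σ; ∃; ∃₂; _×_; _,_; proj₁; proj₂)
open import Data.Sum.Base using ([_,_]′)
open import Data.Vec.Base using ([]; _∷_)
open import Data.Vec.Functional using (Vector)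
open import Function.Bundles using (_↔_; _⇔_; Inverse)
open import Function.Definitions using (Injective)
open import Level using (0ℓ)
open import Relation.Binary.Construct.Closure.ReflexiveTransitive using (Star)
import Relation.Binary.Construct.NonStrictToStrict as NonStrictToStrict
open import Relation.Binary.Core using (Rel)
open import Relation.Binary.Definitions using (Irreflexive; Symmetric)
open import Relation.Binary.PropositionalEquality.Core using (_≡_; _≢_; refl; ≢-sym)
open import Relation.Binary.Structures using (IsTotalOrder)
open import Relation.Nullary using (¬_; yes; no; does; contradiction)

-- Order-complete ordered fields.  Any two are uniquely isomorphic, so a
-- statement about all of them is a statement about the real numbers.

record Reals : Set₁ where
  field
    commutativeRing : CommutativeRing 0ℓ 0ℓ

  open CommutativeRing commutativeRing public
    renaming (refl to ≈-refl; sym to ≈-sym; trans to ≈-trans; reflexive to ≈-reflexive)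

  infix 4 _≤_
  infix 8 _⁻¹

  field
    _≤_          : Rel Carrier 0ℓ
    isTotalOrder : IsTotalOrder _≈_ _≤_
    +-monoˡ-≤    : ∀ z {x y} → x ≤ y → x + z ≤ y + z
    *-nonneg     : ∀ {x y} → 0# ≤ x → 0# ≤ y → 0# ≤ x * y
    0≉1          : ¬ (0# ≈ 1#)
    -- Unconstrained at 0.
    _⁻¹          : Carrier → Carrier
    ⁻¹-inverseʳ  : ∀ {x} → ¬ (x ≈ 0#) → x * x ⁻¹ ≈ 1#

  UpperBound : (Carrier → Set) → Carrier → Set
  UpperBound P b = ∀ {x} → P x → x ≤ b

  field
    complete : (P : Carrier → Set) → ∃ P → ∃ (UpperBound P) →
               ∃ λ s → UpperBound P s × (∀ {b} → UpperBound P b → s ≤ b)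

  open NonStrictToStrict _≈_ _≤_ public using (_<_)
  open IsTotalOrder isTotalOrder public
    using (total; antisym; ≤-respˡ-≈; ≤-respʳ-≈)
  open RawSemiringOps (Semiring.rawSemiring semiring) public using (_^_; sum) renaming (_×_ to _times_)

  infixl 7 _/_

  fromℕ : ℕ → Carrier
  fromℕ n = n times 1#

  _/_ : Carrier → Carrier → Carrier
  x / y = x * y ⁻¹

  abs : Carrier → Carrier
  abs x = [ (λ _ → x) , (λ _ → - x) ]′ (total 0# x)

record Graph : Set₁ where
  field
    Vertex  : Set
    Adj     : Rel Vertex 0ℓ
    adj-sym : Symmetric Adj
    irrefl  : Irreflexive _≡_ Adj

open Graph

infix 4 _≅_

_≅_ : Graph → Graph → Set
G ≅ H = Σ (Vertex G ↔ Vertex H) λ φ →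
        ∀ u v → Adj G u v ⇔ Adj H (Inverse.to φ u) (Inverse.to φ v)

induced : (G : Graph) → (Vertex G → Set) → Graph
induced G W = record
  { Vertex  = Σ (Vertex G) W
  ; Adj     = λ u v → Adj G (proj₁ u) (proj₁ v)
  ; adj-sym = adj-sym G
  ; irrefl  = λ { refl → irrefl G refl }
  }

Connected : Graph → Set
Connected G = ∀ u v → Star (Adj G) u v

Colourable : Graph → ℕ → Set
Colourable G c = Σ (Vertex G → Fin c) λ f → ∀ {u v} → Adj G u v → f u ≢ f v

ChromaticNumber : Graph → ℕ → Set
ChromaticNumber G c = Colourable G c × (∀ {b} → Colourable G b → c ℕ.≤ b)

-- A labelled graph on Fin n, one bit for each pair of distinct vertices: in
-- S ∷ ω, the set S consists of those j for which suc j is adjacent to zero, and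
-- ω is the graph on the remaining vertices.

data Outcome : ℕ → Set where
  []  : Outcome zero
  _∷_ : ∀ {n} → Subset n → Outcome n → Outcome (suc n)

OutcomeAdj : ∀ {n} → Outcome n → Rel (Fin n) 0ℓ
OutcomeAdj (S ∷ ω) zero    zero    = ⊥
OutcomeAdj (S ∷ ω) zero    (suc j) = j ∈ S
OutcomeAdj (S ∷ ω) (suc i) zero    = i ∈ S
OutcomeAdj (S ∷ ω) (suc i) (suc j) = OutcomeAdj ω i j

graph : ∀ {n} → Outcome n → Graph
graph {n} ω = record
  { Vertex  = Fin n
  ; Adj     = OutcomeAdj ω
  ; adj-sym = λ {i} {j} → symm ω i j
  ; irrefl  = λ { {i} refl → irr ω i }
  }
  where
  symm : ∀ {m} (ω : Outcome m) i j → OutcomeAdj ω i j → OutcomeAdj ω j i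
  symm (S ∷ ω) zero    (suc j) a = a
  symm (S ∷ ω) (suc i) zero    a = a
  symm (S ∷ ω) (suc i) (suc j) a = symm ω i j a

  irr : ∀ {m} (ω : Outcome m) i → ¬ OutcomeAdj ω i i
  irr (S ∷ ω) (suc i) a = irr ω i a

-- Excluded middle for untruncated types makes definite description available
-- and lets every event have a probability.

module Classical (em : ExcludedMiddle 0ℓ) (ℝ : Reals) where

  open Reals ℝ

  -- The element satisfying P, or the default if there is none.  For P on
  -- Carrier this is meant for P with at most one solution up to _≈_.

  the : {A : Set} → A → (A → Set) → A
  the {A} default P with em {Σ A P}
  ... | yes (x , _) = x
  ... | no  _       = default

  private
    open import Relation.Binary.Reasoning.Setoid setoid
    open RingProperties ring
      using (-‿distribˡ-*; -‿distribʳ-*; [y-z]x≈yx-zx; -‿involutive)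
    open AbelianGroupProperties +-abelianGroup using (⁻¹-anti-homo‿-; x∙y⁻¹≈ε⇒x≈y)
    open MonoidSum +-monoid using (sum-cong-≋)

    -x*-x≈x*x : ∀ x → - x * - x ≈ x * x
    -x*-x≈x*x x = begin
      - x * - x     ≈⟨ -‿distribʳ-* (- x) x ⟨
      - (- x * x)   ≈⟨ -‿cong (-‿distribˡ-* x x) ⟨
      - - (x * x)   ≈⟨ -‿involutive (x * x) ⟩
      x * x         ∎

    cancel-sub : ∀ a b c → (a - b) + (b - c) ≈ a - c
    cancel-sub a b c = begin
      (a - b) + (b - c)    ≈⟨ +-assoc a (- b) (b - c) ⟩
      a + (- b + (b - c))  ≈⟨ +-congˡ (+-assoc (- b) b (- c)) ⟨
      a + ((- b + b) - c)  ≈⟨ +-congˡ (+-congʳ (-‿inverseˡ b)) ⟩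
      a + (0# - c)         ≈⟨ +-congˡ (+-identityˡ (- c)) ⟩
      a - c                ∎

    difference-of-squares : ∀ a b → (a - b) * (a + b) ≈ a * a - b * b
    difference-of-squares a b = begin
      (a - b) * (a + b)                  ≈⟨ distribˡ (a - b) a b ⟩
      (a - b) * a + (a - b) * b          ≈⟨ +-cong ([y-z]x≈yx-zx a a b) ([y-z]x≈yx-zx b a b) ⟩
      (a * a - b * a) + (a * b - b * b)  ≈⟨ +-congˡ (+-congʳ (*-comm a b)) ⟩
      (a * a - b * a) + (b * a - b * b)  ≈⟨ cancel-sub (a * a) (b * a) (b * b) ⟩
      a * a - b * b                      ∎

    x≤x+y : ∀ {x y} → 0# ≤ y → x ≤ x + y
    x≤x+y {x} {y} 0≤y =
      ≤-respˡ-≈ (+-identityˡ x) (≤-respʳ-≈ (+-comm y x) (+-monoˡ-≤ x 0≤y))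

    nonneg-sum-zero : ∀ {x y} → 0# ≤ x → 0# ≤ y → x + y ≈ 0# → x ≈ 0#
    nonneg-sum-zero 0≤x 0≤y x+y≈0 = antisym (≤-respʳ-≈ x+y≈0 (x≤x+y 0≤y)) 0≤x

    root-unique : ∀ {r s} → 0# ≤ r → 0# ≤ s → r * r ≈ s * s → r ≈ s
    root-unique {r} {s} 0≤r 0≤s r²≈s² with em {r - s ≈ 0#}
    ... | yes r-s≈0 = x∙y⁻¹≈ε⇒x≈y r s r-s≈0
    ... | no  r-s≉0 = ≈-trans (nonneg-sum-zero 0≤r 0≤s r+s≈0)
            (≈-sym (nonneg-sum-zero 0≤s 0≤r (≈-trans (+-comm s r) r+s≈0)))
      where
      r+s≈0 : r + s ≈ 0#
      r+s≈0 = begin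
        r + s                             ≈⟨ *-identityˡ (r + s) ⟨
        1# * (r + s)                      ≈⟨ *-congʳ (⁻¹-inverseʳ r-s≉0) ⟨
        (r - s) * (r - s) ⁻¹ * (r + s)    ≈⟨ *-congʳ (*-comm (r - s) ((r - s) ⁻¹)) ⟩
        (r - s) ⁻¹ * (r - s) * (r + s)    ≈⟨ *-assoc ((r - s) ⁻¹) (r - s) (r + s) ⟩
        (r - s) ⁻¹ * ((r - s) * (r + s))  ≈⟨ *-congˡ (difference-of-squares r s) ⟩
        (r - s) ⁻¹ * (r * r - s * s)      ≈⟨ *-congˡ (+-congʳ r²≈s²) ⟩
        (r - s) ⁻¹ * (s * s - s * s)      ≈⟨ *-congˡ (-‿inverseʳ (s * s)) ⟩
        (r - s) ⁻¹ * 0#                   ≈⟨ zeroʳ ((r - s) ⁻¹) ⟩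
        0#                                ∎

  ConvergesTo : (ℕ → Carrier) → Carrier → Set
  ConvergesTo s L = ∀ ε → 0# < ε → ∃ λ N → ∀ n → N ℕ.≤ n → abs (s n - L) < ε

  TendsToInfinity : (ℕ → Carrier) → Set
  TendsToInfinity s = ∀ M → ∃ λ N → ∀ n → N ℕ.≤ n → M < s n

  sqrt : Carrier → Carrier
  sqrt x = the 0# λ y → 0# ≤ y × y * y ≈ x

  exp : Carrier → Carrier
  exp x = the 0# (ConvergesTo λ N → sum {N} λ k → x ^ toℕ k / fromℕ (toℕ k !))

  sqrt-cong : ∀ {x y} → x ≈ y → sqrt x ≈ sqrt y
  sqrt-cong {x} {y} x≈y
    with em {∃ λ r → 0# ≤ r × r * r ≈ x} | em {∃ λ r → 0# ≤ r × r * r ≈ y}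
  ... | yes (r , 0≤r , r²≈x) | yes (s , 0≤s , s²≈y) =
        root-unique 0≤r 0≤s (≈-trans r²≈x (≈-trans x≈y (≈-sym s²≈y)))
  ... | yes (r , 0≤r , r²≈x) | no ∄s = contradiction (r , 0≤r , ≈-trans r²≈x x≈y) ∄s
  ... | no ∄r | yes (s , 0≤s , s²≈y) = contradiction (s , 0≤s , ≈-trans s²≈y (≈-sym x≈y)) ∄r
  ... | no _  | no _ = ≈-refl

  ln : Carrier → Carrier
  ln x = the 0# λ y → exp y ≈ x

  log : (base : Carrier) → Carrier → Carrier
  log b x = ln x / ln b

  infixr 8 _^ʳ_

  -- Real powers of a positive base.

  _^ʳ_ : Carrier → Carrier → Carrier
  x ^ʳ α = exp (α * ln x)

  Point : ℕ → Set
  Point d = Vector Carrier d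

  dist : ∀ {d} → Point d → Point d → Carrier
  dist u v = sqrt (sum λ k → (u k - v k) * (u k - v k))

  dist-sym : ∀ {d} (u v : Point d) → dist u v ≈ dist v u
  dist-sym u v = sqrt-cong (sum-cong-≋ λ k →
    ≈-trans (≈-sym (-x*-x≈x*x (u k - v k)))
            (*-cong (⁻¹-anti-homo‿- (u k) (v k)) (⁻¹-anti-homo‿- (u k) (v k))))

  -- The maximum distance between points of a nonempty finite family.

  diam : ∀ {d m} → (Fin m → Point d) → Carrier
  diam x = the 0# λ D → (∃₂ λ i j → D ≈ dist (x i) (x j)) × (∀ i j → dist (x i) (x j) ≤ D)

  diameterGraph : ∀ {d m} → (Fin m → Point d) → Graph
  diameterGraph {d} {m} x = record
    { Vertex  = Fin m
    ; Adj     = λ i j → i ≢ j × dist (x i) (x j) ≈ diam x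
    ; adj-sym = λ { {i} {j} (i≢j , e) → ≢-sym i≢j , ≈-trans (dist-sym (x j) (x i)) e }
    ; irrefl  = λ i≡j a → proj₁ a i≡j
    }

  -- A finite V ⊂ ℝᵈ is given by a listing without repetitions.

  IsDiameterGraph : ℕ → Graph → Set
  IsDiameterGraph d G = ∃₂ λ m (x : Fin m → Point d) →
    Injective _≡_ (λ u v → ∀ k → u k ≈ v k) x × G ≅ diameterGraph x

  -- Expectation over a random subset of Fin n that contains each element
  -- independently with probability p.

  𝔼-subset : ∀ n → Carrier → (Subset n → Carrier) → Carrier
  𝔼-subset zero    p f = f []
  𝔼-subset (suc n) p f = p * 𝔼-subset n p (λ S → f (inside ∷ S))
                       + (1# - p) * 𝔼-subset n p (λ S → f (outside ∷ S))

  𝔼 : ∀ n → Carrier → (Outcome n → Carrier) → Carrier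
  𝔼 zero    p f = f []
  𝔼 (suc n) p f = 𝔼-subset n p λ S → 𝔼 n p λ ω → f (S ∷ ω)

  ℙ : ∀ n → Carrier → (Outcome n → Set) → Carrier
  ℙ n p A = 𝔼 n p λ ω → if does (em {A ω}) then 1# else 0#

  IsLargestPositive : (ℕ → Set) → ℕ → Set
  IsLargestPositive Q k = 1 ℕ.≤ k × Q k × (∀ {j} → Q j → j ℕ.≤ k)

  largestInduced : (Graph → Set) → ∀ n → Carrier → ℕ
  largestInduced P n p = the 0 (IsLargestPositive λ k →
    1# / fromℕ 2 < ℙ n p λ ω →
      Σ (Subset n) λ W → ∣ W ∣ ≡ k × P (induced (graph ω) (_∈ W)))

  u : (d n : ℕ) → Carrier → ℕ
  u d = largestInduced λ H → IsDiameterGraph d H × ChromaticNumber H (suc d)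

  u′ : (d n : ℕ) → Carrier → ℕ
  u′ d = largestInduced λ H →
    IsDiameterGraph d H × ChromaticNumber H (suc d) × Connected H

{-# OPTIONS --safe #-}
module Submission where

-- Attach k pendant vertices to one vertex of K₄.  This "broom" is connected,
-- has chromatic number 4 and is a diameter graph in ℝ³: place K₄ as a
-- regular tetrahedron and the pendant vertices on the sphere around one of its
-- vertices through the other three, on an open circular arc joining two of these.
-- So it suffices to find an induced broom with k > (2 - ε) log (np) - 4 pendant
-- vertices, the base of the logarithm being 1 / q.
--
-- Expose the vertices four at a time until four of them span a K₄.  Each attempt
-- succeeds with probability p⁶, independently of all other edges, and n / 8
-- attempts are plenty because p decays slower than every power of n.  A fixed
-- set of k of the remaining vertices then completes a broom with probability
-- τ^k q^(k choose 2), where τ = p q³.  Split these vertices into k blocks of size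
-- N and let X be the proportion of transversals of the blocks that complete a
-- broom.  Two transversals meeting in ℓ points are positively correlated by the
-- factor τ^(-ℓ) q^(-(ℓ choose 2)) ≤ c^ℓ, where c = 1 / (τ q^j) and k = 2 j + 1,
-- so 𝔼 X² / (𝔼 X)² ≤ (1 + c / N)^k.  This is close to 1 as soon as k c / N is
-- small, that is, as long as q^j is well above k² / (n p q³), and the hypotheses
-- on p and q make every factor other than (np)^(1 - ε / 2) negligible.

open import Defs
open import Algebra.Bundles using (CommutativeRing)
import Algebra.Properties.AbelianGroup as AbelianGroupProperties
import Algebra.Properties.CommutativeSemiring.Exp as CommutativeExp
import Algebra.Properties.Ring as RingProperties
import Algebra.Properties.Semiring.Exp as SemiringExp
import Algebra.Properties.Semiring.Mult as SemiringMult
import Algebra.Solver.Ring as RingSolver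
open import Algebra.Solver.Ring.AlmostCommutativeRing using (fromCommutativeRing; _-Raw-AlmostCommutative⟶_)
open import Axiom.ExcludedMiddle using (ExcludedMiddle)
open import Data.Bool.Base using (if_then_else_)
open import Data.Empty using (⊥)
open import Data.Fin.Base as Fin using (Fin; zero; suc; toℕ)
import Data.Fin.Properties as Fin
open import Data.Fin.Subset using (Subset; Side; inside; outside; _∈_; _∉_; _∩_; _∪_; ∣_∣; ⁅_⁆) renaming (⊥ to ∅)
import Data.Fin.Subset.Properties as Subset
open import Data.Integer.Base as ℤ using (ℤ; +_; -[1+_]; _⊖_)
import Data.Integer.Properties as ℤ
open import Data.Maybe.Base using (Maybe; just; nothing)
open import Data.Nat.Base as ℕ using (ℕ; z≤n; s≤s; _!)
import Data.Nat.DivMod as ℕ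
import Data.Nat.Properties as ℕ
import Data.Nat.Solver as ℕ
open import Data.Product.Base using (Σ; ∃; ∃₂; _×_; _,_; proj₁; proj₂)
open import Data.Sum.Base using (_⊎_; inj₁; inj₂; [_,_]′)
open import Data.Unit.Base using (⊤; tt)
open import Data.Vec.Base as Vec using (Vec; []; _∷_; _++_; here; there)
open import Function.Base using (_∘_)
open import Function.Bundles using (_⇔_; Inverse; Equivalence; mk↔ₛ′; mk⇔)
open import Function.Construct.Composition using (_↔-∘_; _⇔-∘_)
open import Function.Construct.Symmetry using (↔-sym)
open import Level using (0ℓ)
open import Relation.Binary.Bundles using (Poset)
open import Relation.Binary.Construct.Closure.ReflexiveTransitive as Star using (Star; _◅_; _◅◅_)
import Relation.Binary.Construct.NonStrictToStrict as NonStrictToStrict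
open import Relation.Binary.PropositionalEquality.Core as ≡ using (_≡_; _≢_; refl)
import Relation.Binary.Reasoning.PartialOrder as PartialOrderReasoning
open import Relation.Binary.Structures using (IsTotalOrder)
open import Relation.Nullary using (¬_; yes; no; does; contradiction)
open import Relation.Nullary.Decidable using (decidable-stable)

-- The functions `exp`, `ln`, `sqrt`, `diam` and the maxima `u`, `u′` are definite descriptions with
-- a default value, so existence has to be proved before anything is known about the value. In
-- particular `ln v` is merely some solution of `exp y ≈ v`, and negative solutions have to be
-- excluded; apart from that, `exp` is studied on nonnegative arguments. Transversals of disjoint
-- blocks stand in for arbitrary k-sets because the blocks contribute independently to the overlap
-- ℓ: the mean of c^ℓ becomes a product, and no sum over binomial coefficients arises. Two factors
-- of at least 3/4, for the good set and for the K₄, give 9/16 > 1/2. With g = n^α, the losses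
-- amount to fifteen factors g: six pay for q³ and nine for k². As ln n ≤ 2 ln (np), they cost at
-- most 30 α ln (np), whereas j leaves a margin of (ε / 2) ln (np). Hence α = ε / 60.

-- A ring solver with integer coefficients

module IntegerSolver (R : CommutativeRing 0ℓ 0ℓ) where

  open CommutativeRing R renaming (refl to ≈-refl; sym to ≈-sym; trans to ≈-trans)
  open SemiringMult semiring using (×-homo-+; ×1-homo-*) renaming (_×_ to _times_)
  open RingProperties ring
  open AbelianGroupProperties +-abelianGroup using (⁻¹-∙-comm)
  open import Relation.Binary.Reasoning.Setoid setoid

  -- 1 is singled out so that the constant 1 denotes 1# on the nose.
  ⟦_⟧ℤ : ℤ → Carrier
  ⟦ + 1 ⟧ℤ      = 1#
  ⟦ + n ⟧ℤ      = n times 1#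
  ⟦ -[1+ n ] ⟧ℤ = - (ℕ.suc n times 1#)

  private
    ⟦+⟧ : ∀ n → ⟦ + n ⟧ℤ ≈ n times 1#
    ⟦+⟧ 0                   = ≈-refl
    ⟦+⟧ 1                   = ≈-sym (+-identityʳ 1#)
    ⟦+⟧ (ℕ.suc (ℕ.suc n)) = ≈-refl

    ⟦-⟧ : ∀ n → ⟦ ℤ.- (+ n) ⟧ℤ ≈ - (n times 1#)
    ⟦-⟧ ℕ.zero    = ≈-sym -0#≈0#
    ⟦-⟧ (ℕ.suc n) = ≈-refl

    cancel-1 : ∀ a b → (1# + a) - (1# + b) ≈ a - b
    cancel-1 a b = begin
      (1# + a) - (1# + b)      ≈⟨ +-cong (+-comm 1# a) (≈-sym (⁻¹-∙-comm 1# b)) ⟩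
      (a + 1#) + (- 1# - b)    ≈⟨ +-assoc a 1# (- 1# - b) ⟩
      a + (1# + (- 1# - b))    ≈⟨ +-congˡ (+-assoc 1# (- 1#) (- b)) ⟨
      a + ((1# - 1#) - b)      ≈⟨ +-congˡ (+-congʳ (-‿inverseʳ 1#)) ⟩
      a + (0# - b)             ≈⟨ +-congˡ (+-identityˡ (- b)) ⟩
      a - b                    ∎

    ⟦⊖⟧ : ∀ m n → ⟦ m ⊖ n ⟧ℤ ≈ m times 1# - n times 1#
    ⟦⊖⟧ m ℕ.zero = begin
      ⟦ + m ⟧ℤ              ≈⟨ ⟦+⟧ m ⟩
      m times 1#            ≈⟨ +-identityʳ _ ⟨
      m times 1# + 0#       ≈⟨ +-congˡ -0#≈0# ⟨
      m times 1# - 0#       ∎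
    ⟦⊖⟧ ℕ.zero (ℕ.suc n) = ≈-sym (+-identityˡ _)
    ⟦⊖⟧ (ℕ.suc m) (ℕ.suc n) = begin
      ⟦ ℕ.suc m ⊖ ℕ.suc n ⟧ℤ                  ≡⟨ ≡.cong ⟦_⟧ℤ (ℤ.[1+m]⊖[1+n]≡m⊖n m n) ⟩
      ⟦ m ⊖ n ⟧ℤ                              ≈⟨ ⟦⊖⟧ m n ⟩
      m times 1# - n times 1#                 ≈⟨ cancel-1 _ _ ⟨
      ℕ.suc m times 1# - ℕ.suc n times 1#     ∎

    +-homo : ∀ x y → ⟦ x ℤ.+ y ⟧ℤ ≈ ⟦ x ⟧ℤ + ⟦ y ⟧ℤ
    +-homo (+ m) (+ n) = begin
      ⟦ + (m ℕ.+ n) ⟧ℤ         ≈⟨ ⟦+⟧ (m ℕ.+ n) ⟩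
      (m ℕ.+ n) times 1#       ≈⟨ ×-homo-+ 1# m n ⟩
      m times 1# + n times 1#  ≈⟨ +-cong (⟦+⟧ m) (⟦+⟧ n) ⟨
      ⟦ + m ⟧ℤ + ⟦ + n ⟧ℤ      ∎
    +-homo (+ m) -[1+ n ] = ≈-trans (⟦⊖⟧ m (ℕ.suc n)) (+-congʳ (≈-sym (⟦+⟧ m)))
    +-homo -[1+ m ] (+ n) = ≈-trans (⟦⊖⟧ n (ℕ.suc m))
      (≈-trans (+-comm _ _) (+-congˡ (≈-sym (⟦+⟧ n))))
    +-homo -[1+ m ] -[1+ n ] = begin
      - (ℕ.suc (ℕ.suc (m ℕ.+ n)) times 1#)           ≡⟨ ≡.cong (λ k → - (k times 1#)) (≡.sym (ℕ.+-suc (ℕ.suc m) n)) ⟩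
      - ((ℕ.suc m ℕ.+ ℕ.suc n) times 1#)              ≈⟨ -‿cong (×-homo-+ 1# (ℕ.suc m) (ℕ.suc n)) ⟩
      - (ℕ.suc m times 1# + ℕ.suc n times 1#)         ≈⟨ ⁻¹-∙-comm _ _ ⟨
      - (ℕ.suc m times 1#) - (ℕ.suc n times 1#)       ∎

    *-homo : ∀ x y → ⟦ x ℤ.* y ⟧ℤ ≈ ⟦ x ⟧ℤ * ⟦ y ⟧ℤ
    *-homo (+ m) (+ n) = begin
      ⟦ + m ℤ.* + n ⟧ℤ         ≡⟨ ≡.cong ⟦_⟧ℤ (≡.sym (ℤ.pos-* m n)) ⟩
      ⟦ + (m ℕ.* n) ⟧ℤ         ≈⟨ ⟦+⟧ (m ℕ.* n) ⟩
      (m ℕ.* n) times 1#       ≈⟨ ×1-homo-* m n ⟩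
      m times 1# * n times 1#  ≈⟨ *-cong (⟦+⟧ m) (⟦+⟧ n) ⟨
      ⟦ + m ⟧ℤ * ⟦ + n ⟧ℤ      ∎
    *-homo (+ m) -[1+ n ] = begin
      ⟦ + m ℤ.* -[1+ n ] ⟧ℤ              ≡⟨ ≡.cong ⟦_⟧ℤ (≡.trans (≡.sym (ℤ.neg-distribʳ-* (+ m) (+ ℕ.suc n))) (≡.cong ℤ.-_ (≡.sym (ℤ.pos-* m (ℕ.suc n))))) ⟩
      ⟦ ℤ.- (+ (m ℕ.* ℕ.suc n)) ⟧ℤ       ≈⟨ ⟦-⟧ (m ℕ.* ℕ.suc n) ⟩
      - ((m ℕ.* ℕ.suc n) times 1#)       ≈⟨ -‿cong (×1-homo-* m (ℕ.suc n)) ⟩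
      - (m times 1# * ℕ.suc n times 1#)  ≈⟨ -‿distribʳ-* _ _ ⟩
      m times 1# * - (ℕ.suc n times 1#)  ≈⟨ *-congʳ (⟦+⟧ m) ⟨
      ⟦ + m ⟧ℤ * ⟦ -[1+ n ] ⟧ℤ           ∎
    *-homo -[1+ m ] (+ n) = begin
      ⟦ -[1+ m ] ℤ.* + n ⟧ℤ              ≡⟨ ≡.cong ⟦_⟧ℤ (≡.trans (≡.sym (ℤ.neg-distribˡ-* (+ ℕ.suc m) (+ n))) (≡.cong ℤ.-_ (≡.sym (ℤ.pos-* (ℕ.suc m) n)))) ⟩
      ⟦ ℤ.- (+ (ℕ.suc m ℕ.* n)) ⟧ℤ       ≈⟨ ⟦-⟧ (ℕ.suc m ℕ.* n) ⟩
      - ((ℕ.suc m ℕ.* n) times 1#)       ≈⟨ -‿cong (×1-homo-* (ℕ.suc m) n) ⟩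
      - (ℕ.suc m times 1# * n times 1#)  ≈⟨ -‿distribˡ-* _ _ ⟩
      - (ℕ.suc m times 1#) * n times 1#  ≈⟨ *-congˡ (⟦+⟧ n) ⟨
      ⟦ -[1+ m ] ⟧ℤ * ⟦ + n ⟧ℤ           ∎
    *-homo -[1+ m ] -[1+ n ] = begin
      ⟦ + (ℕ.suc m ℕ.* ℕ.suc n) ⟧ℤ                ≈⟨ ⟦+⟧ (ℕ.suc m ℕ.* ℕ.suc n) ⟩
      (ℕ.suc m ℕ.* ℕ.suc n) times 1#              ≈⟨ ×1-homo-* (ℕ.suc m) (ℕ.suc n) ⟩
      ℕ.suc m times 1# * ℕ.suc n times 1#         ≈⟨ -‿involutive _ ⟨
      - - (ℕ.suc m times 1# * ℕ.suc n times 1#)   ≈⟨ -‿cong (-‿distribˡ-* _ _) ⟩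
      - (- (ℕ.suc m times 1#) * ℕ.suc n times 1#) ≈⟨ -‿distribʳ-* _ _ ⟩
      ⟦ -[1+ m ] ⟧ℤ * ⟦ -[1+ n ] ⟧ℤ               ∎

    -‿homo : ∀ x → ⟦ ℤ.- x ⟧ℤ ≈ - ⟦ x ⟧ℤ
    -‿homo (+ n)    = ≈-trans (⟦-⟧ n) (-‿cong (≈-sym (⟦+⟧ n)))
    -‿homo -[1+ n ] = ≈-trans (⟦+⟧ (ℕ.suc n)) (≈-sym (-‿involutive _))

    morphism : ℤ.+-*-rawRing -Raw-AlmostCommutative⟶ fromCommutativeRing R
    morphism = record
      { ⟦_⟧    = ⟦_⟧ℤ
      ; +-homo = +-homo
      ; *-homo = *-homo
      ; -‿homo = -‿homo
      ; 0-homo = ≈-refl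
      ; 1-homo = ≈-refl
      }

    -- Decided on the integers. `R` comes with no decision procedure for `_≈_`, so coefficients
    -- taken from `R` itself could not be seen to cancel.
    _coeff≟_ : ∀ x y → Maybe (⟦ x ⟧ℤ ≈ ⟦ y ⟧ℤ)
    x coeff≟ y with x ℤ.≟ y
    ... | yes refl = just ≈-refl
    ... | no  _    = nothing

  open RingSolver ℤ.+-*-rawRing (fromCommutativeRing R) morphism _coeff≟_ public
    using (Polynomial; solve; con; _:+_; _:*_; _:-_; :-_; _:^_; _:=_)

  :0 :1 : ∀ {n} → Polynomial n
  :0 = con (+ 0)
  :1 = con (+ 1)

  -- Built from sums so that it denotes `fromℕ k` definitionally for every `k`; `con (+ 1)` denotes
  -- `1#`, while `fromℕ 1` is `1# + 0#`.
  :ℕ : ∀ {n} → ℕ → Polynomial n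
  :ℕ ℕ.zero    = :0
  :ℕ (ℕ.suc k) = :1 :+ :ℕ k

-- Arithmetic and completeness of an ordered field

module OrderedField (em : ExcludedMiddle 0ℓ) (ℝ : Reals) where

  open Reals ℝ hiding (zero; _-_) public
  open CommutativeRing commutativeRing using (_-_) public
  open IntegerSolver commutativeRing public
  open SemiringMult semiring using (×-homo-+; ×1-homo-*)
  open SemiringExp semiring public using (^-congˡ; ^-homo-*; ^-assocʳ)
  open CommutativeExp commutativeSemiring public using (^-distrib-*)

  open IsTotalOrder isTotalOrder public
    using (isPartialOrder) renaming (refl to ≤-refl; trans to ≤-trans; reflexive to ≤-reflexive)

  poset : Poset 0ℓ 0ℓ 0ℓ
  poset = record { isPartialOrder = isPartialOrder }

  module ≤-Reasoning = PartialOrderReasoning poset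

  private
    module Strict = NonStrictToStrict _≈_ _≤_
    variable
      x y z w x′ y′ : Carrier

  <⇒≤ : x < y → x ≤ y
  <⇒≤ = Strict.<⇒≤

  <-≤-trans : x < y → y ≤ z → x < z
  <-≤-trans = Strict.<-≤-trans ≈-sym ≤-trans antisym ≤-respʳ-≈

  ≤-<-trans : x ≤ y → y < z → x < z
  ≤-<-trans = Strict.≤-<-trans ≤-trans antisym ≤-respˡ-≈

  <-trans : x < y → y < z → x < z
  <-trans = Strict.<-trans isPartialOrder

  <⇒≱ : x < y → ¬ (y ≤ x)
  <⇒≱ = Strict.<⇒≱ antisym

  ≤-<-connex : ∀ x y → x ≤ y ⊎ y < x
  ≤-<-connex x y with em {x ≤ y}
  ... | yes x≤y = inj₁ x≤y
  ... | no  x≰y = inj₂ (Strict.≰⇒> ≈-sym ≤-reflexive total x≰y)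

  ≮⇒≥ : ¬ (x < y) → y ≤ x
  ≮⇒≥ {x} {y} x≮y = [ (λ y≤x → y≤x) , (λ x<y → contradiction x<y x≮y) ]′ (≤-<-connex y x)

  <-respˡ : x ≈ y → x < z → y < z
  <-respˡ x≈y = ≤-<-trans (≤-reflexive (≈-sym x≈y))

  <-respʳ : x ≈ y → z < x → z < y
  <-respʳ x≈y z<x = <-≤-trans z<x (≤-reflexive x≈y)

  0<⇒≉0 : 0# < x → ¬ (x ≈ 0#)
  0<⇒≉0 0<x x≈0 = proj₂ 0<x (≈-sym x≈0)

  +-monoʳ-≤ : ∀ z → x ≤ y → z + x ≤ z + y
  +-monoʳ-≤ z x≤y = ≤-respˡ-≈ (+-comm _ z) (≤-respʳ-≈ (+-comm _ z) (+-monoˡ-≤ z x≤y))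

  +-mono-≤ : x ≤ y → z ≤ w → x + z ≤ y + w
  +-mono-≤ {y = y} {z = z} x≤y z≤w = ≤-trans (+-monoˡ-≤ z x≤y) (+-monoʳ-≤ y z≤w)

  x≤y⇒0≤y-x : x ≤ y → 0# ≤ y - x
  x≤y⇒0≤y-x {x} x≤y = ≤-respˡ-≈ (-‿inverseʳ x) (+-monoˡ-≤ (- x) x≤y)

  -- Inequalities are mostly proved by exhibiting the difference of the two
  -- sides as a visibly nonnegative term and leaving the rest to the solver.
  ≤-diff : ∀ d → 0# ≤ d → y - x ≈ d → x ≤ y
  ≤-diff {y} {x} d 0≤d y-x≈d = ≤-respˡ-≈ (+-identityˡ x)
    (≤-respʳ-≈ (≈-trans (+-congʳ (≈-sym y-x≈d)) (solve 2 (λ x y → y :- x :+ x := y) ≈-refl x y))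
      (+-monoˡ-≤ x 0≤d))

  <-diff : ∀ d → 0# < d → y - x ≈ d → x < y
  <-diff {y} {x} d 0<d y-x≈d = ≤-diff d (<⇒≤ 0<d) y-x≈d , λ x≈y →
    0<⇒≉0 0<d (≈-trans (≈-sym y-x≈d) (≈-trans (+-congˡ (-‿cong x≈y)) (-‿inverseʳ y)))

  x<y⇒0<y-x : x < y → 0# < y - x
  x<y⇒0<y-x {x} {y} (x≤y , x≉y) = x≤y⇒0≤y-x x≤y , λ 0≈d → x≉y
    (≈-trans (≈-sym (+-identityˡ x)) (≈-trans (+-congʳ 0≈d) (solve 2 (λ x y → y :- x :+ x := y) ≈-refl x y)))

  +-nonneg : 0# ≤ x → 0# ≤ y → 0# ≤ x + y
  +-nonneg 0≤x 0≤y = ≤-respˡ-≈ (+-identityˡ 0#) (+-mono-≤ 0≤x 0≤y)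

  x≤x+y : 0# ≤ y → x ≤ x + y
  x≤x+y {y} {x} 0≤y = ≤-diff y 0≤y (solve 2 (λ x y → x :+ y :- x := y) ≈-refl x y)

  -‿anti-≤ : x ≤ y → - y ≤ - x
  -‿anti-≤ {x} {y} x≤y = ≤-diff _ (x≤y⇒0≤y-x x≤y) (solve 2 (λ x y → :- x :- (:- y) := y :- x) ≈-refl x y)

  *-monoˡ-≤ : 0# ≤ z → x ≤ y → z * x ≤ z * y
  *-monoˡ-≤ {z} {x} {y} 0≤z x≤y = ≤-diff _ (*-nonneg 0≤z (x≤y⇒0≤y-x x≤y))
    (solve 3 (λ x y z → z :* y :- z :* x := z :* (y :- x)) ≈-refl x y z)

  *-monoʳ-≤ : 0# ≤ z → x ≤ y → x * z ≤ y * z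
  *-monoʳ-≤ {z} 0≤z x≤y = ≤-respˡ-≈ (*-comm z _) (≤-respʳ-≈ (*-comm z _) (*-monoˡ-≤ 0≤z x≤y))

  *-mono-≤ : 0# ≤ x → 0# ≤ z → x ≤ y → z ≤ w → x * z ≤ y * w
  *-mono-≤ 0≤x 0≤z x≤y z≤w = ≤-trans (*-monoʳ-≤ 0≤z x≤y) (*-monoˡ-≤ (≤-trans 0≤x x≤y) z≤w)

  0≤x*x : ∀ x → 0# ≤ x * x
  0≤x*x x with total 0# x
  ... | inj₁ 0≤x = *-nonneg 0≤x 0≤x
  ... | inj₂ x≤0 = ≤-respʳ-≈ (solve 1 (λ x → (:0 :- x) :* (:0 :- x) := x :* x) ≈-refl x)
    (*-nonneg (x≤y⇒0≤y-x x≤0) (x≤y⇒0≤y-x x≤0))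

  0<1 : 0# < 1#
  0<1 = ≤-respʳ-≈ (*-identityˡ 1#) (0≤x*x 1#) , 0≉1

  0≤1 : 0# ≤ 1#
  0≤1 = <⇒≤ 0<1

  1≤⇒0< : 1# ≤ x → 0# < x
  1≤⇒0< = <-≤-trans 0<1

  *-pos : 0# < x → 0# < y → 0# < x * y
  *-pos {x} {y} 0<x 0<y = *-nonneg (<⇒≤ 0<x) (<⇒≤ 0<y) , λ 0≈xy → 0<⇒≉0 0<y (begin-equality
    y                  ≈⟨ *-identityˡ y ⟨
    1# * y             ≈⟨ *-congʳ (⁻¹-inverseʳ (0<⇒≉0 0<x)) ⟨
    x * x ⁻¹ * y       ≈⟨ solve 3 (λ x y z → x :* z :* y := z :* (x :* y)) ≈-refl x y (x ⁻¹) ⟩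
    x ⁻¹ * (x * y)     ≈⟨ *-congˡ 0≈xy ⟨
    x ⁻¹ * 0#          ≈⟨ zeroʳ _ ⟩
    0#                 ∎)
    where open ≤-Reasoning

  *-monoˡ-< : 0# < z → x < y → z * x < z * y
  *-monoˡ-< {z} {x} {y} 0<z x<y = <-diff _ (*-pos 0<z (x<y⇒0<y-x x<y))
    (solve 3 (λ x y z → z :* y :- z :* x := z :* (y :- x)) ≈-refl x y z)

  *-cancelˡ-≤ : 0# < z → z * x ≤ z * y → x ≤ y
  *-cancelˡ-≤ 0<z zx≤zy = ≮⇒≥ λ y<x → <⇒≱ (*-monoˡ-< 0<z y<x) zx≤zy

  *-cancelˡ-≈ : 0# < z → z * x ≈ z * y → x ≈ y
  *-cancelˡ-≈ 0<z eq = antisym (*-cancelˡ-≤ 0<z (≤-reflexive eq)) (*-cancelˡ-≤ 0<z (≤-reflexive (≈-sym eq)))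

  *-cancelˡ-pos : 0# ≤ x → 0# < x * y → 0# < y
  *-cancelˡ-pos {x} {y} 0≤x 0<xy with ≤-<-connex y 0#
  ... | inj₂ 0<y = 0<y
  ... | inj₁ y≤0 = contradiction (≤-respʳ-≈ (zeroʳ x) (*-monoˡ-≤ 0≤x y≤0)) (<⇒≱ 0<xy)

  x*x⁻¹≈1 : 0# < x → x * x ⁻¹ ≈ 1#
  x*x⁻¹≈1 0<x = ⁻¹-inverseʳ (0<⇒≉0 0<x)

  ⁻¹-pos : 0# < x → 0# < x ⁻¹
  ⁻¹-pos 0<x = *-cancelˡ-pos (<⇒≤ 0<x) (<-respʳ (≈-sym (x*x⁻¹≈1 0<x)) 0<1)

  ^-nonneg : ∀ n → 0# ≤ x → 0# ≤ x ^ n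
  ^-nonneg ℕ.zero    0≤x = 0≤1
  ^-nonneg (ℕ.suc n) 0≤x = *-nonneg 0≤x (^-nonneg n 0≤x)

  ^-pos : ∀ n → 0# < x → 0# < x ^ n
  ^-pos ℕ.zero    0<x = 0<1
  ^-pos (ℕ.suc n) 0<x = *-pos 0<x (^-pos n 0<x)

  ^-monoˡ-≤ : ∀ n → 0# ≤ x → x ≤ y → x ^ n ≤ y ^ n
  ^-monoˡ-≤ ℕ.zero    0≤x x≤y = ≤-refl
  ^-monoˡ-≤ (ℕ.suc n) 0≤x x≤y = *-mono-≤ 0≤x (^-nonneg n 0≤x) x≤y (^-monoˡ-≤ n 0≤x x≤y)

  1≤^ : ∀ n → 1# ≤ x → 1# ≤ x ^ n
  1≤^ ℕ.zero    1≤x = ≤-refl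
  1≤^ (ℕ.suc n) 1≤x = ≤-respˡ-≈ (*-identityˡ 1#) (*-mono-≤ 0≤1 0≤1 1≤x (1≤^ n 1≤x))

  ^-anti-≤ : ∀ {m n} → 0# ≤ x → x ≤ 1# → m ℕ.≤ n → x ^ n ≤ x ^ m
  ^-anti-≤ {n = ℕ.zero}  0≤x x≤1 z≤n = ≤-refl
  ^-anti-≤ {n = ℕ.suc n} 0≤x x≤1 z≤n = ≤-respʳ-≈ (*-identityˡ 1#)
    (*-mono-≤ 0≤x (^-nonneg n 0≤x) x≤1 (^-anti-≤ {n = n} 0≤x x≤1 z≤n))
  ^-anti-≤ 0≤x x≤1 (s≤s m≤n) = *-monoˡ-≤ 0≤x (^-anti-≤ 0≤x x≤1 m≤n)

  1^n≈1 : ∀ n → 1# ^ n ≈ 1#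
  1^n≈1 ℕ.zero    = ≈-refl
  1^n≈1 (ℕ.suc n) = ≈-trans (*-identityˡ _) (1^n≈1 n)

  ⁻¹-^ : ∀ n → 0# < x → x ^ n * (x ⁻¹) ^ n ≈ 1#
  ⁻¹-^ {x} n 0<x = ≈-trans (≈-sym (^-distrib-* x (x ⁻¹) n)) (≈-trans (^-congˡ n (x*x⁻¹≈1 0<x)) (1^n≈1 n))

  0≤fromℕ : ∀ n → 0# ≤ fromℕ n
  0≤fromℕ ℕ.zero    = ≤-refl
  0≤fromℕ (ℕ.suc n) = +-nonneg 0≤1 (0≤fromℕ n)

  1≤fromℕ-suc : ∀ n → 1# ≤ fromℕ (ℕ.suc n)
  1≤fromℕ-suc n = x≤x+y (0≤fromℕ n)

  0<fromℕ-suc : ∀ n → 0# < fromℕ (ℕ.suc n)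
  0<fromℕ-suc n = 1≤⇒0< (1≤fromℕ-suc n)

  fromℕ-mono-≤ : ∀ {m n} → m ℕ.≤ n → fromℕ m ≤ fromℕ n
  fromℕ-mono-≤ {n = n} z≤n = 0≤fromℕ n
  fromℕ-mono-≤ (s≤s m≤n) = +-monoʳ-≤ 1# (fromℕ-mono-≤ m≤n)

  fromℕ-cancel-≤ : ∀ {m n} → fromℕ m ≤ fromℕ n → m ℕ.≤ n
  fromℕ-cancel-≤ {m} {n} m≤n = ℕ.≮⇒≥ λ n<m → <⇒≱
    (<-≤-trans (<-diff _ 0<1 (solve 1 (λ n → :1 :+ n :- n := :1) ≈-refl (fromℕ n))) (fromℕ-mono-≤ n<m)) m≤n

  fromℕ-+ : ∀ m n → fromℕ (m ℕ.+ n) ≈ fromℕ m + fromℕ n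
  fromℕ-+ = ×-homo-+ 1#

  fromℕ-* : ∀ m n → fromℕ (m ℕ.* n) ≈ fromℕ m * fromℕ n
  fromℕ-* = ×1-homo-*

  n≈fromℕ : ∀ n x → fromℕ (ℕ.suc n) * x ≈ x + fromℕ n * x
  n≈fromℕ n x = solve 2 (λ n x → (:1 :+ n) :* x := x :+ n :* x) ≈-refl (fromℕ n) x

  -- Were the naturals bounded, they would have a supremum `s`; since the successor of a natural is
  -- again one, `s - 1#` would bound them as well.
  archimedean : ∀ x → ∃ λ n → x < fromℕ n
  archimedean x with em {∃ λ n → x < fromℕ n}
  ... | yes found = found
  ... | no  ∄n    = contradiction s≤s-1 (<⇒≱ (<-diff 1# 0<1 (solve 1 (λ s → s :- (s :- :1) := :1) ≈-refl s)))
    where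
    IsNat : Carrier → Set
    IsNat y = ∃ λ n → fromℕ n ≈ y

    supremum = complete IsNat (0# , 0 , ≈-refl)
      (x , λ { (n , n≈y) → ≤-respˡ-≈ n≈y (≮⇒≥ λ x<n → ∄n (n , x<n)) })
    s = proj₁ supremum

    s≤s-1 : s ≤ s - 1#
    s≤s-1 = proj₂ (proj₂ supremum) λ { (n , n≈y) → ≤-respˡ-≈ n≈y
      (≤-diff _ (x≤y⇒0≤y-x (proj₁ (proj₂ supremum) (ℕ.suc n , ≈-refl)))
        (solve 2 (λ s n → s :- :1 :- n := s :- (:1 :+ n)) ≈-refl s (fromℕ n))) }

  floor : 0# ≤ x → ∃ λ n → fromℕ n ≤ x × x < fromℕ (ℕ.suc n)
  floor {x} 0≤x = below (proj₁ (archimedean x)) (proj₂ (archimedean x))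
    where
    below : ∀ n → x < fromℕ n → ∃ λ n → fromℕ n ≤ x × x < fromℕ (ℕ.suc n)
    below ℕ.zero x<0 = contradiction 0≤x (<⇒≱ x<0)
    below (ℕ.suc n) x<1+n with ≤-<-connex (fromℕ n) x
    ... | inj₁ n≤x = n , n≤x , x<1+n
    ... | inj₂ x<n = below n x<n

  bernoulli : ∀ n → 0# ≤ x → 1# + fromℕ n * x ≤ (1# + x) ^ n
  bernoulli {x} ℕ.zero    0≤x = ≤-reflexive (solve 1 (λ x → :1 :+ :0 :* x := :1) ≈-refl x)
  bernoulli {x} (ℕ.suc n) 0≤x = ≤-trans
    (≤-diff _ (*-nonneg (0≤fromℕ n) (0≤x*x x))
      (solve 2 (λ n x → (:1 :+ x) :* (:1 :+ n :* x) :- (:1 :+ (:1 :+ n) :* x) := n :* (x :* x)) ≈-refl (fromℕ n) x))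
    (*-monoˡ-≤ (+-nonneg 0≤1 0≤x) (bernoulli n 0≤x))

-- The exponential series, `exp` and `ln`

module Exponential (em : ExcludedMiddle 0ℓ) (ℝ : Reals) where

  open OrderedField em ℝ
  open Classical em ℝ
  open ≤-Reasoning

  -- New terms enter at the end, unlike in `sum`, so that the partial sums of one series extend each
  -- other definitionally.
  S : (ℕ → Carrier) → ℕ → Carrier
  S f ℕ.zero    = 0#
  S f (ℕ.suc n) = S f n + f n

  S-cong : ∀ {f g} → (∀ k → f k ≈ g k) → ∀ n → S f n ≈ S g n
  S-cong f≈g ℕ.zero    = ≈-refl
  S-cong f≈g (ℕ.suc n) = +-cong (S-cong f≈g n) (f≈g n)

  S-front : ∀ f n → S f (ℕ.suc n) ≈ f 0 + S (f ∘ ℕ.suc) n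
  S-front f ℕ.zero    = +-comm 0# (f 0)
  S-front f (ℕ.suc n) = ≈-trans (+-congʳ (S-front f n)) (+-assoc _ _ _)

  sum≈S : ∀ f n → sum {n} (f ∘ toℕ) ≈ S f n
  sum≈S f ℕ.zero    = ≈-refl
  sum≈S f (ℕ.suc n) = ≈-trans (+-congˡ (sum≈S (f ∘ ℕ.suc) n)) (≈-sym (S-front f n))

  S-nonneg : ∀ {f} → (∀ k → 0# ≤ f k) → ∀ n → 0# ≤ S f n
  S-nonneg 0≤f ℕ.zero    = ≤-refl
  S-nonneg 0≤f (ℕ.suc n) = +-nonneg (S-nonneg 0≤f n) (0≤f n)

  S-mono : ∀ {f} → (∀ k → 0# ≤ f k) → ∀ {m n} → m ℕ.≤ n → S f m ≤ S f n
  S-mono 0≤f {n = n} z≤n = S-nonneg 0≤f n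
  S-mono {f} 0≤f {ℕ.suc m} {ℕ.suc n} (s≤s m≤n) with ℕ.m≤n⇒m<n∨m≡n m≤n
  ... | inj₁ m<n  = ≤-trans (S-mono 0≤f m<n) (x≤x+y (0≤f n))
  ... | inj₂ refl = ≤-refl

  conv : (ℕ → Carrier) → (ℕ → Carrier) → ℕ → Carrier
  conv a b ℕ.zero    = a 0 * b 0
  conv a b (ℕ.suc k) = a 0 * b (ℕ.suc k) + conv (a ∘ ℕ.suc) b k

  -- The sum of a i * b j over i + j < n.
  tri : (ℕ → Carrier) → (ℕ → Carrier) → ℕ → Carrier
  tri a b ℕ.zero    = 0#
  tri a b (ℕ.suc n) = a 0 * S b (ℕ.suc n) + tri (a ∘ ℕ.suc) b n

  tri-suc : ∀ a b n → tri a b (ℕ.suc n) ≈ tri a b n + conv a b n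
  tri-suc a b ℕ.zero = solve 2 (λ a b → a :* (:0 :+ b) :+ :0 := :0 :+ a :* b) ≈-refl (a 0) (b 0)
  tri-suc a b (ℕ.suc n) = begin-equality
    a 0 * (S b (ℕ.suc n) + b (ℕ.suc n)) + tri (a ∘ ℕ.suc) b (ℕ.suc n)
      ≈⟨ +-congˡ (tri-suc (a ∘ ℕ.suc) b n) ⟩
    a 0 * (S b (ℕ.suc n) + b (ℕ.suc n)) + (tri (a ∘ ℕ.suc) b n + conv (a ∘ ℕ.suc) b n)
      ≈⟨ solve 5 (λ a s b t c → a :* (s :+ b) :+ (t :+ c) := (a :* s :+ t) :+ (a :* b :+ c)) ≈-refl
           (a 0) (S b (ℕ.suc n)) (b (ℕ.suc n)) _ _ ⟩
    tri a b (ℕ.suc n) + conv a b (ℕ.suc n) ∎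

  tri≈S-conv : ∀ a b n → tri a b n ≈ S (conv a b) n
  tri≈S-conv a b ℕ.zero    = ≈-refl
  tri≈S-conv a b (ℕ.suc n) = ≈-trans (tri-suc a b n) (+-congʳ (tri≈S-conv a b n))

  module _ {b : ℕ → Carrier} (0≤b : ∀ k → 0# ≤ b k) where

    -- The triangle i + j < n lies inside the square i, j < n, and all products are nonnegative.
    tri≤S*S : ∀ {a} → (∀ k → 0# ≤ a k) → ∀ n → tri a b n ≤ S a n * S b n
    tri≤S*S 0≤a ℕ.zero = ≤-reflexive (≈-sym (zeroˡ _))
    tri≤S*S {a} 0≤a (ℕ.suc n) = begin
      a 0 * S b (ℕ.suc n) + tri (a ∘ ℕ.suc) b n
        ≤⟨ +-monoʳ-≤ _ (tri≤S*S (0≤a ∘ ℕ.suc) n) ⟩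
      a 0 * S b (ℕ.suc n) + S (a ∘ ℕ.suc) n * S b n
        ≤⟨ +-monoʳ-≤ _ (*-monoˡ-≤ (S-nonneg (0≤a ∘ ℕ.suc) n) (S-mono 0≤b (ℕ.n≤1+n n))) ⟩
      a 0 * S b (ℕ.suc n) + S (a ∘ ℕ.suc) n * S b (ℕ.suc n)
        ≈⟨ distribʳ _ _ _ ⟨
      (a 0 + S (a ∘ ℕ.suc) n) * S b (ℕ.suc n)
        ≈⟨ *-congʳ (S-front a n) ⟨
      S a (ℕ.suc n) * S b (ℕ.suc n) ∎

    -- The rectangle i < m, j < n lies inside the triangle i + j < m + n.
    S*S≤tri : ∀ {a} → (∀ k → 0# ≤ a k) → ∀ m n → S a m * S b n ≤ tri a b (m ℕ.+ n)
    S*S≤tri {a} 0≤a ℕ.zero n = ≤-respˡ-≈ (≈-sym (zeroˡ _)) (tri-nonneg 0≤a n)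
      where
      tri-nonneg : ∀ {a} → (∀ k → 0# ≤ a k) → ∀ n → 0# ≤ tri a b n
      tri-nonneg 0≤a ℕ.zero    = ≤-refl
      tri-nonneg 0≤a (ℕ.suc n) =
        +-nonneg (*-nonneg (0≤a 0) (S-nonneg 0≤b (ℕ.suc n))) (tri-nonneg (0≤a ∘ ℕ.suc) n)
    S*S≤tri {a} 0≤a (ℕ.suc m) n = begin
      S a (ℕ.suc m) * S b n                          ≈⟨ *-congʳ (S-front a m) ⟩
      (a 0 + S (a ∘ ℕ.suc) m) * S b n                ≈⟨ distribʳ _ _ _ ⟩
      a 0 * S b n + S (a ∘ ℕ.suc) m * S b n
        ≤⟨ +-mono-≤ (*-monoˡ-≤ (0≤a 0) (S-mono 0≤b (ℕ.m≤n+m n (ℕ.suc m)))) (S*S≤tri (0≤a ∘ ℕ.suc) m n) ⟩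
      tri a b (ℕ.suc m ℕ.+ n)                        ∎

  infix 4 ∣_∣≤_

  -- A bound on the absolute value as two inequalities: `abs` is defined by cases, whereas this form
  -- passes through sums and products by algebra alone.
  ∣_∣≤_ : Carrier → Carrier → Set
  ∣ d ∣≤ D = - D ≤ d × d ≤ D

  ∣∣-resp : ∀ {d e D F} → d ≈ e → D ≈ F → ∣ d ∣≤ D → ∣ e ∣≤ F
  ∣∣-resp d≈e D≈F (l , u) =
    ≤-respˡ-≈ (-‿cong D≈F) (≤-respʳ-≈ d≈e l) , ≤-respʳ-≈ D≈F (≤-respˡ-≈ d≈e u)

  ∣∣-+ : ∀ {d e D F} → ∣ d ∣≤ D → ∣ e ∣≤ F → ∣ d + e ∣≤ D + F
  ∣∣-+ {d} {e} {D} {F} (l , u) (l′ , u′) =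
    ≤-respˡ-≈ (solve 2 (λ D F → :- D :+ :- F := :- (D :+ F)) ≈-refl D F) (+-mono-≤ l l′) , +-mono-≤ u u′

  ∣∣-neg : ∀ {d D} → ∣ d ∣≤ D → ∣ - d ∣≤ D
  ∣∣-neg {d} {D} (l , u) = -‿anti-≤ u , ≤-respʳ-≈ (solve 1 (λ D → :- (:- D) := D) ≈-refl D) (-‿anti-≤ l)

  ∣∣-* : ∀ {d e D F} → ∣ d ∣≤ D → ∣ e ∣≤ F → ∣ d * e ∣≤ D * F
  ∣∣-* {d} {e} {D} {F} d≤D e≤F =
    ≤-respʳ-≈ (solve 2 (λ d e → :- ((:- d) :* e) := d :* e) ≈-refl d e) (-‿anti-≤ (upper (∣∣-neg d≤D) e≤F)) ,
    upper d≤D e≤F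
    where
    upper : ∀ {d e D F} → ∣ d ∣≤ D → ∣ e ∣≤ F → d * e ≤ D * F
    upper {d} {e} {D} {F} (l , u) (l′ , u′) = *-cancelˡ-≤ (0<fromℕ-suc 1) (≤-diff _
      (+-nonneg (*-nonneg (x≤y⇒0≤y-x u) (x≤y⇒0≤y-x l′)) (*-nonneg (x≤y⇒0≤y-x l) (x≤y⇒0≤y-x u′)))
      (solve 4 (λ d e D F → :ℕ 2 :* (D :* F) :- :ℕ 2 :* (d :* e) :=
         (D :- d) :* (e :- (:- F)) :+ (d :- (:- D)) :* (F :- e)) ≈-refl d e D F))

  module _ {b B : ℕ → Carrier} (b≤B : ∀ k → ∣ b k ∣≤ B k) where

    S-tail-dominated : ∀ {m n} → m ℕ.≤ n → ∣ S b n - S b m ∣≤ S B n - S B m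
    S-tail-dominated {m} {n} m≤n with ℕ.m≤n⇒∃[o]m+o≡n m≤n
    ... | o , refl = go o
      where
      go : ∀ o → ∣ S b (m ℕ.+ o) - S b m ∣≤ S B (m ℕ.+ o) - S B m
      go ℕ.zero rewrite ℕ.+-identityʳ m =
        ≤-reflexive (solve 2 (λ s S → :- (S :- S) := s :- s) ≈-refl (S b m) (S B m)) ,
        ≤-reflexive (solve 2 (λ s S → s :- s := S :- S) ≈-refl (S b m) (S B m))
      go (ℕ.suc o) rewrite ℕ.+-suc m o = ∣∣-resp (shift _ _ _) (shift _ _ _) (∣∣-+ (go o) (b≤B (m ℕ.+ o)))
        where
        shift : ∀ s t u → s - t + u ≈ s + u - t
        shift = solve 3 (λ s t u → s :- t :+ u := s :+ u :- t) ≈-refl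

    -- As m ≤ n, the triangle i + j < m lies in the rectangle i < m, j < n. Either difference is the
    -- sum over the rest of the rectangle, so one dominates the other term by term.
    S*S-tri-dominated : ∀ {a A} → (∀ k → ∣ a k ∣≤ A k) → ∀ {m n} → m ℕ.≤ n →
                        ∣ S a m * S b n - tri a b m ∣≤ S A m * S B n - tri A B m
    S*S-tri-dominated a≤A {ℕ.zero} {n} m≤n =
      ≤-reflexive (solve 2 (λ s S → :- (:0 :* S :- :0) := :0 :* s :- :0) ≈-refl (S b n) (S B n)) ,
      ≤-reflexive (solve 2 (λ s S → :0 :* s :- :0 := :0 :* S :- :0) ≈-refl (S b n) (S B n))
    S*S-tri-dominated {a} {A} a≤A {ℕ.suc m} {n} m≤n =
      ∣∣-resp (split a b) (split A B)
        (∣∣-+ (∣∣-* (a≤A 0) (S-tail-dominated m≤n))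
              (S*S-tri-dominated (a≤A ∘ ℕ.suc) (ℕ.≤-trans (ℕ.n≤1+n m) m≤n)))
      where
      split : ∀ a b → a 0 * (S b n - S b (ℕ.suc m)) + (S (a ∘ ℕ.suc) m * S b n - tri (a ∘ ℕ.suc) b m)
                      ≈ S a (ℕ.suc m) * S b n - tri a b (ℕ.suc m)
      split a b = ≈-trans
        (solve 5 (λ a s s′ S t → a :* (s :- s′) :+ (S :* s :- t) := (a :+ S) :* s :- (a :* s′ :+ t)) ≈-refl
           (a 0) (S b n) (S b (ℕ.suc m)) (S (a ∘ ℕ.suc) m) (tri (a ∘ ℕ.suc) b m))
        (+-congʳ (*-congʳ (≈-sym (S-front a m))))

  term : Carrier → ℕ → Carrier
  term x k = x ^ k / fromℕ (k !)

  E : Carrier → ℕ → Carrier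
  E x = S (term x)

  private
    0<k! : ∀ k → 0# < fromℕ (k !)
    0<k! k = 1≤⇒0< (≤-respˡ-≈ (+-identityʳ 1#) (fromℕ-mono-≤ (ℕ.1≤n! k)))

    term-* : ∀ x k → fromℕ (k !) * term x k ≈ x ^ k
    term-* x k = begin-equality
      fromℕ (k !) * (x ^ k * fromℕ (k !) ⁻¹)
        ≈⟨ solve 3 (λ f p i → f :* (p :* i) := (f :* i) :* p) ≈-refl (fromℕ (k !)) (x ^ k) (fromℕ (k !) ⁻¹) ⟩
      fromℕ (k !) * fromℕ (k !) ⁻¹ * x ^ k  ≈⟨ *-congʳ (x*x⁻¹≈1 (0<k! k)) ⟩
      1# * x ^ k                            ≈⟨ *-identityˡ _ ⟩
      x ^ k                                 ∎

  term-0 : ∀ x → term x 0 ≈ 1#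
  term-0 x = *-cancelˡ-≈ (0<k! 0) (≈-trans (term-* x 0)
    (solve 0 (:1 := :ℕ 1 :* :1) ≈-refl))

  -- The offset m is there because the recurrence is applied to shifted sequences.
  Rec : Carrier → Carrier → (ℕ → Carrier) → Set
  Rec m x a = ∀ k → (m + fromℕ (ℕ.suc k)) * a (ℕ.suc k) ≈ x * a k

  Rec-shift : ∀ {m x a} → Rec m x a → Rec (m + 1#) x (a ∘ ℕ.suc)
  Rec-shift {m} rec k = ≈-trans
    (*-congʳ (solve 2 (λ m k → m :+ :1 :+ (:1 :+ k) := m :+ (:1 :+ (:1 :+ k))) ≈-refl m (fromℕ k)))
    (rec (ℕ.suc k))

  term-rec : ∀ x → Rec 0# x (term x)
  term-rec x k = *-cancelˡ-≈ (0<k! k) (begin-equality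
    fromℕ (k !) * ((0# + fromℕ (ℕ.suc k)) * term x (ℕ.suc k))
      ≈⟨ solve 3 (λ f k t → f :* ((:0 :+ k) :* t) := (k :* f) :* t) ≈-refl (fromℕ (k !)) (fromℕ (ℕ.suc k)) _ ⟩
    fromℕ (ℕ.suc k) * fromℕ (k !) * term x (ℕ.suc k) ≈⟨ *-congʳ (fromℕ-* (ℕ.suc k) (k !)) ⟨
    fromℕ (ℕ.suc k !) * term x (ℕ.suc k)             ≈⟨ term-* x (ℕ.suc k) ⟩
    x * x ^ k                                        ≈⟨ *-congˡ (term-* x k) ⟨
    x * (fromℕ (k !) * term x k)
      ≈⟨ solve 3 (λ x f t → x :* (f :* t) := f :* (x :* t)) ≈-refl x (fromℕ (k !)) _ ⟩
    fromℕ (k !) * (x * term x k)                     ∎)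

  rec-unique : ∀ {x a} → a 0 ≈ 1# → Rec 0# x a → ∀ k → a k ≈ term x k
  rec-unique {x} a0 rec ℕ.zero    = ≈-trans a0 (≈-sym (term-0 x))
  rec-unique {x} {a} a0 rec (ℕ.suc k) = *-cancelˡ-≈ (<-respʳ (≈-sym (+-identityˡ _)) (0<fromℕ-suc k))
    (≈-trans (rec k) (≈-trans (*-congˡ (rec-unique a0 rec k)) (≈-sym (term-rec x k))))

  -- In each summand `a i * b j` with i + j = k + 1, split the factor m + k + 1 as (m + i) + j and
  -- apply the recurrence of `a` to one part and that of `b` to the other. For i = 0 the first
  -- recurrence says nothing, which leaves the term with `m`; it vanishes for m = 0.
  conv-rec : ∀ {m x y a b} → Rec m x a → Rec 0# y b → ∀ k →
             (m + fromℕ (ℕ.suc k)) * conv a b (ℕ.suc k) ≈ m * (a 0 * b (ℕ.suc k)) + (x + y) * conv a b k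
  conv-rec {m} {x} {y} {a} {b} ra rb ℕ.zero = begin-equality
    (m + fromℕ 1) * (a 0 * b 1 + a 1 * b 0)
      ≈⟨ solve 5 (λ m a a′ b b′ → (m :+ :ℕ 1) :* (a :* b′ :+ a′ :* b) :=
           m :* (a :* b′) :+ (a :* ((:0 :+ :ℕ 1) :* b′) :+ ((m :+ :ℕ 1) :* a′) :* b)) ≈-refl m (a 0) (a 1) (b 0) (b 1) ⟩
    m * (a 0 * b 1) + (a 0 * ((0# + fromℕ 1) * b 1) + (m + fromℕ 1) * a 1 * b 0)
      ≈⟨ +-congˡ (+-cong (*-congˡ (rb 0)) (*-congʳ (ra 0))) ⟩
    m * (a 0 * b 1) + (a 0 * (y * b 0) + x * a 0 * b 0)
      ≈⟨ +-congˡ (solve 4 (λ a b x y → a :* (y :* b) :+ x :* a :* b := (x :+ y) :* (a :* b)) ≈-refl (a 0) (b 0) x y) ⟩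
    m * (a 0 * b 1) + (x + y) * (a 0 * b 0) ∎
  conv-rec {m} {x} {y} {a} {b} ra rb (ℕ.suc k) = begin-equality
    (m + fromℕ (2 ℕ.+ k)) * (a 0 * b (2 ℕ.+ k) + c₁)
      ≈⟨ solve 5 (λ m k a b c → (m :+ (:1 :+ (:1 :+ k))) :* (a :* b :+ c) :=
           m :* (a :* b) :+ (a :* ((:0 :+ (:1 :+ (:1 :+ k))) :* b) :+ ((m :+ :1) :+ (:1 :+ k)) :* c)) ≈-refl m (fromℕ k) (a 0) (b (2 ℕ.+ k)) c₁ ⟩
    m * (a 0 * b (2 ℕ.+ k)) + (a 0 * ((0# + fromℕ (2 ℕ.+ k)) * b (2 ℕ.+ k)) + (m + 1# + fromℕ (ℕ.suc k)) * c₁)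
      ≈⟨ +-congˡ (+-cong (*-congˡ (rb (ℕ.suc k))) (conv-rec (Rec-shift ra) rb k)) ⟩
    m * (a 0 * b (2 ℕ.+ k)) + (a 0 * (y * b (ℕ.suc k)) + ((m + 1#) * (a 1 * b (ℕ.suc k)) + (x + y) * c₀))
      ≈⟨ +-congˡ (+-congˡ (+-congʳ (solve 3 (λ m a b → (m :+ :1) :* (a :* b) := ((m :+ :ℕ 1) :* a) :* b) ≈-refl m (a 1) (b (ℕ.suc k))))) ⟩
    m * (a 0 * b (2 ℕ.+ k)) + (a 0 * (y * b (ℕ.suc k)) + ((m + fromℕ 1) * a 1 * b (ℕ.suc k) + (x + y) * c₀))
      ≈⟨ +-congˡ (+-congˡ (+-congʳ (*-congʳ (ra 0)))) ⟩
    m * (a 0 * b (2 ℕ.+ k)) + (a 0 * (y * b (ℕ.suc k)) + (x * a 0 * b (ℕ.suc k) + (x + y) * c₀))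
      ≈⟨ +-congˡ (solve 5 (λ a b x y c → a :* (y :* b) :+ (x :* a :* b :+ (x :+ y) :* c) :=
           (x :+ y) :* (a :* b :+ c)) ≈-refl (a 0) (b (ℕ.suc k)) x y c₀) ⟩
    m * (a 0 * b (2 ℕ.+ k)) + (x + y) * (a 0 * b (ℕ.suc k) + c₀) ∎
    where
    c₁ = conv (a ∘ ℕ.suc) b (ℕ.suc k)
    c₀ = conv (a ∘ ℕ.suc) b k

  -- The binomial theorem divided by k!, from the recurrence rather than from binomial coefficients.
  conv-term : ∀ x y k → conv (term x) (term y) k ≈ term (x + y) k
  conv-term x y = rec-unique (≈-trans (*-cong (term-0 x) (term-0 y)) (*-identityˡ 1#)) λ k →
    ≈-trans (conv-rec (term-rec x) (term-rec y) k) (solve 2 (λ u v → :0 :* u :+ v := v) ≈-refl _ _)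

  tri-term : ∀ x y n → tri (term x) (term y) n ≈ E (x + y) n
  tri-term x y n = ≈-trans (tri≈S-conv _ _ n) (S-cong (conv-term x y) n)

  term-cong : ∀ {x y} → x ≈ y → ∀ k → term x k ≈ term y k
  term-cong x≈y k = *-congʳ (^-congˡ k x≈y)

  term-nonneg : ∀ {x} → 0# ≤ x → ∀ k → 0# ≤ term x k
  term-nonneg 0≤x k = *-nonneg (^-nonneg k 0≤x) (<⇒≤ (⁻¹-pos (0<k! k)))

  E-+-≤ : ∀ {x y} → 0# ≤ x → 0# ≤ y → ∀ n → E (x + y) n ≤ E x n * E y n
  E-+-≤ {x} {y} 0≤x 0≤y n =
    ≤-respˡ-≈ (tri-term x y n) (tri≤S*S (term-nonneg 0≤y) (term-nonneg 0≤x) n)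

  E-+-≥ : ∀ {x y} → 0# ≤ x → 0# ≤ y → ∀ m n → E x m * E y n ≤ E (x + y) (m ℕ.+ n)
  E-+-≥ {x} {y} 0≤x 0≤y m n =
    ≤-respʳ-≈ (tri-term x y (m ℕ.+ n)) (S*S≤tri (term-nonneg 0≤y) (term-nonneg 0≤x) m n)

  E-2 : ∀ x → E x 2 ≈ 1# + x
  E-2 x = begin-equality
    0# + term x 0 + term x 1       ≈⟨ +-cong (+-congˡ (term-0 x)) (≈-trans (≈-sym (*-identityˡ _)) (≈-trans (*-congʳ (solve 0 (:1 := :0 :+ :ℕ 1) ≈-refl)) (term-rec x 0))) ⟩
    0# + 1# + x * term x 0         ≈⟨ +-congˡ (*-congˡ (term-0 x)) ⟩
    0# + 1# + x * 1#               ≈⟨ solve 1 (λ x → :0 :+ :1 :+ x :* :1 := :1 :+ x) ≈-refl x ⟩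
    1# + x                         ∎

  -- Comparison with the geometric series: `term x k ≤ x ^ k`, and 1 - x times the partial geometric
  -- sum is 1 - x^n. The product form also covers x = 1.
  [1-x]E≤1 : ∀ {x} → 0# ≤ x → x ≤ 1# → ∀ n → (1# - x) * E x n ≤ 1#
  [1-x]E≤1 {x} 0≤x x≤1 n = ≤-trans (x≤x+y (^-nonneg n 0≤x)) (go n)
    where
    term≤^ : ∀ k → term x k ≤ x ^ k
    term≤^ k = ≤-respʳ-≈ (term-* x k) (≤-respˡ-≈ (*-identityˡ _)
      (*-monoʳ-≤ (term-nonneg 0≤x k) (≤-respˡ-≈ (+-identityʳ 1#) (fromℕ-mono-≤ (ℕ.1≤n! k)))))

    go : ∀ n → (1# - x) * E x n + x ^ n ≤ 1#
    go ℕ.zero    = ≤-reflexive (solve 1 (λ x → (:1 :- x) :* :0 :+ :1 := :1) ≈-refl x)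
    go (ℕ.suc n) = begin
      (1# - x) * (E x n + term x n) + x * x ^ n
        ≤⟨ +-monoˡ-≤ _ (*-monoˡ-≤ (x≤y⇒0≤y-x x≤1) (+-monoʳ-≤ _ (term≤^ n))) ⟩
      (1# - x) * (E x n + x ^ n) + x * x ^ n
        ≈⟨ solve 3 (λ x e p → (:1 :- x) :* (e :+ p) :+ x :* p := (:1 :- x) :* e :+ p) ≈-refl x (E x n) (x ^ n) ⟩
      (1# - x) * E x n + x ^ n  ≤⟨ go n ⟩
      1#                        ∎

  ½ : Carrier
  ½ = fromℕ 2 ⁻¹

  2½≈1 : fromℕ 2 * ½ ≈ 1#
  2½≈1 = x*x⁻¹≈1 (0<fromℕ-suc 1)

  0<½ : 0# < ½
  0<½ = ⁻¹-pos (0<fromℕ-suc 1)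

  ½+½≈1 : ½ + ½ ≈ 1#
  ½+½≈1 = ≈-trans (solve 1 (λ h → h :+ h := :ℕ 2 :* h) ≈-refl ½) 2½≈1

  ½≤1 : ½ ≤ 1#
  ½≤1 = ≤-diff ½ (<⇒≤ 0<½) (≈-trans (+-congʳ (≈-sym ½+½≈1)) (solve 1 (λ h → h :+ h :- h := h) ≈-refl ½))

  E-cong : ∀ {x y} → x ≈ y → ∀ n → E x n ≈ E y n
  E-cong x≈y = S-cong (term-cong x≈y)

  -- On [0, ½] the geometric bound gives 2. Beyond that, induction on the number of halves in `x`:
  -- by `E-+-≤`, removing ½ costs at most a factor 2.
  E-bounded : ∀ x → 0# ≤ x → ∃ λ B → ∀ n → E x n ≤ B
  E-bounded x 0≤x with archimedean (fromℕ 2 * x)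
  ... | m , 2x<m = go m 0≤x (begin
      x                             ≈⟨ *-identityˡ x ⟨
      1# * x                        ≈⟨ *-congʳ 2½≈1 ⟨
      fromℕ 2 * ½ * x               ≈⟨ solve 3 (λ t h x → t :* h :* x := (t :* x) :* h) ≈-refl (fromℕ 2) ½ x ⟩
      fromℕ 2 * x * ½               ≤⟨ *-monoʳ-≤ (<⇒≤ 0<½) (<⇒≤ 2x<m) ⟩
      fromℕ m * ½                   ∎)
    where
    small : ∀ {x} → 0# ≤ x → x ≤ ½ → ∀ n → E x n ≤ fromℕ 2
    small {x} 0≤x x≤½ n = *-cancelˡ-≤ 0<½ (begin
      ½ * E x n          ≤⟨ *-monoʳ-≤ (S-nonneg (term-nonneg 0≤x) n) ½≤1-x ⟩
      (1# - x) * E x n   ≤⟨ [1-x]E≤1 0≤x (≤-trans x≤½ ½≤1) n ⟩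
      1#                 ≈⟨ ≈-trans (*-comm _ _) 2½≈1 ⟨
      ½ * fromℕ 2        ∎)
      where
      ½≤1-x : ½ ≤ 1# - x
      ½≤1-x = ≤-diff _ (x≤y⇒0≤y-x x≤½) (≈-trans (+-congʳ (+-congʳ (≈-sym ½+½≈1)))
        (solve 2 (λ h x → h :+ h :- x :- h := h :- x) ≈-refl ½ x))

    go : ∀ m {x} → 0# ≤ x → x ≤ fromℕ m * ½ → ∃ λ B → ∀ n → E x n ≤ B
    go ℕ.zero 0≤x x≤0 = fromℕ 2 , small 0≤x (≤-trans x≤0 (≤-respˡ-≈ (≈-sym (zeroˡ _)) (<⇒≤ 0<½)))
    go (ℕ.suc m) {x} 0≤x x≤ with total x ½
    ... | inj₁ x≤½ = fromℕ 2 , small 0≤x x≤½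
    ... | inj₂ ½≤x = B * fromℕ 2 , λ n → begin
      E x n               ≈⟨ E-cong (solve 2 (λ x h → x :- h :+ h := x) ≈-refl x ½) n ⟨
      E (x - ½ + ½) n     ≤⟨ E-+-≤ 0≤x-½ (<⇒≤ 0<½) n ⟩
      E (x - ½) n * E ½ n ≤⟨ *-mono-≤ (S-nonneg (term-nonneg 0≤x-½) n) (S-nonneg (term-nonneg (<⇒≤ 0<½)) n)
                                (proj₂ bounded n) (small (<⇒≤ 0<½) ≤-refl n) ⟩
      B * fromℕ 2         ∎
      where
      0≤x-½ = x≤y⇒0≤y-x ½≤x
      bounded = go m 0≤x-½ (≤-diff _ (x≤y⇒0≤y-x x≤)
        (solve 3 (λ m h x → m :* h :- (x :- h) := (:1 :+ m) :* h :- x) ≈-refl (fromℕ m) ½ x))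
      B = proj₁ bounded

  the-satisfies : {A : Set} (d : A) (P : A → Set) → Σ A P → P (the d P)
  the-satisfies {A} d P ∃P with em {Σ A P}
  ... | yes (_ , Px) = Px
  ... | no  ∄P       = contradiction ∃P ∄P

  abs<⇒ : ∀ {z ε} → abs z < ε → - ε < z × z < ε
  abs<⇒ {z} {ε} with total 0# z
  ... | inj₁ 0≤z = λ z<ε → <-≤-trans
        (<-diff _ (≤-<-trans 0≤z z<ε) (solve 1 (λ ε → :0 :- (:- ε) := ε) ≈-refl ε)) 0≤z , z<ε
  ... | inj₂ z≤0 = λ -z<ε →
        <-diff _ (x<y⇒0<y-x -z<ε) (solve 2 (λ z ε → z :- (:- ε) := ε :- (:- z)) ≈-refl z ε) ,
        ≤-<-trans (≤-trans z≤0 (≤-diff _ (x≤y⇒0≤y-x z≤0) (solve 1 (λ z → :- z :- :0 := :0 :- z) ≈-refl z))) -z<ε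

  abs<⇐ : ∀ {z ε} → - ε < z → z < ε → abs z < ε
  abs<⇐ {z} {ε} -ε<z z<ε with total 0# z
  ... | inj₁ 0≤z = z<ε
  ... | inj₂ z≤0 = <-diff _ (x<y⇒0<y-x -ε<z) (solve 2 (λ z ε → ε :- (:- z) := z :- (:- ε)) ≈-refl z ε)

  partial : Carrier → ℕ → Carrier
  partial x N = sum {N} λ k → x ^ toℕ k / fromℕ (toℕ k !)

  converges-≈ : ∀ {f g} → (∀ n → f n ≈ g n) → ∀ {L} → ConvergesTo f L → ConvergesTo g L
  converges-≈ f≈g c ε 0<ε = let N , close = c ε 0<ε in N , λ n N≤n →
    let l , u = abs<⇒ (close n N≤n)
    in abs<⇐ (<-respʳ (+-congʳ (f≈g n)) l) (<-respˡ (+-congʳ (f≈g n)) u)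

  monotone-converges : ∀ {f} → (∀ {m n} → m ℕ.≤ n → f m ≤ f n) → (∃ λ B → ∀ n → f n ≤ B) → ∃ (ConvergesTo f)
  monotone-converges {f} mono (B , f≤B)
    with complete (λ y → ∃ λ n → f n ≈ y) (f 0 , 0 , ≈-refl) (B , λ { (n , n≈y) → ≤-respˡ-≈ n≈y (f≤B n) })
  ... | s , upper , least = s , converges
    where
    near : ∀ δ → 0# < δ → ∃ λ n → s - δ < f n
    near δ 0<δ with em {∃ λ n → s - δ < f n}
    ... | yes found = found
    ... | no  ∄n = contradiction
      (least λ { (n , n≈y) → ≤-respˡ-≈ n≈y (≮⇒≥ λ s-δ<n → ∄n (n , s-δ<n)) })
      (<⇒≱ (<-diff δ 0<δ (solve 2 (λ s δ → s :- (s :- δ) := δ) ≈-refl s δ)))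

    converges : ConvergesTo f s
    converges δ 0<δ with near δ 0<δ
    ... | N , s-δ<f = N , λ n N≤n → abs<⇐
      (<-diff _ (x<y⇒0<y-x (<-≤-trans s-δ<f (mono N≤n)))
        (solve 3 (λ p s δ → p :- s :- (:- δ) := p :- (s :- δ)) ≈-refl (f n) s δ))
      (≤-<-trans (≤-respʳ-≈ (-‿inverseʳ s) (+-monoˡ-≤ (- s) (upper (n , ≈-refl)))) 0<δ)

  a-[a-b]≈b : ∀ a b → a - (a - b) ≈ b
  a-[a-b]≈b = solve 2 (λ a b → a :- (a :- b) := b) ≈-refl

  [1-0]*a≈a : ∀ a → (1# - 0#) * a ≈ a
  [1-0]*a≈a = solve 1 (λ a → (:1 :- :0) :* a := a) ≈-refl

  a+[b-a]≈b : ∀ a b → a + (b - a) ≈ b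
  a+[b-a]≈b = solve 2 (λ a b → a :+ (b :- a) := b) ≈-refl

  converges-near : ∀ {f L} → ConvergesTo f L → ∀ δ → 0# < δ →
                   ∃ λ N → ∀ n → N ℕ.≤ n → L - δ < f n × f n < L + δ
  converges-near {f} {L} c δ 0<δ with c δ 0<δ
  ... | N , close = N , λ n N≤n → let (l , u) = abs<⇒ (close n N≤n) in
    <-diff _ (x<y⇒0<y-x l) (solve 3 (λ p e δ → p :- (e :- δ) := p :- e :- (:- δ)) ≈-refl (f n) L δ) ,
    <-diff _ (x<y⇒0<y-x u) (solve 3 (λ p e δ → e :+ δ :- p := δ :- (p :- e)) ≈-refl (f n) L δ)

  module _ {f : ℕ → Carrier} (mono : ∀ {m n} → m ℕ.≤ n → f m ≤ f n) {L} (c : ConvergesTo f L) where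

    ≤limit : ∀ n → f n ≤ L
    ≤limit n = ≮⇒≥ λ L<f →
      let N , close = converges-near c (f n - L) (x<y⇒0<y-x L<f)
      in <⇒≱ (proj₂ (close (N ℕ.⊔ n) (ℕ.m≤m⊔n N n)))
           (≤-respˡ-≈ (≈-sym (a+[b-a]≈b L (f n))) (mono (ℕ.m≤n⊔m N n)))

    limit≤ : ∀ {b} → (∀ n → f n ≤ b) → L ≤ b
    limit≤ {b} f≤b = ≮⇒≥ λ b<L →
      let N , close = converges-near c (L - b) (x<y⇒0<y-x b<L)
      in <⇒≱ (proj₁ (close N ℕ.≤-refl)) (≤-respʳ-≈ (≈-sym (a-[a-b]≈b L b)) (f≤b N))

  module _ {x} (0≤x : 0# ≤ x) where

    E-mono : ∀ {m n} → m ℕ.≤ n → E x m ≤ E x n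
    E-mono = S-mono (term-nonneg 0≤x)

    exp-converges : ConvergesTo (E x) (exp x)
    exp-converges = converges-≈ (sum≈S (term x)) (the-satisfies 0# (ConvergesTo (partial x))
      (let L , c = monotone-converges E-mono (E-bounded x 0≤x)
       in L , converges-≈ (λ n → ≈-sym (sum≈S (term x) n)) c))

    E≤exp : ∀ n → E x n ≤ exp x
    E≤exp = ≤limit E-mono exp-converges

    exp-least : ∀ {b} → (∀ n → E x n ≤ b) → exp x ≤ b
    exp-least = limit≤ E-mono exp-converges

    1+x≤exp : 1# + x ≤ exp x
    1+x≤exp = ≤-respˡ-≈ (E-2 x) (E≤exp 2)

    1≤exp : 1# ≤ exp x
    1≤exp = ≤-trans (x≤x+y 0≤x) 1+x≤exp

    x≤exp : x ≤ exp x
    x≤exp = ≤-trans (≤-respʳ-≈ (+-comm x 1#) (x≤x+y 0≤1)) 1+x≤exp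

    0<exp : 0# < exp x
    0<exp = 1≤⇒0< 1≤exp

    -- The supremum passes through multiplication by `c`; since the argument divides by `c`, the
    -- case `c ≈ 0#` is separate.
    c*exp-least : ∀ {c b} → 0# ≤ c → 0# ≤ b → (∀ n → c * E x n ≤ b) → c * exp x ≤ b
    c*exp-least {c} {b} 0≤c 0≤b cE≤b with em {0# ≈ c}
    ... | yes 0≈c = ≤-respˡ-≈ (≈-trans (≈-sym (zeroˡ _)) (*-congʳ 0≈c)) 0≤b
    ... | no  0≉c = ≤-respʳ-≈ (c*c⁻¹ b) (*-monoˡ-≤ 0≤c (exp-least λ n →
                      *-cancelˡ-≤ 0<c (≤-respʳ-≈ (≈-sym (c*c⁻¹ b)) (cE≤b n))))
      where
      0<c = 0≤c , 0≉c
      c*c⁻¹ : ∀ b → c * (c ⁻¹ * b) ≈ b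
      c*c⁻¹ b = ≈-trans (≈-sym (*-assoc _ _ _)) (≈-trans (*-congʳ (x*x⁻¹≈1 0<c)) (*-identityˡ b))

    [1-x]exp≤1 : x ≤ 1# → (1# - x) * exp x ≤ 1#
    [1-x]exp≤1 x≤1 = c*exp-least (x≤y⇒0≤y-x x≤1) 0≤1 ([1-x]E≤1 0≤x x≤1)

  -- The upper bound compares triangle and square at the same `n`; for the lower bound the suprema
  -- over `m` and `n` are taken one after the other.
  exp-+ : ∀ {x y} → 0# ≤ x → 0# ≤ y → exp (x + y) ≈ exp x * exp y
  exp-+ {x} {y} 0≤x 0≤y = antisym
    (exp-least (+-nonneg 0≤x 0≤y) λ n → ≤-trans (E-+-≤ 0≤x 0≤y n)
      (*-mono-≤ (S-nonneg (term-nonneg 0≤x) n) (S-nonneg (term-nonneg 0≤y) n) (E≤exp 0≤x n) (E≤exp 0≤y n)))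
    (c*exp-least 0≤y (<⇒≤ (0<exp 0≤x)) (<⇒≤ (0<exp 0≤x+y)) λ n →
      ≤-respˡ-≈ (*-comm _ _) (c*exp-least 0≤x (S-nonneg (term-nonneg 0≤y) n) (<⇒≤ (0<exp 0≤x+y)) λ m →
        ≤-respˡ-≈ (*-comm _ _) (≤-trans (E-+-≥ 0≤x 0≤y m n) (E≤exp 0≤x+y (m ℕ.+ n)))))
    where 0≤x+y = +-nonneg 0≤x 0≤y

  -- Not automatic: `exp` is a description, made separately for each argument. On nonnegative
  -- arguments its value is the supremum of the partial sums, which respects `_≈_`.
  exp-cong : ∀ {x y} → 0# ≤ x → x ≈ y → exp x ≈ exp y
  exp-cong 0≤x x≈y = antisym
    (exp-least 0≤x λ n → ≤-respˡ-≈ (E-cong (≈-sym x≈y) n) (E≤exp 0≤y n))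
    (exp-least 0≤y λ n → ≤-respˡ-≈ (E-cong x≈y n) (E≤exp 0≤x n))
    where 0≤y = ≤-respʳ-≈ x≈y 0≤x

  exp-0 : exp 0# ≈ 1#
  exp-0 = antisym
    (≤-respˡ-≈ ([1-0]*a≈a _) ([1-x]exp≤1 ≤-refl 0≤1)) (1≤exp ≤-refl)

  exp-split : ∀ {x y} → 0# ≤ x → x ≤ y → exp y ≈ exp x * exp (y - x)
  exp-split {x} {y} 0≤x x≤y = ≈-trans
    (exp-cong (≤-trans 0≤x x≤y) (solve 2 (λ x y → y := x :+ (y :- x)) ≈-refl x y))
    (exp-+ 0≤x (x≤y⇒0≤y-x x≤y))

  exp-mono-≤ : ∀ {x y} → 0# ≤ x → x ≤ y → exp x ≤ exp y
  exp-mono-≤ {x} 0≤x x≤y = ≤-respˡ-≈ (*-identityʳ _) (≤-respʳ-≈ (≈-sym (exp-split 0≤x x≤y))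
    (*-monoˡ-≤ (<⇒≤ (0<exp 0≤x)) (1≤exp (x≤y⇒0≤y-x x≤y))))

  exp-mono-< : ∀ {x y} → 0# ≤ x → x < y → exp x < exp y
  exp-mono-< {x} {y} 0≤x x<y = <-respˡ (*-identityʳ _) (<-respʳ (≈-sym (exp-split 0≤x (<⇒≤ x<y)))
    (*-monoˡ-< (0<exp 0≤x) (<-≤-trans
      (<-diff _ (x<y⇒0<y-x x<y) (solve 1 (λ d → :1 :+ d :- :1 := d) ≈-refl (y - x)))
      (1+x≤exp (x≤y⇒0≤y-x (<⇒≤ x<y))))))

  exp-cancel-≤ : ∀ {x y} → 0# ≤ y → exp x ≤ exp y → x ≤ y
  exp-cancel-≤ 0≤y ex≤ey = ≮⇒≥ λ y<x → <⇒≱ (exp-mono-< 0≤y y<x) ex≤ey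

  exp-times : ∀ {x} → 0# ≤ x → ∀ n → exp (fromℕ n * x) ≈ exp x ^ n
  exp-times {x} 0≤x ℕ.zero = ≈-trans (≈-sym (exp-cong ≤-refl (≈-sym (zeroˡ x)))) exp-0
  exp-times {x} 0≤x (ℕ.suc n) = ≈-trans
    (exp-cong (*-nonneg (0≤fromℕ (ℕ.suc n)) 0≤x) (n≈fromℕ n x))
    (≈-trans (exp-+ 0≤x (*-nonneg (0≤fromℕ n) 0≤x)) (*-congˡ (exp-times 0≤x n)))

  -- The solution is the supremum of the nonnegative `y` with `exp y ≤ v`. In place of continuity,
  -- `gap` supplies an explicit step `h` that contradicts the supremum on either side.
  exp-surjective : ∀ {v} → 1# ≤ v → ∃ λ y → 0# ≤ y × exp y ≈ v
  exp-surjective {v} 1≤v = s , 0≤s , antisym (≮⇒≥ too-big) (≮⇒≥ too-small)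
    where
    Below : Carrier → Set
    Below y = 0# ≤ y × exp y ≤ v
    supremum = complete Below (0# , ≤-refl , ≤-respˡ-≈ (≈-sym exp-0) 1≤v)
      (v , λ { (0≤y , ey≤v) → ≤-trans (x≤exp 0≤y) ey≤v })
    s = proj₁ supremum
    0≤s : 0# ≤ s
    0≤s = proj₁ (proj₂ supremum) (≤-refl , ≤-respˡ-≈ (≈-sym exp-0) 1≤v)
    0<v = 1≤⇒0< 1≤v

    -- For h = 1 - w / v the bound exp h ≤ 1 / (1 - h) reads exp h ≤ v / w.
    gap : ∀ {w v} → 0# < w → w < v → ∃ λ h → 0# < h × w * exp h ≤ v
    gap {w} {v} 0<w w<v = h , 0<h , ≤-respˡ-≈ wexp (≤-respʳ-≈ (*-identityʳ v) (*-monoˡ-≤ (<⇒≤ 0<v′) ([1-x]exp≤1 (<⇒≤ 0<h) h≤1)))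
      where
      0<v′ = <-trans 0<w w<v
      h = 1# - w * v ⁻¹
      v*w/v : v * (w * v ⁻¹) ≈ w
      v*w/v = ≈-trans (solve 3 (λ v w i → v :* (w :* i) := w :* (v :* i)) ≈-refl v w (v ⁻¹))
        (≈-trans (*-congˡ (x*x⁻¹≈1 0<v′)) (*-identityʳ w))
      v*[1-h] : v * (1# - h) ≈ w
      v*[1-h] = ≈-trans (solve 2 (λ v u → v :* (:1 :- (:1 :- u)) := v :* u) ≈-refl v (w * v ⁻¹)) v*w/v
      0<h : 0# < h
      0<h = *-cancelˡ-pos (<⇒≤ 0<v′) (<-respʳ
        (≈-trans (+-congˡ (-‿cong (≈-sym v*w/v))) (solve 2 (λ v u → v :- v :* u := v :* (:1 :- u)) ≈-refl v (w * v ⁻¹)))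
        (x<y⇒0<y-x w<v))
      h≤1 : h ≤ 1#
      h≤1 = ≤-diff _ (<⇒≤ (*-pos 0<w (⁻¹-pos 0<v′))) (solve 1 (λ u → :1 :- (:1 :- u) := u) ≈-refl (w * v ⁻¹))
      wexp : v * ((1# - h) * exp h) ≈ w * exp h
      wexp = ≈-trans (≈-sym (*-assoc _ _ _)) (*-congʳ v*[1-h])

    too-small : ¬ (exp s < v)
    -- `s + h` would still belong to the set.
    too-small es<v = let h , 0<h , es*eh≤v = gap (0<exp 0≤s) es<v in <⇒≱
      (<-diff h 0<h (solve 2 (λ s h → s :+ h :- s := h) ≈-refl s h))
      (proj₁ (proj₂ supremum) (+-nonneg 0≤s (<⇒≤ 0<h) , ≤-respˡ-≈ (≈-sym (exp-+ 0≤s (<⇒≤ 0<h))) es*eh≤v))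

    too-big : ¬ (v < exp s)
    too-big v<es = contradict (gap 0<v v<es)
      where
      contradict : ¬ (∃ λ h → 0# < h × v * exp h ≤ exp s)
      -- `s - h` would already be an upper bound.
      contradict (h , 0<h , v*eh≤es) = <⇒≱ (<-diff h 0<h (a-[a-b]≈b s h))
        (proj₂ (proj₂ supremum) λ { (0≤y , ey≤v) → exp-cancel-≤ (x≤y⇒0≤y-x h≤s) (≤-trans ey≤v v≤e[s-h]) })
        where
        h≤s : h ≤ s
        h≤s = exp-cancel-≤ 0≤s (≤-trans
          (≤-respˡ-≈ (*-identityˡ _) (*-monoʳ-≤ (<⇒≤ (0<exp (<⇒≤ 0<h))) 1≤v)) v*eh≤es)
        v≤e[s-h] : v ≤ exp (s - h)
        v≤e[s-h] = *-cancelˡ-≤ (0<exp (<⇒≤ 0<h))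
          (≤-respˡ-≈ (*-comm _ _) (≤-respʳ-≈ (exp-split (<⇒≤ 0<h) h≤s) v*eh≤es))

  -- For x > 0 the Cauchy product of the series at x and - x tends to 1, while
  -- E x n ≥ 1 + x; hence exp (- x) cannot be a number ≥ 1.
  exp-negative-≱1 : ∀ {x v} → 0# < x → 1# ≤ v → ¬ ConvergesTo (E (- x)) v
  exp-negative-≱1 {x} {v} 0<x 1≤v conv-v = <⇒≱ too-large too-close
    where
    0≤x = <⇒≤ 0<x
    0≤2x = +-nonneg 0≤x 0≤x
    0<3+x : 0# < fromℕ 3 + x
    0<3+x = <-≤-trans (0<fromℕ-suc 2) (x≤x+y 0≤x)
    -- Chosen so that `(1# + x) * (1# - δ)` exceeds `1# + δ` by exactly `δ`.
    δ = x * (fromℕ 3 + x) ⁻¹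
    0<δ : 0# < δ
    0<δ = *-pos 0<x (⁻¹-pos 0<3+x)
    [3+x]δ≈x : (fromℕ 3 + x) * δ ≈ x
    [3+x]δ≈x = ≈-trans (solve 3 (λ c x i → c :* (x :* i) := x :* (c :* i)) ≈-refl _ x _)
      (≈-trans (*-congˡ (x*x⁻¹≈1 0<3+x)) (*-identityʳ x))

    near₁ = converges-near conv-v δ 0<δ
    N₁ = proj₁ near₁
    near₂ = converges-near (exp-converges 0≤2x) δ 0<δ
    N₂ = proj₁ near₂
    -- Beyond both thresholds, and at least 2 so that `E x n` contains the terms 1 and x.
    n = ℕ.suc (ℕ.suc (N₁ ℕ.+ N₂))

    1-δ≤E : 1# - δ ≤ E (- x) n
    1-δ≤E = <⇒≤ (≤-<-trans (+-monoˡ-≤ (- δ) 1≤v) (proj₁ (proj₂ near₁ n (ℕ.≤-trans (ℕ.m≤m+n N₁ N₂) (ℕ.m≤n+m _ 2)))))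

    too-large : 1# + δ < E x n * E (- x) n
    too-large = <-≤-trans
      (<-diff δ 0<δ (≈-trans (+-congʳ (*-congʳ (+-congˡ (≈-sym [3+x]δ≈x))))
        (≈-trans (solve 2 (λ x δ → (:1 :+ (:ℕ 3 :+ x) :* δ) :* (:1 :- δ) :- (:1 :+ δ) :=
            δ :+ δ :* (x :- (:ℕ 3 :+ x) :* δ)) ≈-refl x δ)
          (≈-trans (+-congˡ (*-congˡ (+-congˡ (-‿cong [3+x]δ≈x)))) (solve 2 (λ x δ → δ :+ δ :* (x :- x) := δ) ≈-refl x δ)))))
      (*-mono-≤ (+-nonneg 0≤1 0≤x) (x≤y⇒0≤y-x δ≤1) (≤-respˡ-≈ (E-2 x) (E-mono 0≤x {n = n} (s≤s (s≤s z≤n)))) 1-δ≤E)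
      where
      δ≤1 : δ ≤ 1#
      δ≤1 = *-cancelˡ-≤ 0<3+x (≤-respˡ-≈ (≈-sym [3+x]δ≈x)
        (≤-diff _ (0≤fromℕ 3) (solve 1 (λ x → (:ℕ 3 :+ x) :* :1 :- x := :ℕ 3) ≈-refl x)))

    self-dominated : ∀ {z} → 0# ≤ z → ∣ z ∣≤ z
    self-dominated 0≤z = ≤-trans (≤-respʳ-≈ (solve 0 (:- :0 := :0) ≈-refl) (-‿anti-≤ 0≤z)) 0≤z , ≤-refl

    term-dominated : ∀ k → ∣ term (- x) k ∣≤ term x k
    term-dominated k = ∣∣-resp ≈-refl ≈-refl (∣∣-* (power k) (self-dominated 0≤i))
      where
      0≤i = <⇒≤ (⁻¹-pos (0<k! k))
      power : ∀ k → ∣ (- x) ^ k ∣≤ x ^ k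
      power ℕ.zero    = self-dominated 0≤1
      power (ℕ.suc k) = ∣∣-* (∣∣-neg (self-dominated 0≤x)) (power k)

    term-0-suc : ∀ k → term 0# (ℕ.suc k) ≈ 0#
    term-0-suc k = ≈-trans (*-congʳ (zeroˡ _)) (zeroˡ _)

    tri≈1 : tri (term x) (term (- x)) n ≈ 1#
    tri≈1 = begin-equality
      tri (term x) (term (- x)) n              ≈⟨ tri-term x (- x) n ⟩
      E (x - x) n                              ≈⟨ E-cong (-‿inverseʳ x) n ⟩
      E 0# n                                   ≈⟨ S-front (term 0#) (ℕ.suc (N₁ ℕ.+ N₂)) ⟩
      term 0# 0 + S (term 0# ∘ ℕ.suc) (ℕ.suc (N₁ ℕ.+ N₂))       ≈⟨ +-cong (term-0 0#) (S-zero (ℕ.suc (N₁ ℕ.+ N₂))) ⟩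
      1# + 0#                                  ≈⟨ +-identityʳ 1# ⟩
      1#                                       ∎
      where
      S-zero : ∀ m → S (term 0# ∘ ℕ.suc) m ≈ 0#
      S-zero ℕ.zero    = ≈-refl
      S-zero (ℕ.suc m) = ≈-trans (+-cong (S-zero m) (term-0-suc m)) (+-identityˡ 0#)

    too-close : E x n * E (- x) n ≤ 1# + δ
    too-close = begin
      E x n * E (- x) n                                  ≈⟨ a+[b-a]≈b (tri (term x) (term (- x)) n) (E x n * E (- x) n) ⟨
      tri (term x) (term (- x)) n + (E x n * E (- x) n - tri (term x) (term (- x)) n)
        ≤⟨ +-mono-≤ (≤-reflexive tri≈1) (proj₂ (S*S-tri-dominated term-dominated {a = term x} (λ k → self-dominated (term-nonneg 0≤x k)) {m = n} ℕ.≤-refl)) ⟩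
      1# + (E x n * E x n - tri (term x) (term x) n)     ≤⟨ +-monoʳ-≤ 1# defect ⟩
      1# + δ                                             ∎
      where
      -- The square is at most the full sum at `x + x`, and the triangle is the partial sum
      -- `E (x + x) n`, so the defect is at most the tail of a convergent series.
      defect : E x n * E x n - tri (term x) (term x) n ≤ δ
      defect = begin
        E x n * E x n - tri (term x) (term x) n
          ≤⟨ +-mono-≤ (≤-trans (E-+-≥ 0≤x 0≤x n n) (E≤exp 0≤2x (n ℕ.+ n)))
               (-‿anti-≤ (≤-respʳ-≈ (≈-sym (tri-term x x n))
                 (<⇒≤ (proj₁ (proj₂ near₂ n (ℕ.≤-trans (ℕ.m≤n+m N₂ N₁) (ℕ.m≤n+m _ 2))))))) ⟩
        exp (x + x) - (exp (x + x) - δ)   ≈⟨ a-[a-b]≈b (exp (x + x)) δ ⟩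
        δ                                 ∎

  private
    l≈-[0-l] : ∀ l → l ≈ - (0# - l)
    l≈-[0-l] = solve 1 (λ l → l := :- (:0 :- l)) ≈-refl

    exp-spec : ∀ y → (ConvergesTo (partial y) (exp y)) ⊎ (exp y ≈ 0#)
    exp-spec y with em {Σ Carrier (ConvergesTo (partial y))}
    ... | yes (_ , c) = inj₁ c
    ... | no  _       = inj₂ ≈-refl

  module _ {v} (1≤v : 1# ≤ v) where

    exp-ln : exp (ln v) ≈ v
    exp-ln = let y , _ , ey≈v = exp-surjective 1≤v in the-satisfies 0# (λ y → exp y ≈ v) (y , ey≈v)

    -- Suppose `ln v` is negative. Either the series converges there, which `exp-negative-≱1`
    -- forbids as the value is at least 1, or `exp` takes its default 0, which is not `v`.
    0≤ln : 0# ≤ ln v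
    0≤ln = ≮⇒≥ λ l<0 → [ exp-negative-≱1 (x<y⇒0<y-x l<0) (≤-respʳ-≈ (≈-sym exp-ln) 1≤v)
                            ∘ converges-≈ (λ n → ≈-trans (sum≈S (term (ln v)) n) (E-cong (l≈-[0-l] (ln v)) n))
                          , (λ e≈0 → contradiction (≈-trans (≈-sym e≈0) exp-ln) (proj₂ (1≤⇒0< 1≤v)))
                          ]′ (exp-spec (ln v))

-- Counting vertex pairs and transversals

pairs : ℕ → ℕ
pairs ℕ.zero    = 0
pairs (ℕ.suc n) = n ℕ.+ pairs n

∣∪∣+∣∩∣ : ∀ {n} (A B : Subset n) → ∣ A ∪ B ∣ ℕ.+ ∣ A ∩ B ∣ ≡ ∣ A ∣ ℕ.+ ∣ B ∣
∣∪∣+∣∩∣ []            []            = refl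
∣∪∣+∣∩∣ (outside ∷ A) (outside ∷ B) = ∣∪∣+∣∩∣ A B
∣∪∣+∣∩∣ (inside  ∷ A) (outside ∷ B) = ≡.cong ℕ.suc (∣∪∣+∣∩∣ A B)
∣∪∣+∣∩∣ (outside ∷ A) (inside  ∷ B) = ≡.trans (≡.cong ℕ.suc (∣∪∣+∣∩∣ A B)) (≡.sym (ℕ.+-suc ∣ A ∣ ∣ B ∣))
∣∪∣+∣∩∣ (inside  ∷ A) (inside  ∷ B) = ≡.cong ℕ.suc (≡.trans (ℕ.+-suc ∣ A ∪ B ∣ ∣ A ∩ B ∣)
  (≡.trans (≡.cong ℕ.suc (∣∪∣+∣∩∣ A B)) (≡.sym (ℕ.+-suc ∣ A ∣ ∣ B ∣))))

-- The number of pairs of vertices lying both in A or both in B.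
pairs-in : ∀ {n} → Subset n → Subset n → ℕ
pairs-in []            []            = 0
pairs-in (outside ∷ A) (outside ∷ B) = pairs-in A B
pairs-in (inside  ∷ A) (outside ∷ B) = ∣ A ∣ ℕ.+ pairs-in A B
pairs-in (outside ∷ A) (inside  ∷ B) = ∣ B ∣ ℕ.+ pairs-in A B
pairs-in (inside  ∷ A) (inside  ∷ B) = ∣ A ∪ B ∣ ℕ.+ pairs-in A B

-- Inclusion-exclusion, the pairs inside both sets being those inside `A ∩ B`. It governs the
-- exponent of q when two sets are required to be independent at once.
pairs-in+pairs-∩ : ∀ {n} (A B : Subset n) →
  pairs-in A B ℕ.+ pairs ∣ A ∩ B ∣ ≡ pairs ∣ A ∣ ℕ.+ pairs ∣ B ∣
pairs-in+pairs-∩ []            []            = refl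
pairs-in+pairs-∩ (outside ∷ A) (outside ∷ B) = pairs-in+pairs-∩ A B
pairs-in+pairs-∩ (inside  ∷ A) (outside ∷ B) =
  ≡.trans (ℕ.+-assoc ∣ A ∣ (pairs-in A B) _)
    (≡.trans (≡.cong (∣ A ∣ ℕ.+_) (pairs-in+pairs-∩ A B)) (≡.sym (ℕ.+-assoc ∣ A ∣ _ _)))
pairs-in+pairs-∩ (outside ∷ A) (inside  ∷ B) =
  ≡.trans (ℕ.+-assoc ∣ B ∣ (pairs-in A B) _)
    (≡.trans (≡.cong (∣ B ∣ ℕ.+_) (pairs-in+pairs-∩ A B))
      (solve 3 (λ b p q → b :+ (p :+ q) := p :+ (b :+ q)) refl (∣ B ∣) (pairs (∣ A ∣)) (pairs (∣ B ∣))))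
  where open ℕ.+-*-Solver
pairs-in+pairs-∩ (inside  ∷ A) (inside  ∷ B) =
  ≡.trans (solve 4 (λ u e l t → (u :+ e) :+ (l :+ t) := (u :+ l) :+ (e :+ t)) refl
             (∣ A ∪ B ∣) (pairs-in A B) (∣ A ∩ B ∣) (pairs (∣ A ∩ B ∣)))
    (≡.trans (≡.cong₂ ℕ._+_ (∣∪∣+∣∩∣ A B) (pairs-in+pairs-∩ A B))
      (solve 4 (λ a b s t → (a :+ b) :+ (s :+ t) := (a :+ s) :+ (b :+ t)) refl
        (∣ A ∣) (∣ B ∣) (pairs (∣ A ∣)) (pairs (∣ B ∣))))
  where open ℕ.+-*-Solver

-- Twice `pairs ℓ` is ℓ (ℓ - 1), and ℓ - 1 ≤ 2 j. The linear exponent in place of a quadratic one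
-- turns the overlap weight into a power `c ^ ℓ`.
pairs≤ : ∀ j ℓ → ℓ ℕ.≤ ℕ.suc (j ℕ.+ j) → pairs ℓ ℕ.≤ j ℕ.* ℓ
pairs≤ j ℓ ℓ≤ = ℕ.*-cancelˡ-≤ 2 (ℕ.+-cancelʳ-≤ ℓ _ _ (begin
  2 ℕ.* pairs ℓ ℕ.+ ℓ            ≡⟨ 2pairs ℓ ⟩
  ℓ ℕ.* ℓ                        ≤⟨ ℕ.*-monoˡ-≤ ℓ ℓ≤ ⟩
  ℕ.suc (j ℕ.+ j) ℕ.* ℓ          ≡⟨ solve 2 (λ j l → (con 1 :+ (j :+ j)) :* l := con 2 :* (j :* l) :+ l) refl j ℓ ⟩
  2 ℕ.* (j ℕ.* ℓ) ℕ.+ ℓ          ∎))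
  where
  open ℕ.≤-Reasoning
  open ℕ.+-*-Solver
  2pairs : ∀ n → 2 ℕ.* pairs n ℕ.+ n ≡ n ℕ.* n
  2pairs ℕ.zero    = refl
  2pairs (ℕ.suc n) = ≡.trans
    (solve 2 (λ n t → con 2 :* (n :+ t) :+ (con 1 :+ n) := (con 2 :* t :+ n) :+ (n :+ n :+ con 1)) refl n (pairs n))
    (≡.trans (≡.cong (ℕ._+ (n ℕ.+ n ℕ.+ 1)) (2pairs n))
      (solve 1 (λ n → n :* n :+ (n :+ n :+ con 1) := (con 1 :+ n) :* (con 1 :+ n)) refl n))

∣++∣ : ∀ {m n} (A : Subset m) (B : Subset n) → ∣ A ++ B ∣ ≡ ∣ A ∣ ℕ.+ ∣ B ∣
∣++∣ []            B = refl
∣++∣ (outside ∷ A) B = ∣++∣ A B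
∣++∣ (inside  ∷ A) B = ≡.cong ℕ.suc (∣++∣ A B)

∣++∩++∣ : ∀ {m n} (A B : Subset m) (C D : Subset n) →
          ∣ (A ++ C) ∩ (B ++ D) ∣ ≡ ∣ A ∩ B ∣ ℕ.+ ∣ C ∩ D ∣
∣++∩++∣ []            []            C D = refl
∣++∩++∣ (outside ∷ A) (_ ∷ B)       C D = ∣++∩++∣ A B C D
∣++∩++∣ (inside  ∷ A) (outside ∷ B) C D = ∣++∩++∣ A B C D
∣++∩++∣ (inside  ∷ A) (inside  ∷ B) C D = ≡.cong ℕ.suc (∣++∩++∣ A B C D)

-- The transversal picking the element vᵢ of the i-th block, in a ground set of
-- k blocks of size N followed by r unused elements.

ground : ℕ → ℕ → ℕ → ℕ
ground N r ℕ.zero    = r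
ground N r (ℕ.suc k) = N ℕ.+ ground N r k

transversal : ∀ {N k} r → Vec (Fin N) k → Subset (ground N r k)
transversal r []      = ∅
transversal r (i ∷ v) = ⁅ i ⁆ ++ transversal r v

∣transversal∣ : ∀ {N k} r (v : Vec (Fin N) k) → ∣ transversal r v ∣ ≡ k
∣transversal∣ r []      = Subset.∣⊥∣≡0 r
∣transversal∣ r (i ∷ v) = ≡.trans (∣++∣ ⁅ i ⁆ (transversal r v))
  (≡.cong₂ ℕ._+_ (Subset.∣⁅x⁆∣≡1 i) (∣transversal∣ r v))

ground≡ : ∀ N r k → ground N r k ≡ k ℕ.* N ℕ.+ r
ground≡ N r ℕ.zero    = refl
ground≡ N r (ℕ.suc k) = ≡.trans (≡.cong (N ℕ.+_) (ground≡ N r k)) (≡.sym (ℕ.+-assoc N (k ℕ.* N) r))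

-- S₁, …, S₄ are the neighbourhoods of four further vertices, which span a K₄.

record Good {n} (k : ℕ) (S₁ S₂ S₃ S₄ : Subset n) (ω : Outcome n) (A : Subset n) : Set where
  field
    size        : ∣ A ∣ ≡ k
    ⊆S₁         : ∀ {i} → i ∈ A → i ∈ S₁
    ∩S₂         : ∀ {i} → i ∈ A → i ∉ S₂
    ∩S₃         : ∀ {i} → i ∈ A → i ∉ S₃
    ∩S₄         : ∀ {i} → i ∈ A → i ∉ S₄
    independent : ∀ {i j} → i ∈ A → j ∈ A → ¬ OutcomeAdj ω i j

-- Expectations and the second moment method

module Probability (em : ExcludedMiddle 0ℓ) (ℝ : Reals) where

  open OrderedField em ℝ
  open Classical em ℝ
  open ≤-Reasoning

  𝟙 : Set → Carrier
  𝟙 A = if does (em {A}) then 1# else 0#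

  𝟙-cases : ∀ A → (A × 𝟙 A ≈ 1#) ⊎ (¬ A × 𝟙 A ≈ 0#)
  𝟙-cases A with em {A}
  ... | yes a = inj₁ (a , ≈-refl)
  ... | no ¬a = inj₂ (¬a , ≈-refl)

  𝟙-nonneg : ∀ A → 0# ≤ 𝟙 A
  𝟙-nonneg A with 𝟙-cases A
  ... | inj₁ (_ , ≈1) = ≤-respʳ-≈ (≈-sym ≈1) 0≤1
  ... | inj₂ (_ , ≈0) = ≤-reflexive (≈-sym ≈0)

  𝟙-mono : ∀ {A B} → (A → B) → 𝟙 A ≤ 𝟙 B
  𝟙-mono {A} {B} A→B with 𝟙-cases A | 𝟙-cases B
  ... | inj₂ (_ , ≈0) | _             = ≤-respˡ-≈ (≈-sym ≈0) (𝟙-nonneg B)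
  ... | inj₁ (_ , ≈1) | inj₁ (_ , ≈1′) = ≤-reflexive (≈-trans ≈1 (≈-sym ≈1′))
  ... | inj₁ (a , _)  | inj₂ (¬b , _)  = contradiction (A→B a) ¬b

  -- A positive, normalised linear functional: the common form of `𝔼`, of averages over transversals
  -- and of their products.
  record Expectation (A : Set) : Set where
    infix 9 _⟨_⟩
    field
      _⟨_⟩ : (A → Carrier) → Carrier
      ⟨⟩-mono  : ∀ {f g} → (∀ a → f a ≤ g a) → _⟨_⟩ f ≤ _⟨_⟩ g
      ⟨⟩-+     : ∀ f g → _⟨_⟩ (λ a → f a + g a) ≈ _⟨_⟩ f + _⟨_⟩ g
      ⟨⟩-*     : ∀ c f → _⟨_⟩ (λ a → c * f a) ≈ c * _⟨_⟩ f
      ⟨⟩-const : ∀ c → _⟨_⟩ (λ _ → c) ≈ c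

    ⟨⟩-cong : ∀ {f g} → (∀ a → f a ≈ g a) → _⟨_⟩ f ≈ _⟨_⟩ g
    ⟨⟩-cong f≈g = antisym (⟨⟩-mono (≤-reflexive ∘ f≈g)) (⟨⟩-mono (≤-reflexive ∘ ≈-sym ∘ f≈g))

    ⟨⟩-*ʳ : ∀ c f → _⟨_⟩ (λ a → f a * c) ≈ _⟨_⟩ f * c
    ⟨⟩-*ʳ c f = ≈-trans (⟨⟩-cong λ a → *-comm (f a) c) (≈-trans (⟨⟩-* c f) (*-comm c _))

    ⟨⟩-nonneg : ∀ {f} → (∀ a → 0# ≤ f a) → 0# ≤ _⟨_⟩ f
    ⟨⟩-nonneg 0≤f = ≤-respˡ-≈ (⟨⟩-const 0#) (⟨⟩-mono 0≤f)

  open Expectation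

  infixr 5 _⊗_

  _⊗_ : ∀ {A B} → Expectation A → Expectation B → Expectation (A × B)
  P ⊗ Q = record
    { _⟨_⟩     = λ f → P ⟨ (λ a → Q ⟨ (λ b → f (a , b)) ⟩) ⟩
    ; ⟨⟩-mono  = λ f≤g → ⟨⟩-mono P λ a → ⟨⟩-mono Q λ b → f≤g (a , b)
    ; ⟨⟩-+     = λ f g → ≈-trans (⟨⟩-cong P λ a → ⟨⟩-+ Q _ _) (⟨⟩-+ P _ _)
    ; ⟨⟩-*     = λ c f → ≈-trans (⟨⟩-cong P λ a → ⟨⟩-* Q c _) (⟨⟩-* P c _)
    ; ⟨⟩-const = λ c → ≈-trans (⟨⟩-cong P λ a → ⟨⟩-const Q c) (⟨⟩-const P c)
    }

  ⊗-* : ∀ {A B} (P : Expectation A) (Q : Expectation B) f g →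
        (P ⊗ Q) ⟨ (λ ab → f (proj₁ ab) * g (proj₂ ab)) ⟩ ≈ P ⟨ f ⟩ * Q ⟨ g ⟩
  ⊗-* P Q f g = ≈-trans (⟨⟩-cong P λ a → ⟨⟩-* Q (f a) g) (⟨⟩-*ʳ P (Q ⟨ g ⟩) f)

  map : ∀ {A B} → (A → B) → Expectation A → Expectation B
  map h P = record
    { _⟨_⟩     = λ f → P ⟨ f ∘ h ⟩
    ; ⟨⟩-mono  = λ f≤g → ⟨⟩-mono P (f≤g ∘ h)
    ; ⟨⟩-+     = λ f g → ⟨⟩-+ P (f ∘ h) (g ∘ h)
    ; ⟨⟩-*     = λ c f → ⟨⟩-* P c (f ∘ h)
    ; ⟨⟩-const = ⟨⟩-const P
    }

  point : ∀ {A} → A → Expectation A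
  point a = record
    { _⟨_⟩     = λ f → f a
    ; ⟨⟩-mono  = λ f≤g → f≤g a
    ; ⟨⟩-+     = λ f g → ≈-refl
    ; ⟨⟩-*     = λ c f → ≈-refl
    ; ⟨⟩-const = λ c → ≈-refl
    }

  -- Fubini against an arbitrary `P`. For averages over finitely many points it reduces to the
  -- linearity of `P`.
  Commutes : ∀ {A} → Expectation A → Set₁
  Commutes {A} Q = ∀ {B} (P : Expectation B) (f : B → A → Carrier) →
    P ⟨ (λ b → Q ⟨ f b ⟩) ⟩ ≈ Q ⟨ (λ a → P ⟨ (λ b → f b a) ⟩) ⟩

  module Uniform {N} (0<N : 0# < fromℕ N) where

    private
      sumE : ∀ {n} → (Fin n → Carrier) → Carrier
      sumE = sum

      sum-mono : ∀ {n} {f g : Fin n → Carrier} → (∀ i → f i ≤ g i) → sumE f ≤ sumE g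
      sum-mono {ℕ.zero}  f≤g = ≤-refl
      sum-mono {ℕ.suc n} f≤g = +-mono-≤ (f≤g zero) (sum-mono (f≤g ∘ suc))

      sum-+ : ∀ {n} (f g : Fin n → Carrier) → sumE (λ i → f i + g i) ≈ sumE f + sumE g
      sum-+ {ℕ.zero}  f g = ≈-sym (+-identityˡ 0#)
      sum-+ {ℕ.suc n} f g = ≈-trans (+-congˡ (sum-+ (f ∘ suc) (g ∘ suc)))
        (solve 4 (λ a b c d → (a :+ b) :+ (c :+ d) := (a :+ c) :+ (b :+ d)) ≈-refl _ _ _ _)

      sum-* : ∀ {n} c (f : Fin n → Carrier) → sumE (λ i → c * f i) ≈ c * sumE f
      sum-* {ℕ.zero}  c f = ≈-sym (zeroʳ c)
      sum-* {ℕ.suc n} c f = ≈-trans (+-congˡ (sum-* c (f ∘ suc))) (≈-sym (distribˡ c _ _))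

      sum-const : ∀ n c → sumE {n} (λ _ → c) ≈ fromℕ n * c
      sum-const ℕ.zero    c = ≈-sym (zeroˡ c)
      sum-const (ℕ.suc n) c = ≈-trans (+-congˡ (sum-const n c)) (≈-sym (n≈fromℕ n c))

      sum-commutes : ∀ {n B} (P : Expectation B) (f : B → Fin n → Carrier) →
                     P ⟨ (λ b → sumE (f b)) ⟩ ≈ sumE (λ i → P ⟨ (λ b → f b i) ⟩)
      sum-commutes {ℕ.zero}  P f = ⟨⟩-const P 0#
      sum-commutes {ℕ.suc n} P f = ≈-trans (⟨⟩-+ P _ _) (+-congˡ (sum-commutes P λ b → f b ∘ suc))

      1/N = fromℕ N ⁻¹

    uniform : Expectation (Fin N)
    uniform = record
      { _⟨_⟩     = λ f → 1/N * sumE f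
      ; ⟨⟩-mono  = λ f≤g → *-monoˡ-≤ (<⇒≤ (⁻¹-pos 0<N)) (sum-mono f≤g)
      ; ⟨⟩-+     = λ f g → ≈-trans (*-congˡ (sum-+ f g)) (distribˡ _ _ _)
      ; ⟨⟩-*     = λ c f → ≈-trans (*-congˡ (sum-* c f)) (solve 3 (λ i c s → i :* (c :* s) := c :* (i :* s)) ≈-refl _ _ _)
      ; ⟨⟩-const = λ c → ≈-trans (*-congˡ (sum-const N c)) (≈-trans (≈-sym (*-assoc _ _ _))
          (≈-trans (*-congʳ (≈-trans (*-comm _ _) (x*x⁻¹≈1 0<N))) (*-identityˡ c)))
      }

    uniform-commutes : Commutes uniform
    uniform-commutes P f = ≈-trans (⟨⟩-* P 1/N _) (*-congˡ (sum-commutes P f))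

    -- The exponent is 1 if i = j and 0 otherwise, so the average equals 1 + (c - 1) / N.
    uniform-overlap : ∀ {c} → 0# ≤ c → ∀ j → uniform ⟨ (λ i → c ^ ∣ ⁅ i ⁆ ∩ ⁅ j ⁆ ∣) ⟩ ≤ 1# + c / fromℕ N
    uniform-overlap {c} 0≤c j = begin
      1/N * sumE (λ i → c ^ ∣ ⁅ i ⁆ ∩ ⁅ j ⁆ ∣)  ≤⟨ *-monoˡ-≤ (<⇒≤ (⁻¹-pos 0<N)) (sum-overlap j) ⟩
      1/N * (fromℕ N + c)                       ≈⟨ solve 3 (λ i n c → i :* (n :+ c) := n :* i :+ c :* i) ≈-refl 1/N (fromℕ N) c ⟩
      fromℕ N * 1/N + c * 1/N                   ≈⟨ +-congʳ (x*x⁻¹≈1 0<N) ⟩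
      1# + c / fromℕ N                          ∎
      where
      disjoint-∅ : ∀ {n} (A : Subset n) → ∣ ∅ ∩ A ∣ ≡ 0
      disjoint-∅ {n} A = ≡.trans (≡.cong ∣_∣ (Subset.∩-zeroˡ A)) (Subset.∣⊥∣≡0 n)

      ∅-disjoint : ∀ {n} (A : Subset n) → ∣ A ∩ ∅ ∣ ≡ 0
      ∅-disjoint {n} A = ≡.trans (≡.cong ∣_∣ (Subset.∩-zeroʳ A)) (Subset.∣⊥∣≡0 n)

      sum-ones : ∀ {n m} (h : Fin n → Subset m) → sumE (λ i → c ^ ∣ h i ∩ ∅ ∣) ≈ fromℕ n
      sum-ones {ℕ.zero}  h = ≈-refl
      sum-ones {ℕ.suc n} h = +-cong (≈-reflexive (≡.cong (c ^_) (∅-disjoint (h zero)))) (sum-ones (h ∘ suc))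

      sum-overlap : ∀ {n} (j : Fin n) → sumE (λ i → c ^ ∣ ⁅ i ⁆ ∩ ⁅ j ⁆ ∣) ≤ fromℕ n + c
      sum-overlap {ℕ.suc n} zero = begin
        c ^ ℕ.suc ∣ ∅ {n = n} ∩ ∅ ∣ + sumE {n} (λ i → c ^ ∣ ⁅ i ⁆ ∩ ∅ ∣)
          ≈⟨ +-cong (≈-reflexive (≡.cong (λ m → c ^ ℕ.suc m) (disjoint-∅ (∅ {n = n})))) (sum-ones {n} ⁅_⁆) ⟩
        c * 1# + fromℕ n            ≤⟨ ≤-diff 1# 0≤1 (solve 2 (λ c n → :1 :+ n :+ c :- (c :* :1 :+ n) := :1) ≈-refl c (fromℕ n)) ⟩
        fromℕ (ℕ.suc n) + c         ∎
      sum-overlap {ℕ.suc n} (suc j) = begin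
        c ^ ∣ ∅ ∩ ⁅ j ⁆ ∣ + sumE {n} (λ i → c ^ ∣ ⁅ i ⁆ ∩ ⁅ j ⁆ ∣)
          ≤⟨ +-mono-≤ (≤-reflexive (≈-reflexive (≡.cong (c ^_) (disjoint-∅ ⁅ j ⁆)))) (sum-overlap j) ⟩
        1# + (fromℕ n + c)          ≈⟨ +-assoc _ _ _ ⟨
        fromℕ (ℕ.suc n) + c         ∎

    uniforms : ∀ k → Expectation (Vec (Fin N) k)
    uniforms ℕ.zero    = point []
    uniforms (ℕ.suc k) = map (λ iv → proj₁ iv ∷ proj₂ iv) (uniform ⊗ uniforms k)

    uniforms-commutes : ∀ k → Commutes (uniforms k)
    uniforms-commutes ℕ.zero    P f = ≈-refl
    uniforms-commutes (ℕ.suc k) P f = ≈-trans (uniform-commutes P λ b i → uniforms k ⟨ (λ v → f b (i ∷ v)) ⟩)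
      (⟨⟩-cong uniform λ i → uniforms-commutes k P λ b v → f b (i ∷ v))

    -- The overlap of two transversals is a sum over the blocks, and choices in different blocks are
    -- independent, so the average factorises into `k` averages of the kind treated in
    -- `uniform-overlap`.
    uniforms-overlap : ∀ {c} → 0# ≤ c → ∀ r k →
      uniforms k ⟨ (λ v → uniforms k ⟨ (λ w → c ^ ∣ transversal r w ∩ transversal r v ∣) ⟩) ⟩ ≤ (1# + c / fromℕ N) ^ k
    uniforms-overlap {c} 0≤c r ℕ.zero = ≤-reflexive (≈-reflexive (≡.cong (c ^_)
      (≡.trans (≡.cong ∣_∣ (Subset.∩-zeroˡ (∅ {n = r}))) (Subset.∣⊥∣≡0 r))))
    uniforms-overlap {c} 0≤c r (ℕ.suc k) = begin
      uniform ⟨ (λ i → U ⟨ (λ v → uniform ⟨ (λ j → U ⟨ (λ w → c ^ ∣ (⁅ j ⁆ ++ transversal r w) ∩ (⁅ i ⁆ ++ transversal r v) ∣) ⟩) ⟩) ⟩) ⟩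
        ≤⟨ ⟨⟩-mono uniform (λ i → ⟨⟩-mono U λ v → inner i v) ⟩
      uniform ⟨ (λ i → U ⟨ (λ v → (1# + c / fromℕ N) * h v) ⟩) ⟩
        ≈⟨ ⟨⟩-const uniform _ ⟩
      U ⟨ (λ v → (1# + c / fromℕ N) * h v) ⟩
        ≈⟨ ⟨⟩-* U _ h ⟩
      (1# + c / fromℕ N) * U ⟨ h ⟩
        ≤⟨ *-monoˡ-≤ (+-nonneg 0≤1 (*-nonneg 0≤c (<⇒≤ (⁻¹-pos 0<N)))) (uniforms-overlap 0≤c r k) ⟩
      (1# + c / fromℕ N) ^ ℕ.suc k ∎
      where
      U = uniforms k
      h : Vec (Fin N) k → Carrier
      h v = U ⟨ (λ w → c ^ ∣ transversal r w ∩ transversal r v ∣) ⟩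

      inner : ∀ i v → uniform ⟨ (λ j → U ⟨ (λ w → c ^ ∣ (⁅ j ⁆ ++ transversal r w) ∩ (⁅ i ⁆ ++ transversal r v) ∣) ⟩) ⟩
                      ≤ (1# + c / fromℕ N) * h v
      inner i v = begin
        uniform ⟨ (λ j → U ⟨ (λ w → c ^ ∣ (⁅ j ⁆ ++ transversal r w) ∩ (⁅ i ⁆ ++ transversal r v) ∣) ⟩) ⟩
          ≈⟨ ⟨⟩-cong uniform (λ j → ⟨⟩-cong U λ w → ≈-trans
               (≈-reflexive (≡.cong (c ^_) (∣++∩++∣ ⁅ j ⁆ ⁅ i ⁆ (transversal r w) (transversal r v))))
               (^-homo-* c ∣ ⁅ j ⁆ ∩ ⁅ i ⁆ ∣ _)) ⟩
        (uniform ⊗ U) ⟨ (λ jw → c ^ ∣ ⁅ proj₁ jw ⁆ ∩ ⁅ i ⁆ ∣ * c ^ ∣ transversal r (proj₂ jw) ∩ transversal r v ∣) ⟩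
          ≈⟨ ⊗-* uniform U (λ j → c ^ ∣ ⁅ j ⁆ ∩ ⁅ i ⁆ ∣) (λ w → c ^ ∣ transversal r w ∩ transversal r v ∣) ⟩
        uniform ⟨ (λ j → c ^ ∣ ⁅ j ⁆ ∩ ⁅ i ⁆ ∣) ⟩ * h v
          ≤⟨ *-monoʳ-≤ (⟨⟩-nonneg U λ w → ^-nonneg (∣ transversal r w ∩ transversal r v ∣) 0≤c) (uniform-overlap 0≤c i) ⟩
        (1# + c / fromℕ N) * h v ∎

  -- Good sets in the random graph

  module RandomGraph (p : Carrier) (0≤p : 0# ≤ p) (p≤1 : p ≤ 1#) where

    q : Carrier
    q = 1# - p

    0≤q : 0# ≤ q
    0≤q = x≤y⇒0≤y-x p≤1

    q≤1 : q ≤ 1#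
    q≤1 = ≤-diff p 0≤p (a-[a-b] 1# p)
      where
      a-[a-b] : ∀ a b → a - (a - b) ≈ b
      a-[a-b] = solve 2 (λ a b → a :- (a :- b) := b) ≈-refl

    private
      interchange : ∀ a b c d → (a * b) * (c * d) ≈ (a * c) * (b * d)
      interchange = solve 4 (λ a b c d → (a :* b) :* (c :* d) := (a :* c) :* (b :* d)) ≈-refl

      ∉-outside : ∀ {n} {S : Subset n} {i} → S Vec.[ i ]= outside → i ∉ S
      ∉-outside (there out) (there i∈S) = ∉-outside out i∈S

      zero-left : ∀ {x y} → x ≈ 0# → x * y ≈ 0#
      zero-left {y = y} x≈0 = ≈-trans (*-congʳ x≈0) (zeroˡ y)

      zero-right : ∀ {x y} → y ≈ 0# → x * y ≈ 0#
      zero-right {x} y≈0 = ≈-trans (*-congˡ y≈0) (zeroʳ x)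

      mix-mono : ∀ {a b c d} → a ≤ c → b ≤ d → p * a + q * b ≤ p * c + q * d
      mix-mono a≤c b≤d = +-mono-≤ (*-monoˡ-≤ 0≤p a≤c) (*-monoˡ-≤ 0≤q b≤d)

      mix-+ : ∀ a b c d → p * (a + c) + q * (b + d) ≈ (p * a + q * b) + (p * c + q * d)
      mix-+ = solve 6 (λ p q a b c d → p :* (a :+ c) :+ q :* (b :+ d) := (p :* a :+ q :* b) :+ (p :* c :+ q :* d)) ≈-refl p q

      mix-* : ∀ c a b → p * (c * a) + q * (c * b) ≈ c * (p * a + q * b)
      mix-* = solve 5 (λ p q c a b → p :* (c :* a) :+ q :* (c :* b) := c :* (p :* a :+ q :* b)) ≈-refl p q

      mix-const : ∀ c → p * c + q * c ≈ c
      mix-const = solve 2 (λ p c → p :* c :+ (:1 :- p) :* c := c) ≈-refl p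

      subset-mono : ∀ n {f g} → (∀ S → f S ≤ g S) → 𝔼-subset n p f ≤ 𝔼-subset n p g
      subset-mono ℕ.zero    f≤g = f≤g []
      subset-mono (ℕ.suc n) f≤g = mix-mono (subset-mono n (f≤g ∘ (inside ∷_))) (subset-mono n (f≤g ∘ (outside ∷_)))

      subset-cong : ∀ n {f g} → (∀ S → f S ≈ g S) → 𝔼-subset n p f ≈ 𝔼-subset n p g
      subset-cong n f≈g = antisym (subset-mono n (≤-reflexive ∘ f≈g)) (subset-mono n (≤-reflexive ∘ ≈-sym ∘ f≈g))

      subset-+ : ∀ n f g → 𝔼-subset n p (λ S → f S + g S) ≈ 𝔼-subset n p f + 𝔼-subset n p g
      subset-+ ℕ.zero    f g = ≈-refl
      subset-+ (ℕ.suc n) f g = ≈-trans (+-cong (*-congˡ (subset-+ n _ _)) (*-congˡ (subset-+ n _ _))) (mix-+ _ _ _ _)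

      subset-* : ∀ n c f → 𝔼-subset n p (λ S → c * f S) ≈ c * 𝔼-subset n p f
      subset-* ℕ.zero    c f = ≈-refl
      subset-* (ℕ.suc n) c f = ≈-trans (+-cong (*-congˡ (subset-* n c _)) (*-congˡ (subset-* n c _))) (mix-* c _ _)

      subset-const : ∀ n c → 𝔼-subset n p (λ _ → c) ≈ c
      subset-const ℕ.zero    c = ≈-refl
      subset-const (ℕ.suc n) c = ≈-trans (+-cong (*-congˡ (subset-const n c)) (*-congˡ (subset-const n c))) (mix-const c)

      outcome-mono : ∀ n {f g} → (∀ ω → f ω ≤ g ω) → 𝔼 n p f ≤ 𝔼 n p g
      outcome-mono ℕ.zero    f≤g = f≤g []
      outcome-mono (ℕ.suc n) f≤g = subset-mono n λ S → outcome-mono n λ ω → f≤g (S ∷ ω)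

      outcome-+ : ∀ n f g → 𝔼 n p (λ ω → f ω + g ω) ≈ 𝔼 n p f + 𝔼 n p g
      outcome-+ ℕ.zero    f g = ≈-refl
      outcome-+ (ℕ.suc n) f g = ≈-trans (subset-cong n λ S → outcome-+ n _ _) (subset-+ n _ _)

      outcome-* : ∀ n c f → 𝔼 n p (λ ω → c * f ω) ≈ c * 𝔼 n p f
      outcome-* ℕ.zero    c f = ≈-refl
      outcome-* (ℕ.suc n) c f = ≈-trans (subset-cong n λ S → outcome-* n c _) (subset-* n c _)

      outcome-const : ∀ n c → 𝔼 n p (λ _ → c) ≈ c
      outcome-const ℕ.zero    c = ≈-refl
      outcome-const (ℕ.suc n) c = ≈-trans (subset-cong n λ S → outcome-const n c) (subset-const n c)

    subsets : ∀ n → Expectation (Subset n)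
    subsets n = record
      { _⟨_⟩ = 𝔼-subset n p ; ⟨⟩-mono = subset-mono n ; ⟨⟩-+ = subset-+ n ; ⟨⟩-* = subset-* n ; ⟨⟩-const = subset-const n }

    outcomes : ∀ n → Expectation (Outcome n)
    outcomes n = record
      { _⟨_⟩ = 𝔼 n p ; ⟨⟩-mono = outcome-mono n ; ⟨⟩-+ = outcome-+ n ; ⟨⟩-* = outcome-* n ; ⟨⟩-const = outcome-const n }

    hit : Side → Side → Carrier
    hit inside  inside  = 1#
    hit inside  outside = 0#
    hit outside inside  = 0#
    hit outside outside = 1#

    hit-idem : ∀ b s → hit b s * hit b s ≈ hit b s
    hit-idem inside  inside  = *-identityˡ 1#
    hit-idem inside  outside = zeroˡ 0#
    hit-idem outside inside  = zeroˡ 0#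
    hit-idem outside outside = *-identityˡ 1#

    -- The indicator of A ⊆ S (b = inside) or of A ∩ S = ∅ (b = outside).
    agree : ∀ {n} → Side → Subset n → Subset n → Carrier
    agree b []            []      = 1#
    agree b (outside ∷ A) (s ∷ S) = agree b A S
    agree b (inside ∷ A)  (s ∷ S) = hit b s * agree b A S

    -- A product of indicators is again one because `hit` is idempotent; this is how unions enter
    -- the joint probabilities.
    agree-* : ∀ {n} b (A B S : Subset n) → agree b A S * agree b B S ≈ agree b (A ∪ B) S
    agree-* b []            []            []      = *-identityˡ 1#
    agree-* b (outside ∷ A) (outside ∷ B) (s ∷ S) = agree-* b A B S
    agree-* b (inside ∷ A)  (outside ∷ B) (s ∷ S) = ≈-trans (*-assoc _ _ _) (*-congˡ (agree-* b A B S))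
    agree-* b (outside ∷ A) (inside ∷ B)  (s ∷ S) = ≈-trans
      (solve 3 (λ a h b → a :* (h :* b) := h :* (a :* b)) ≈-refl _ _ _) (*-congˡ (agree-* b A B S))
    agree-* b (inside ∷ A)  (inside ∷ B)  (s ∷ S) = ≈-trans
      (solve 3 (λ a h b → (h :* a) :* (h :* b) := (h :* h) :* (a :* b)) ≈-refl _ _ _)
      (*-cong (hit-idem b s) (agree-* b A B S))

    prob : Side → Carrier
    prob inside  = p
    prob outside = q

    agree-expectation : ∀ {n} b (A : Subset n) → subsets n ⟨ agree b A ⟩ ≈ prob b ^ ∣ A ∣
    agree-expectation b [] = ≈-refl
    agree-expectation {ℕ.suc n} b (outside ∷ A) =
      ≈-trans (mix-const _) (agree-expectation b A)
    agree-expectation {ℕ.suc n} b (inside ∷ A) = ≈-trans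
      (+-cong (*-congˡ (⟨⟩-* (subsets n) _ _)) (*-congˡ (⟨⟩-* (subsets n) _ _)))
      (≈-trans (mix-hit b (subsets n ⟨ agree b A ⟩)) (*-congˡ (agree-expectation b A)))
      where
      mix-hit : ∀ b x → p * (hit b inside * x) + q * (hit b outside * x) ≈ prob b * x
      mix-hit inside  = solve 3 (λ p q x → p :* (:1 :* x) :+ q :* (:0 :* x) := p :* x) ≈-refl p q
      mix-hit outside = solve 3 (λ p q x → p :* (:0 :* x) :+ q :* (:1 :* x) := q :* x) ≈-refl p q

    agree-∅ : ∀ {n} b (S : Subset n) → agree b ∅ S ≈ 1#
    agree-∅ b []      = ≈-refl
    agree-∅ b (s ∷ S) = agree-∅ b S

    agree-sound : ∀ {n} b (A S : Subset n) → agree b A S ≈ 0# ⊎ (∀ {i} → i ∈ A → S Vec.[ i ]= b)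
    agree-sound b []            []      = inj₂ λ ()
    agree-sound b (outside ∷ A) (s ∷ S) with agree-sound b A S
    ... | inj₁ ≈0  = inj₁ ≈0
    ... | inj₂ all = inj₂ λ { (there i∈A) → there (all i∈A) }
    agree-sound b (inside ∷ A) (s ∷ S) with agree-sound b A S | hit-sound b s
      where
      hit-sound : ∀ b s → hit b s ≈ 0# ⊎ s ≡ b
      hit-sound inside  inside  = inj₂ refl
      hit-sound inside  outside = inj₁ ≈-refl
      hit-sound outside inside  = inj₁ ≈-refl
      hit-sound outside outside = inj₂ refl
    ... | inj₁ ≈0  | _         = inj₁ (≈-trans (*-congˡ ≈0) (zeroʳ _))
    ... | inj₂ _   | inj₁ ≈0   = inj₁ (≈-trans (*-congʳ ≈0) (zeroˡ _))
    ... | inj₂ all | inj₂ refl = inj₂ λ { here → here ; (there i∈A) → there (all i∈A) }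

    independent : ∀ {n} → Subset n → Outcome n → Carrier
    independent []            []      = 1#
    independent (outside ∷ A) (S ∷ ω) = independent A ω
    independent (inside ∷ A)  (S ∷ ω) = agree outside A S * independent A ω

    independent-∅ : ∀ {n} (ω : Outcome n) → independent ∅ ω ≈ 1#
    independent-∅ []      = ≈-refl
    independent-∅ (S ∷ ω) = independent-∅ ω

    -- Expose the vertices in turn. The neighbourhood of a vertex among the later ones has to avoid
    -- the rest of `A`, of `B` or of `A ∪ B`, according to which of the sets contain the vertex, and
    -- is independent of the remaining graph.
    independent-* : ∀ {n} (A B : Subset n) →
      outcomes n ⟨ (λ ω → independent A ω * independent B ω) ⟩ ≈ q ^ pairs-in A B
    independent-* [] [] = *-identityˡ 1#
    independent-* {ℕ.suc n} (outside ∷ A) (outside ∷ B) = ≈-trans (⟨⟩-const (subsets n) _) (independent-* A B)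
    independent-* {ℕ.suc n} (inside ∷ A) (outside ∷ B) = begin-equality
      (subsets n ⊗ outcomes n) ⟨ (λ (S , ω) → agree outside A S * independent A ω * independent B ω) ⟩
        ≈⟨ ⟨⟩-cong (subsets n ⊗ outcomes n) (λ _ → *-assoc _ _ _) ⟩
      (subsets n ⊗ outcomes n) ⟨ (λ (S , ω) → agree outside A S * (independent A ω * independent B ω)) ⟩
        ≈⟨ ⊗-* (subsets n) (outcomes n) (agree outside A) (λ ω → independent A ω * independent B ω) ⟩
      subsets n ⟨ agree outside A ⟩ * outcomes n ⟨ (λ ω → independent A ω * independent B ω) ⟩
        ≈⟨ *-cong (agree-expectation outside A) (independent-* A B) ⟩
      q ^ ∣ A ∣ * q ^ pairs-in A B
        ≈⟨ ^-homo-* q ∣ A ∣ (pairs-in A B) ⟨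
      q ^ (∣ A ∣ ℕ.+ pairs-in A B) ∎
    independent-* {ℕ.suc n} (outside ∷ A) (inside ∷ B) = begin-equality
      (subsets n ⊗ outcomes n) ⟨ (λ (S , ω) → independent A ω * (agree outside B S * independent B ω)) ⟩
        ≈⟨ ⟨⟩-cong (subsets n ⊗ outcomes n) (λ _ → solve 3 (λ a h b → a :* (h :* b) := h :* (a :* b)) ≈-refl _ _ _) ⟩
      (subsets n ⊗ outcomes n) ⟨ (λ (S , ω) → agree outside B S * (independent A ω * independent B ω)) ⟩
        ≈⟨ ⊗-* (subsets n) (outcomes n) (agree outside B) (λ ω → independent A ω * independent B ω) ⟩
      subsets n ⟨ agree outside B ⟩ * outcomes n ⟨ (λ ω → independent A ω * independent B ω) ⟩
        ≈⟨ *-cong (agree-expectation outside B) (independent-* A B) ⟩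
      q ^ ∣ B ∣ * q ^ pairs-in A B
        ≈⟨ ^-homo-* q ∣ B ∣ (pairs-in A B) ⟨
      q ^ (∣ B ∣ ℕ.+ pairs-in A B) ∎
    independent-* {ℕ.suc n} (inside ∷ A) (inside ∷ B) = begin-equality
      (subsets n ⊗ outcomes n) ⟨ (λ (S , ω) → (agree outside A S * independent A ω) * (agree outside B S * independent B ω)) ⟩
        ≈⟨ ⟨⟩-cong (subsets n ⊗ outcomes n) (λ (S , ω) → ≈-trans (interchange _ _ _ _) (*-congʳ (agree-* outside A B S))) ⟩
      (subsets n ⊗ outcomes n) ⟨ (λ (S , ω) → agree outside (A ∪ B) S * (independent A ω * independent B ω)) ⟩
        ≈⟨ ⊗-* (subsets n) (outcomes n) (agree outside (A ∪ B)) (λ ω → independent A ω * independent B ω) ⟩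
      subsets n ⟨ agree outside (A ∪ B) ⟩ * outcomes n ⟨ (λ ω → independent A ω * independent B ω) ⟩
        ≈⟨ *-cong (agree-expectation outside (A ∪ B)) (independent-* A B) ⟩
      q ^ ∣ A ∪ B ∣ * q ^ pairs-in A B
        ≈⟨ ^-homo-* q ∣ A ∪ B ∣ (pairs-in A B) ⟨
      q ^ (∣ A ∪ B ∣ ℕ.+ pairs-in A B) ∎

    independent-sound : ∀ {n} (A : Subset n) (ω : Outcome n) →
      independent A ω ≈ 0# ⊎ (∀ {i j} → i ∈ A → j ∈ A → ¬ OutcomeAdj ω i j)
    independent-sound []            []      = inj₂ λ ()
    independent-sound (outside ∷ A) (S ∷ ω) with independent-sound A ω
    ... | inj₁ ≈0  = inj₁ ≈0
    ... | inj₂ ind = inj₂ λ { (there i∈A) (there j∈A) → ind i∈A j∈A }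
    independent-sound (inside ∷ A) (S ∷ ω) with agree-sound outside A S | independent-sound A ω
    ... | inj₁ ≈0  | _        = inj₁ (≈-trans (*-congʳ ≈0) (zeroˡ _))
    ... | inj₂ _   | inj₁ ≈0  = inj₁ (≈-trans (*-congˡ ≈0) (zeroʳ _))
    ... | inj₂ out | inj₂ ind = inj₂ λ
      { here        (there j∈A) → ∉-outside (out j∈A)
      ; (there i∈A) here        → ∉-outside (out i∈A)
      ; (there i∈A) (there j∈A) → ind i∈A j∈A
      }

    -- The neighbourhoods of the four core vertices among `n` others, and the graph on those; the
    -- six edges of the core are kept apart for `step`.
    Ω : ℕ → Set
    Ω n = Subset n × Subset n × Subset n × Subset n × Outcome n

    space : ∀ n → Expectation (Ω n)
    space n = subsets n ⊗ subsets n ⊗ subsets n ⊗ subsets n ⊗ outcomes n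

    IsGood : ∀ {n} → ℕ → Ω n → Set
    IsGood k (S₁ , S₂ , S₃ , S₄ , ω) = ∃ (Good k S₁ S₂ S₃ S₄ ω)

    good : ∀ {n} → Subset n → Ω n → Carrier
    good A (S₁ , S₂ , S₃ , S₄ , ω) =
      agree inside A S₁ * (agree outside A S₂ * (agree outside A S₃ * (agree outside A S₄ * independent A ω)))

    τ : Carrier
    τ = p * (q * (q * q))

    0≤τ : 0# ≤ τ
    0≤τ = *-nonneg 0≤p (*-nonneg 0≤q (*-nonneg 0≤q 0≤q))

    good-∅ : ∀ {n} (s : Ω n) → good ∅ s ≈ 1#
    good-∅ (S₁ , S₂ , S₃ , S₄ , ω) = begin-equality
      _  ≈⟨ *-cong (agree-∅ inside S₁) (*-cong (agree-∅ outside S₂) (*-cong (agree-∅ outside S₃) (*-cong (agree-∅ outside S₄) (independent-∅ ω)))) ⟩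
      1# * (1# * (1# * (1# * 1#)))  ≈⟨ solve 0 (:1 :* (:1 :* (:1 :* (:1 :* :1))) := :1) ≈-refl ⟩
      1# ∎

    good-* : ∀ {n} (A B : Subset n) →
      space n ⟨ (λ s → good A s * good B s) ⟩ ≈ τ ^ ∣ A ∪ B ∣ * q ^ pairs-in A B
    good-* {n} A B = begin-equality
      space n ⟨ (λ s → good A s * good B s) ⟩
        ≈⟨ ⟨⟩-cong (space n) (λ (S₁ , S₂ , S₃ , S₄ , ω) →
             ≈-trans (interchange _ _ _ _) (*-cong (agree-* inside A B S₁)
               (≈-trans (interchange _ _ _ _) (*-cong (agree-* outside A B S₂)
                 (≈-trans (interchange _ _ _ _) (*-cong (agree-* outside A B S₃)
                   (≈-trans (interchange _ _ _ _) (*-congʳ (agree-* outside A B S₄))))))))) ⟩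
      space n ⟨ (λ (S₁ , S₂ , S₃ , S₄ , ω) → f inside S₁ * (f outside S₂ * (f outside S₃ * (f outside S₄ * g ω)))) ⟩
        ≈⟨ ⊗-* (subsets n) (subsets n ⊗ subsets n ⊗ subsets n ⊗ outcomes n) (f inside) _ ⟩
      subsets n ⟨ f inside ⟩ * (subsets n ⊗ subsets n ⊗ subsets n ⊗ outcomes n) ⟨ (λ (S₂ , S₃ , S₄ , ω) → f outside S₂ * (f outside S₃ * (f outside S₄ * g ω))) ⟩
        ≈⟨ *-congˡ (⊗-* (subsets n) (subsets n ⊗ subsets n ⊗ outcomes n) (f outside) _) ⟩
      subsets n ⟨ f inside ⟩ * (subsets n ⟨ f outside ⟩ * (subsets n ⊗ subsets n ⊗ outcomes n) ⟨ (λ (S₃ , S₄ , ω) → f outside S₃ * (f outside S₄ * g ω)) ⟩)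
        ≈⟨ *-congˡ (*-congˡ (⊗-* (subsets n) (subsets n ⊗ outcomes n) (f outside) _)) ⟩
      subsets n ⟨ f inside ⟩ * (subsets n ⟨ f outside ⟩ * (subsets n ⟨ f outside ⟩ * (subsets n ⊗ outcomes n) ⟨ (λ (S₄ , ω) → f outside S₄ * g ω) ⟩))
        ≈⟨ *-congˡ (*-congˡ (*-congˡ (⊗-* (subsets n) (outcomes n) (f outside) g))) ⟩
      subsets n ⟨ f inside ⟩ * (subsets n ⟨ f outside ⟩ * (subsets n ⟨ f outside ⟩ * (subsets n ⟨ f outside ⟩ * outcomes n ⟨ g ⟩)))
        ≈⟨ *-cong (agree-expectation inside (A ∪ B)) (*-cong f-out (*-cong f-out (*-cong f-out (independent-* A B)))) ⟩
      p ^ m * (q ^ m * (q ^ m * (q ^ m * q ^ pairs-in A B)))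
        ≈⟨ solve 3 (λ p q e → p :* (q :* (q :* (q :* e))) := (p :* (q :* (q :* q))) :* e) ≈-refl (p ^ m) (q ^ m) _ ⟩
      p ^ m * (q ^ m * (q ^ m * q ^ m)) * q ^ pairs-in A B
        ≈⟨ *-congʳ τ^m ⟨
      τ ^ m * q ^ pairs-in A B ∎
      where
      m = ∣ A ∪ B ∣
      f : Side → Subset n → Carrier
      f b = agree b (A ∪ B)
      g : Outcome n → Carrier
      g ω = independent A ω * independent B ω
      f-out = agree-expectation outside (A ∪ B)
      τ^m : τ ^ m ≈ p ^ m * (q ^ m * (q ^ m * q ^ m))
      τ^m = ≈-trans (^-distrib-* p _ m) (*-congˡ (≈-trans (^-distrib-* q _ m) (*-congˡ (^-distrib-* q q m))))

    expected : ℕ → Carrier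
    expected k = τ ^ k * q ^ pairs k

    -- Inclusion-exclusion in the exponents of τ and of q. The overlap factor multiplies the left
    -- side rather than dividing the right one, so the identity also holds when τ or q is zero.
    good-*-overlap : ∀ {n} (A B : Subset n) →
      space n ⟨ (λ s → good A s * good B s) ⟩ * expected ∣ A ∩ B ∣ ≈ expected ∣ A ∣ * expected ∣ B ∣
    good-*-overlap A B = begin-equality
      _ ≈⟨ *-congʳ (good-* A B) ⟩
      (τ ^ ∣ A ∪ B ∣ * q ^ pairs-in A B) * (τ ^ ∣ A ∩ B ∣ * q ^ pairs ∣ A ∩ B ∣)    ≈⟨ interchange _ _ _ _ ⟩
      (τ ^ ∣ A ∪ B ∣ * τ ^ ∣ A ∩ B ∣) * (q ^ pairs-in A B * q ^ pairs ∣ A ∩ B ∣)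
        ≈⟨ *-cong (exponents τ (∣ A ∪ B ∣) (∣ A ∩ B ∣) (∣ A ∣) (∣ B ∣) (∣∪∣+∣∩∣ A B))
                  (exponents q (pairs-in A B) (pairs (∣ A ∩ B ∣)) (pairs (∣ A ∣)) (pairs (∣ B ∣)) (pairs-in+pairs-∩ A B)) ⟩
      (τ ^ ∣ A ∣ * τ ^ ∣ B ∣) * (q ^ pairs ∣ A ∣ * q ^ pairs ∣ B ∣)                  ≈⟨ interchange _ _ _ _ ⟩
      expected ∣ A ∣ * expected ∣ B ∣ ∎
      where
      exponents : ∀ x a b c d → a ℕ.+ b ≡ c ℕ.+ d → x ^ a * x ^ b ≈ x ^ c * x ^ d
      exponents x a b c d eq = ≈-trans (≈-sym (^-homo-* x a b))
        (≈-trans (≈-reflexive (≡.cong (x ^_) eq)) (^-homo-* x c d))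

    -- The case `B = ∅` of `good-*-overlap`.
    good-expectation : ∀ {n} (A : Subset n) → space n ⟨ good A ⟩ ≈ expected ∣ A ∣
    good-expectation {n} A = begin-equality
      space n ⟨ good A ⟩
        ≈⟨ ⟨⟩-cong (space n) (λ s → ≈-trans (*-congˡ (good-∅ s)) (*-identityʳ _)) ⟨
      space n ⟨ (λ s → good A s * good ∅ s) ⟩
        ≈⟨ *1*1 _ ⟨
      space n ⟨ (λ s → good A s * good ∅ s) ⟩ * (1# * 1#)
        ≈⟨ *-congˡ (≈-reflexive (≡.cong expected (≡.trans (≡.cong ∣_∣ (Subset.∩-zeroʳ A)) (Subset.∣⊥∣≡0 n)))) ⟨
      space n ⟨ (λ s → good A s * good ∅ s) ⟩ * expected ∣ A ∩ ∅ ∣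
        ≈⟨ good-*-overlap A ∅ ⟩
      expected ∣ A ∣ * expected ∣ ∅ {n = n} ∣
        ≈⟨ *-congˡ (≈-reflexive (≡.cong expected (Subset.∣⊥∣≡0 n))) ⟩
      expected ∣ A ∣ * (1# * 1#)
        ≈⟨ *1*1 _ ⟩
      expected ∣ A ∣ ∎
      where
      *1*1 : ∀ x → x * (1# * 1#) ≈ x
      *1*1 = solve 1 (λ x → x :* (:1 :* :1) := x) ≈-refl

    -- Makes `X` vanish at every outcome without a good set, as `pointwise` requires.
    good-sound : ∀ {n} (A : Subset n) (s : Ω n) → good A s ≈ 0# ⊎ IsGood ∣ A ∣ s
    good-sound A (S₁ , S₂ , S₃ , S₄ , ω)
      with agree-sound inside A S₁ | agree-sound outside A S₂ | agree-sound outside A S₃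
         | agree-sound outside A S₄ | independent-sound A ω
    ... | inj₁ ≈0 | _ | _ | _ | _ = inj₁ (zero-left ≈0)
    ... | inj₂ _ | inj₁ ≈0 | _ | _ | _ = inj₁ (zero-right (zero-left ≈0))
    ... | inj₂ _ | inj₂ _ | inj₁ ≈0 | _ | _ = inj₁ (zero-right (zero-right (zero-left ≈0)))
    ... | inj₂ _ | inj₂ _ | inj₂ _ | inj₁ ≈0 | _ = inj₁ (zero-right (zero-right (zero-right (zero-left ≈0))))
    ... | inj₂ _ | inj₂ _ | inj₂ _ | inj₂ _ | inj₁ ≈0 = inj₁ (zero-right (zero-right (zero-right (zero-right ≈0))))
    ... | inj₂ in₁ | inj₂ out₂ | inj₂ out₃ | inj₂ out₄ | inj₂ ind = inj₂ (A , record
      { size = refl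
      ; ⊆S₁ = in₁
      ; ∩S₂ = λ i∈A → ∉-outside (out₂ i∈A)
      ; ∩S₃ = λ i∈A → ∉-outside (out₃ i∈A)
      ; ∩S₄ = λ i∈A → ∉-outside (out₄ i∈A)
      ; independent = ind
      })

    -- From 𝟙(X > 0) ≥ 2 t X - (t X)² with t = 1 / 𝔼 X.
    second-moment : 0# < τ → 0# < q → ∀ {N} (0<N : 0# < fromℕ N) r {j k} → k ℕ.≤ ℕ.suc (j ℕ.+ j) →
      fromℕ 2 - (1# + (τ * q ^ j) ⁻¹ / fromℕ N) ^ k ≤ space (ground N r k) ⟨ (λ s → 𝟙 (IsGood k s)) ⟩
    second-moment 0<τ 0<q {N} 0<N r {j} {k} k≤ = begin
      fromℕ 2 - (1# + c / fromℕ N) ^ k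
        ≈⟨ normalise _ ⟩
      a * π + b * (π * π * (1# + c / fromℕ N) ^ k)
        ≤⟨ +-monoʳ-≤ _ (*-monoˡ-≤-neg (*-monoˡ-≤ (<⇒≤ (*-pos 0<π 0<π)) (uniforms-overlap (<⇒≤ 0<c) r k))) ⟩
      a * π + b * (π * π * U ⟨ (λ v → U ⟨ (λ w → c ^ common w v) ⟩) ⟩)
        ≤⟨ +-mono-≤ (≤-reflexive (*-congˡ (≈-sym mean))) (*-monoˡ-≤-neg square) ⟩
      a * P ⟨ X ⟩ + b * P ⟨ (λ s → X s * X s) ⟩
        ≈⟨ +-cong (⟨⟩-* P a X) (⟨⟩-* P b (λ s → X s * X s)) ⟨
      P ⟨ (λ s → a * X s) ⟩ + P ⟨ (λ s → b * (X s * X s)) ⟩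
        ≈⟨ ⟨⟩-+ P (λ s → a * X s) (λ s → b * (X s * X s)) ⟨
      P ⟨ (λ s → a * X s + b * (X s * X s)) ⟩
        ≤⟨ ⟨⟩-mono P pointwise ⟩
      P ⟨ (λ s → 𝟙 (IsGood k s)) ⟩ ∎
      where
      open Uniform {N} 0<N
      P = space (ground N r k)
      U = uniforms k
      c = (τ * q ^ j) ⁻¹
      0<τq^j = *-pos 0<τ (^-pos j 0<q)
      0<c : 0# < c
      0<c = ⁻¹-pos 0<τq^j
      π = expected k
      0<π : 0# < π
      0<π = *-pos (^-pos k 0<τ) (^-pos (pairs k) 0<q)
      t = π ⁻¹
      a = fromℕ 2 * t
      b = - (t * t)
      tπ≈1 : t * π ≈ 1#
      tπ≈1 = ≈-trans (*-comm _ _) (x*x⁻¹≈1 0<π)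
      common : Vec (Fin N) k → Vec (Fin N) k → ℕ
      common w v = ∣ transversal r w ∩ transversal r v ∣

      Y : Ω (ground N r k) → Vec (Fin N) k → Carrier
      Y s v = good (transversal r v) s

      X : Ω (ground N r k) → Carrier
      X s = U ⟨ Y s ⟩

      normalise : ∀ y → fromℕ 2 - y ≈ a * π + b * (π * π * y)
      normalise y = ≈-sym (≈-trans
        (solve 3 (λ t π y → (:ℕ 2 :* t) :* π :+ (:- (t :* t)) :* (π :* π :* y) :=
           :ℕ 2 :* (t :* π) :- (t :* π) :* (t :* π) :* y) ≈-refl t π y)
        (≈-trans (+-cong (*-congˡ tπ≈1) (-‿cong (*-congʳ (*-cong tπ≈1 tπ≈1))))
          (solve 1 (λ y → :ℕ 2 :* :1 :- :1 :* :1 :* y := :ℕ 2 :- y) ≈-refl y)))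

      *-monoˡ-≤-neg : ∀ {x y} → x ≤ y → b * y ≤ b * x
      *-monoˡ-≤-neg {x} {y} x≤y = ≤-diff _ (*-nonneg (0≤x*x t) (x≤y⇒0≤y-x x≤y))
        (solve 3 (λ t x y → (:- (t :* t)) :* x :- (:- (t :* t)) :* y := t :* t :* (y :- x)) ≈-refl t x y)

      pointwise : ∀ s → a * X s + b * (X s * X s) ≤ 𝟙 (IsGood k s)
      pointwise s with 𝟙-cases (IsGood k s)
      ... | inj₁ (_ , ≈1) = ≤-respʳ-≈ (≈-sym ≈1) (≤-diff _ (0≤x*x (1# - t * X s))
        (solve 2 (λ t x → :1 :- (:ℕ 2 :* t :* x :+ (:- (t :* t)) :* (x :* x)) := (:1 :- t :* x) :* (:1 :- t :* x)) ≈-refl t (X s)))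
      ... | inj₂ (¬good , ≈0) = ≤-reflexive (≈-trans (+-cong (*-congˡ X≈0) (*-congˡ (*-cong X≈0 X≈0)))
        (≈-trans (solve 2 (λ a b → a :* :0 :+ b :* (:0 :* :0) := :0) ≈-refl a b) (≈-sym ≈0)))
        where
        vanishes : ∀ v → good (transversal r v) s ≈ 0#
        vanishes v with good-sound (transversal r v) s
        ... | inj₁ ≈0   = ≈0
        ... | inj₂ isGood = contradiction (≡.subst (λ m → IsGood m s) (∣transversal∣ r v) isGood) ¬good
        X≈0 : X s ≈ 0#
        X≈0 = ≈-trans (⟨⟩-cong U vanishes) (⟨⟩-const U 0#)

      mean : P ⟨ X ⟩ ≈ π
      mean = begin-equality
        P ⟨ X ⟩
          ≈⟨ uniforms-commutes k P (λ s v → good (transversal r v) s) ⟩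
        U ⟨ (λ v → P ⟨ good (transversal r v) ⟩) ⟩
          ≈⟨ ⟨⟩-cong U (λ v → ≈-trans (good-expectation (transversal r v)) (≈-reflexive (≡.cong expected (∣transversal∣ r v)))) ⟩
        U ⟨ (λ _ → π) ⟩
          ≈⟨ ⟨⟩-const U π ⟩
        π ∎

      -- By `pairs≤` the factor `expected ℓ` in `good-*-overlap` is at least `(τ * q ^ j) ^ ℓ`, the
      -- reciprocal of `c ^ ℓ`.
      joint : ∀ v w → P ⟨ (λ s → good (transversal r w) s * good (transversal r v) s) ⟩ ≤ π * π * c ^ common w v
      joint v w = *-cancelˡ-≤ (^-pos ℓ 0<τq^j) (begin
        (τ * q ^ j) ^ ℓ * e                  ≈⟨ *-comm _ _ ⟩
        e * (τ * q ^ j) ^ ℓ                  ≤⟨ *-monoˡ-≤ 0≤e (begin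
          (τ * q ^ j) ^ ℓ                      ≈⟨ ^-distrib-* τ (q ^ j) ℓ ⟩
          τ ^ ℓ * (q ^ j) ^ ℓ                  ≈⟨ *-congˡ (^-assocʳ q j ℓ) ⟩
          τ ^ ℓ * q ^ (j ℕ.* ℓ)                ≤⟨ *-monoˡ-≤ (^-nonneg ℓ 0≤τ) (^-anti-≤ 0≤q q≤1 (pairs≤ j ℓ (ℕ.≤-trans ℓ≤k k≤))) ⟩
          expected ℓ                           ∎) ⟩
        e * expected ℓ                       ≈⟨ good-*-overlap (transversal r w) (transversal r v) ⟩
        expected ∣ transversal r w ∣ * expected ∣ transversal r v ∣
                                             ≈⟨ *-cong (≈-reflexive (≡.cong expected (∣transversal∣ r w))) (≈-reflexive (≡.cong expected (∣transversal∣ r v))) ⟩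
        π * π                                ≈⟨ *-identityʳ _ ⟨
        π * π * 1#                           ≈⟨ *-congˡ (⁻¹-^ ℓ 0<τq^j) ⟨
        π * π * ((τ * q ^ j) ^ ℓ * c ^ ℓ)    ≈⟨ solve 3 (λ a b c → a :* (b :* c) := b :* (a :* c)) ≈-refl (π * π) _ _ ⟩
        (τ * q ^ j) ^ ℓ * (π * π * c ^ ℓ)    ∎)
        where
        ℓ = common w v
        e = P ⟨ (λ s → good (transversal r w) s * good (transversal r v) s) ⟩
        0≤e : 0# ≤ e
        0≤e = ≤-respʳ-≈ (≈-sym (good-* (transversal r w) (transversal r v)))
          (*-nonneg (^-nonneg ∣ transversal r w ∪ transversal r v ∣ 0≤τ) (^-nonneg (pairs-in (transversal r w) (transversal r v)) 0≤q))
        ℓ≤k : ℓ ℕ.≤ k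
        ℓ≤k = ≡.subst (ℓ ℕ.≤_) (∣transversal∣ r w) (Subset.∣p∩q∣≤∣p∣ (transversal r w) (transversal r v))

      square : P ⟨ (λ s → X s * X s) ⟩ ≤ π * π * U ⟨ (λ v → U ⟨ (λ w → c ^ common w v) ⟩) ⟩
      square = begin
        P ⟨ (λ s → X s * X s) ⟩
          ≈⟨ ⟨⟩-cong P (λ s → ≈-trans (≈-sym (⟨⟩-* U (X s) (Y s))) (⟨⟩-cong U λ v → ≈-sym (⟨⟩-*ʳ U (Y s v) (Y s)))) ⟩
        P ⟨ (λ s → U ⟨ (λ v → U ⟨ (λ w → good (transversal r w) s * good (transversal r v) s) ⟩) ⟩) ⟩
          ≈⟨ uniforms-commutes k P (λ s v → U ⟨ (λ w → good (transversal r w) s * good (transversal r v) s) ⟩) ⟩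
        U ⟨ (λ v → P ⟨ (λ s → U ⟨ (λ w → good (transversal r w) s * good (transversal r v) s) ⟩) ⟩) ⟩
          ≈⟨ ⟨⟩-cong U (λ v → uniforms-commutes k P (λ s w → good (transversal r w) s * good (transversal r v) s)) ⟩
        U ⟨ (λ v → U ⟨ (λ w → P ⟨ (λ s → good (transversal r w) s * good (transversal r v) s) ⟩) ⟩) ⟩
          ≤⟨ ⟨⟩-mono U (λ v → ⟨⟩-mono U λ w → joint v w) ⟩
        U ⟨ (λ v → U ⟨ (λ w → π * π * c ^ common w v) ⟩) ⟩
          ≈⟨ ⟨⟩-cong U (λ v → ⟨⟩-* U (π * π) (λ w → c ^ common w v)) ⟩
        U ⟨ (λ v → π * π * U ⟨ (λ w → c ^ common w v) ⟩) ⟩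
          ≈⟨ ⟨⟩-* U (π * π) (λ v → U ⟨ (λ w → c ^ common w v) ⟩) ⟩
        π * π * U ⟨ (λ v → U ⟨ (λ w → c ^ common w v) ⟩) ⟩ ∎

    -- For k y < 1 this bounds (1 + y)^k by 1 / (1 - k y). In the inductive step (1 + y) (1 - (k +
    -- 1) y) falls short of 1 - k y by (k + 1) y².
    [1+y]^k[1-ky]≤1 : ∀ {y} → 0# ≤ y → ∀ k → (1# + y) ^ k * (1# - fromℕ k * y) ≤ 1#
    [1+y]^k[1-ky]≤1 {y} 0≤y ℕ.zero = ≤-reflexive (solve 1 (λ y → :1 :* (:1 :- :0 :* y) := :1) ≈-refl y)
    [1+y]^k[1-ky]≤1 {y} 0≤y (ℕ.suc k) = ≤-trans
      (≤-diff _ (*-nonneg (^-nonneg k (+-nonneg 0≤1 0≤y)) (*-nonneg (0≤fromℕ (ℕ.suc k)) (0≤x*x y)))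
        (solve 3 (λ y k e → e :* (:1 :- k :* y) :- (:1 :+ y) :* e :* (:1 :- (:1 :+ k) :* y) := e :* ((:1 :+ k) :* (y :* y)))
          ≈-refl y (fromℕ k) ((1# + y) ^ k)))
      ([1+y]^k[1-ky]≤1 0≤y k)

    good-likely : 0# < τ → 0# < q → ∀ {N j k} → k ℕ.≤ ℕ.suc (j ℕ.+ j) → 1 ℕ.≤ k →
      fromℕ 5 * fromℕ k ≤ τ * q ^ j * fromℕ N →
      ∀ n → k ℕ.* N ℕ.≤ n → fromℕ 3 ≤ fromℕ 4 * space n ⟨ (λ s → 𝟙 (IsGood k s)) ⟩
    good-likely 0<τ 0<q {N} {j} {k} k≤ 1≤k 5k≤ n kN≤n with ℕ.m≤n⇒∃[o]m+o≡n kN≤n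
    ... | r , refl rewrite ≡.sym (ground≡ N r k) = begin
      fromℕ 3                                            ≤⟨ three e≤ ⟩
      fromℕ 4 * (fromℕ 2 - e)                            ≤⟨ *-monoˡ-≤ (0≤fromℕ 4) (second-moment 0<τ 0<q {N} 0<N r {j} k≤) ⟩
      fromℕ 4 * space (ground N r k) ⟨ (λ s → 𝟙 (IsGood k s)) ⟩ ∎
      where
      0<τq^j = *-pos 0<τ (^-pos j 0<q)
      0<k : 0# < fromℕ k
      0<k = <-≤-trans (0<fromℕ-suc 0) (fromℕ-mono-≤ 1≤k)
      0<N : 0# < fromℕ N
      0<N = *-cancelˡ-pos (<⇒≤ 0<τq^j) (<-≤-trans (*-pos (0<fromℕ-suc 4) 0<k) 5k≤)
      y = (τ * q ^ j) ⁻¹ / fromℕ N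
      0≤y : 0# ≤ y
      0≤y = <⇒≤ (*-pos (⁻¹-pos 0<τq^j) (⁻¹-pos 0<N))
      e = (1# + y) ^ k
      5ky≤1 : fromℕ 5 * fromℕ k * y ≤ 1#
      5ky≤1 = begin
        fromℕ 5 * fromℕ k * y        ≤⟨ *-monoʳ-≤ 0≤y 5k≤ ⟩
        τ * q ^ j * fromℕ N * y      ≈⟨ interchange _ _ _ _ ⟩
        τ * q ^ j * (τ * q ^ j) ⁻¹ * (fromℕ N * fromℕ N ⁻¹) ≈⟨ *-cong (x*x⁻¹≈1 0<τq^j) (x*x⁻¹≈1 0<N) ⟩
        1# * 1#                      ≈⟨ *-identityˡ 1# ⟩
        1#                           ∎
      e≤ : fromℕ 4 * e ≤ fromℕ 5
      e≤ = begin
        fromℕ 4 * e                                ≤⟨ ≤-diff _ (*-nonneg (^-nonneg k (+-nonneg 0≤1 0≤y)) (x≤y⇒0≤y-x 5ky≤1))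
          (solve 3 (λ e k y → :ℕ 5 :* (e :* (:1 :- k :* y)) :- :ℕ 4 :* e := e :* (:1 :- :ℕ 5 :* k :* y)) ≈-refl e (fromℕ k) y) ⟩
        fromℕ 5 * (e * (1# - fromℕ k * y))         ≤⟨ *-monoˡ-≤ (0≤fromℕ 5) ([1+y]^k[1-ky]≤1 0≤y k) ⟩
        fromℕ 5 * 1#                               ≈⟨ *-identityʳ _ ⟩
        fromℕ 5                                    ∎
      three : ∀ {e} → fromℕ 4 * e ≤ fromℕ 5 → fromℕ 3 ≤ fromℕ 4 * (fromℕ 2 - e)
      three {e} e≤5/4 = ≤-diff _ (x≤y⇒0≤y-x e≤5/4)
        (solve 1 (λ e → :ℕ 4 :* (:ℕ 2 :- e) :- :ℕ 3 := :ℕ 5 :- :ℕ 4 :* e) ≈-refl e)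

    -- By conditioning on whether the first m elements are all present.
    peel : ∀ m {n V} {f : Subset (m ℕ.+ n) → Carrier} → (∀ S → V ≤ f S) →
           p ^ m * 𝔼-subset n p (λ S → f (Vec.replicate m inside ++ S)) + (1# - p ^ m) * V ≤ 𝔼-subset (m ℕ.+ n) p f
    peel ℕ.zero {n} {V} V≤f = ≤-reflexive (solve 2 (λ e v → :1 :* e :+ (:1 :- :1) :* v := e) ≈-refl _ V)
    peel (ℕ.suc m) {n} {V} {f} V≤f = begin
      p * p ^ m * e + (1# - p * p ^ m) * V
        ≈⟨ solve 4 (λ p r e v → p :* r :* e :+ (:1 :- p :* r) :* v := p :* (r :* e :+ (:1 :- r) :* v) :+ (:1 :- p) :* v) ≈-refl p (p ^ m) e V ⟩
      p * (p ^ m * e + (1# - p ^ m) * V) + q * V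
        ≤⟨ mix-mono (peel m (V≤f ∘ (inside ∷_)))
             (≤-respˡ-≈ (subset-const (m ℕ.+ n) V) (subset-mono (m ℕ.+ n) (V≤f ∘ (outside ∷_)))) ⟩
      𝔼-subset (ℕ.suc m ℕ.+ n) p f ∎
      where e = 𝔼-subset n p (λ S → f (Vec.replicate (ℕ.suc m) inside ++ S))

    -- Exposing the vertices four at a time

    module _ (Ev : ∀ {n} → Outcome n → Set) {k : ℕ}
      (extend : ∀ {n S₁ S₂ S₃ S₄} {ω : Outcome n} → Ev ω → Ev (S₁ ∷ S₂ ∷ S₃ ∷ S₄ ∷ ω))
      (create : ∀ {n} {S₁ S₂ S₃ S₄ : Subset n} {ω A} → Good k S₁ S₂ S₃ S₄ ω A →
                Ev ((inside ∷ inside ∷ inside ∷ S₁) ∷ (inside ∷ inside ∷ S₂) ∷ (inside ∷ S₃) ∷ S₄ ∷ ω))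
      where

      private
        average : ∀ {A} (P : Expectation A) {a b f g} → (∀ x → a * f x + b ≤ g x) → a * P ⟨ f ⟩ + b ≤ P ⟨ g ⟩
        average P {a} {b} {f} af+b≤g = ≤-respˡ-≈
          (≈-trans (⟨⟩-+ P _ _) (+-cong (⟨⟩-* P a f) (⟨⟩-const P b))) (⟨⟩-mono P af+b≤g)

        const≤ : ∀ {A} (P : Expectation A) {V f} → (∀ a → V ≤ f a) → V ≤ P ⟨ f ⟩
        const≤ P V≤f = ≤-respˡ-≈ (⟨⟩-const P _) (⟨⟩-mono P V≤f)

      -- If the four new vertices span a K₄, `create` turns a good set into the event; if not,
      -- `extend` still transports the event from the other vertices. Of the six edges, the first
      -- three neighbourhoods hold 3, 2 and 1, whence three uses of `peel`. All conditional
      -- probabilities are at least `V` because `extend` holds for arbitrary neighbourhoods.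
      step : ∀ n → p ^ 6 * space n ⟨ (λ s → 𝟙 (IsGood k s)) ⟩ + (1# - p ^ 6) * ℙ n p Ev ≤ ℙ (4 ℕ.+ n) p Ev
      step n = ≤-trans (≤-reflexive (split p _ V)) peel₁
        where
        V = ℙ n p Ev

        F₃ : Subset (3 ℕ.+ n) → Subset (2 ℕ.+ n) → Subset (1 ℕ.+ n) → Carrier
        F₃ S₁ S₂ S₃ = (subsets n ⊗ outcomes n) ⟨ (λ (S₄ , ω) → 𝟙 (Ev (S₁ ∷ S₂ ∷ S₃ ∷ S₄ ∷ ω))) ⟩
        F₂ : Subset (3 ℕ.+ n) → Subset (2 ℕ.+ n) → Carrier
        F₂ S₁ S₂ = subsets (1 ℕ.+ n) ⟨ F₃ S₁ S₂ ⟩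
        F₁ : Subset (3 ℕ.+ n) → Carrier
        F₁ S₁ = subsets (2 ℕ.+ n) ⟨ F₂ S₁ ⟩

        R₃ : Subset n → Subset n → Subset n → Carrier
        R₃ S₁ S₂ S₃ = (subsets n ⊗ outcomes n) ⟨ (λ (S₄ , ω) → 𝟙 (IsGood k (S₁ , S₂ , S₃ , S₄ , ω))) ⟩
        R₂ : Subset n → Subset n → Carrier
        R₂ S₁ S₂ = subsets n ⟨ R₃ S₁ S₂ ⟩
        R₁ : Subset n → Carrier
        R₁ S₁ = subsets n ⟨ R₂ S₁ ⟩

        V≤F₃ : ∀ S₁ S₂ S₃ → V ≤ F₃ S₁ S₂ S₃
        V≤F₃ S₁ S₂ S₃ = const≤ (subsets n) λ S₄ → ⟨⟩-mono (outcomes n) λ ω → 𝟙-mono extend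
        V≤F₂ : ∀ S₁ S₂ → V ≤ F₂ S₁ S₂
        V≤F₂ S₁ S₂ = const≤ (subsets (1 ℕ.+ n)) (V≤F₃ S₁ S₂)
        V≤F₁ : ∀ S₁ → V ≤ F₁ S₁
        V≤F₁ S₁ = const≤ (subsets (2 ℕ.+ n)) (V≤F₂ S₁)

        peel₃ : ∀ S₁ S₂ → p ^ 1 * R₂ S₁ S₂ + (1# - p ^ 1) * V ≤ F₂ (inside ∷ inside ∷ inside ∷ S₁) (inside ∷ inside ∷ S₂)
        peel₃ S₁ S₂ = ≤-trans
          (+-monoˡ-≤ _ (*-monoˡ-≤ (^-nonneg 1 0≤p) (⟨⟩-mono (subsets n ⊗ subsets n ⊗ outcomes n) λ _ → 𝟙-mono λ g → create (proj₂ g))))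
          (peel 1 (V≤F₃ _ _))
        peel₂ : ∀ S₁ → p ^ 2 * (p ^ 1 * R₁ S₁ + (1# - p ^ 1) * V) + (1# - p ^ 2) * V ≤ F₁ (inside ∷ inside ∷ inside ∷ S₁)
        peel₂ S₁ = ≤-trans
          (+-monoˡ-≤ _ (*-monoˡ-≤ (^-nonneg 2 0≤p) (average (subsets n) (peel₃ S₁))))
          (peel 2 (V≤F₂ _))
        peel₁ : p ^ 3 * (p ^ 2 * (p ^ 1 * subsets n ⟨ R₁ ⟩ + (1# - p ^ 1) * V) + (1# - p ^ 2) * V) + (1# - p ^ 3) * V ≤ subsets (3 ℕ.+ n) ⟨ F₁ ⟩
        peel₁ = ≤-trans
          (+-monoˡ-≤ _ (*-monoˡ-≤ (^-nonneg 3 0≤p) (average₂ peel₂)))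
          (peel 3 V≤F₁)
          where
          average₂ : ∀ {g} → (∀ S₁ → p ^ 2 * (p ^ 1 * R₁ S₁ + (1# - p ^ 1) * V) + (1# - p ^ 2) * V ≤ g S₁) →
                     p ^ 2 * (p ^ 1 * subsets n ⟨ R₁ ⟩ + (1# - p ^ 1) * V) + (1# - p ^ 2) * V ≤ subsets n ⟨ g ⟩
          average₂ bound = ≤-trans
            (+-monoˡ-≤ _ (*-monoˡ-≤ (^-nonneg 2 0≤p) (average (subsets n) (λ _ → ≤-refl))))
            (average (subsets n) bound)

        split : ∀ p r v → p ^ 6 * r + (1# - p ^ 6) * v ≈
          p ^ 3 * (p ^ 2 * (p ^ 1 * r + (1# - p ^ 1) * v) + (1# - p ^ 2) * v) + (1# - p ^ 3) * v
        split = solve 3 (λ p r v → p :^ 6 :* r :+ (:1 :- p :^ 6) :* v :=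
          p :^ 3 :* (p :^ 2 :* (p :^ 1 :* r :+ (:1 :- p :^ 1) :* v) :+ (:1 :- p :^ 2) :* v) :+ (:1 :- p :^ 3) :* v) ≈-refl

      p^6≤1 : p ^ 6 ≤ 1#
      p^6≤1 = ^-anti-≤ {m = 0} {n = 6} 0≤p p≤1 z≤n

      -- The bound solves the recursion x ↦ s ρ + (1 - s) x with s = p⁶, started at 0. The good set
      -- is sought among all vertices not yet exposed, so ρ has to be a lower bound for every number
      -- of vertices from `m` on.
      grow : ∀ {ρ m} → (∀ n → m ℕ.≤ n → ρ ≤ space n ⟨ (λ s → 𝟙 (IsGood k s)) ⟩) →
             ∀ M → ρ * (1# - (1# - p ^ 6) ^ M) ≤ ℙ (M ℕ.* 4 ℕ.+ m) p Ev
      grow {ρ} {m} ρ≤ ℕ.zero = ≤-respˡ-≈ (solve 1 (λ r → :0 := r :* (:1 :- :1)) ≈-refl ρ)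
        (⟨⟩-nonneg (outcomes m) λ ω → 𝟙-nonneg (Ev ω))
      grow {ρ} {m} ρ≤ (ℕ.suc M) = begin
        ρ * (1# - (1# - p ^ 6) * (1# - p ^ 6) ^ M)
          ≈⟨ solve 3 (λ r s x → r :* (:1 :- (:1 :- s) :* x) := s :* r :+ (:1 :- s) :* (r :* (:1 :- x))) ≈-refl ρ (p ^ 6) _ ⟩
        p ^ 6 * ρ + (1# - p ^ 6) * (ρ * (1# - (1# - p ^ 6) ^ M))
          ≤⟨ +-mono-≤ (*-monoˡ-≤ (^-nonneg 6 0≤p) (ρ≤ n (ℕ.m≤n+m m (M ℕ.* 4))))
                      (*-monoˡ-≤ (x≤y⇒0≤y-x p^6≤1) (grow ρ≤ M)) ⟩
        p ^ 6 * space n ⟨ (λ s → 𝟙 (IsGood k s)) ⟩ + (1# - p ^ 6) * ℙ n p Ev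
          ≤⟨ step n ⟩
        ℙ (4 ℕ.+ n) p Ev ∎
        where n = M ℕ.* 4 ℕ.+ m

      -- A good set has probability at least 3/4, and all `M` attempts at a K₄ fail with probability
      -- at most 1/4; the product 9/16 exceeds 1/2. Multiplying by 16 avoids fractions.
      likely : 0# < τ → 0# < q → ∀ {N M j} → k ℕ.≤ ℕ.suc (j ℕ.+ j) → 1 ℕ.≤ k →
        fromℕ 5 * fromℕ k ≤ τ * q ^ j * fromℕ N → fromℕ 3 ≤ p ^ 6 * fromℕ M →
        ∀ n → M ℕ.* 4 ℕ.+ k ℕ.* N ℕ.≤ n → 1# / fromℕ 2 < ℙ n p Ev
      likely 0<τ 0<q {N} {M} {j} k≤ 1≤k 5k≤ 3≤ n fits with ℕ.m≤n⇒∃[o]m+o≡n fits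
      ... | o , refl rewrite ℕ.+-assoc (M ℕ.* 4) (k ℕ.* N) o =
        [ (λ F≤½ → contradiction (≤-trans 9≤16F (*-monoˡ-≤ (0≤fromℕ 16) F≤½)) (<⇒≱ 16½<9)) , (λ ½<F → ½<F) ]′
          (≤-<-connex F (1# / fromℕ 2))
        where
        F = ℙ (M ℕ.* 4 ℕ.+ (k ℕ.* N ℕ.+ o)) p Ev
        ρ = fromℕ 3 * fromℕ 4 ⁻¹
        s = p ^ 6
        x = (1# - s) ^ M
        0≤s = ^-nonneg 6 0≤p
        0≤1-s = x≤y⇒0≤y-x p^6≤1

        4ρ≈3 : fromℕ 4 * ρ ≈ fromℕ 3
        4ρ≈3 = ≈-trans (solve 3 (λ a b c → a :* (b :* c) := b :* (a :* c)) ≈-refl _ _ _)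
          (≈-trans (*-congˡ (x*x⁻¹≈1 (0<fromℕ-suc 3))) (*-identityʳ _))

        ρ≤ : ∀ n → k ℕ.* N ℕ.+ o ℕ.≤ n → ρ ≤ space n ⟨ (λ s → 𝟙 (IsGood k s)) ⟩
        ρ≤ n kN+o≤n = *-cancelˡ-≤ (0<fromℕ-suc 3) (≤-respˡ-≈ (≈-sym 4ρ≈3)
          (good-likely 0<τ 0<q {N} {j} k≤ 1≤k 5k≤ n (ℕ.≤-trans (ℕ.m≤m+n (k ℕ.* N) o) kN+o≤n)))

        -- (1 - s)^M is at most 1 / (1 + s)^M, which `bernoulli` bounds by 1 / (1 + M s) ≤ 1/4.
        x*4≤1 : x * fromℕ 4 ≤ 1#
        x*4≤1 = begin
          x * fromℕ 4                  ≤⟨ *-monoˡ-≤ (^-nonneg M 0≤1-s) (+-monoʳ-≤ 1# 3≤) ⟩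
          x * (1# + s * fromℕ M)       ≈⟨ *-congˡ (+-congˡ (*-comm s (fromℕ M))) ⟩
          x * (1# + fromℕ M * s)       ≤⟨ *-monoˡ-≤ (^-nonneg M 0≤1-s) (bernoulli M 0≤s) ⟩
          x * (1# + s) ^ M             ≈⟨ ^-distrib-* (1# - s) (1# + s) M ⟨
          ((1# - s) * (1# + s)) ^ M    ≤⟨ ^-monoˡ-≤ M (*-nonneg 0≤1-s (+-nonneg 0≤1 0≤s)) (1-s²≤1 s) ⟩
          1# ^ M                       ≈⟨ 1^n≈1 M ⟩
          1#                           ∎
          where
          1-s²≤1 : ∀ s → (1# - s) * (1# + s) ≤ 1#
          1-s²≤1 s = ≤-diff _ (0≤x*x s) (solve 1 (λ s → :1 :- (:1 :- s) :* (:1 :+ s) := s :* s) ≈-refl s)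

        9≤16F : fromℕ 9 ≤ fromℕ 16 * F
        9≤16F = begin
          fromℕ 9                        ≤⟨ 9≤ x*4≤1 ⟩
          fromℕ 3 * (fromℕ 4 * (1# - x)) ≈⟨ *-congʳ 4ρ≈3 ⟨
          fromℕ 4 * ρ * (fromℕ 4 * (1# - x)) ≈⟨ 16≈4*4 ρ (1# - x) ⟩
          fromℕ 16 * (ρ * (1# - x))      ≤⟨ *-monoˡ-≤ (0≤fromℕ 16) (grow {ρ} {k ℕ.* N ℕ.+ o} ρ≤ M) ⟩
          fromℕ 16 * F                   ∎
          where
          9≤ : ∀ {x} → x * fromℕ 4 ≤ 1# → fromℕ 9 ≤ fromℕ 3 * (fromℕ 4 * (1# - x))
          9≤ {x} x*4≤1 = ≤-diff _ (*-nonneg (0≤fromℕ 3) (x≤y⇒0≤y-x x*4≤1))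
            (solve 1 (λ x → :ℕ 3 :* (:ℕ 4 :* (:1 :- x)) :- :ℕ 9 := :ℕ 3 :* (:1 :- x :* :ℕ 4)) ≈-refl x)
          16≈4*4 : ∀ r z → fromℕ 4 * r * (fromℕ 4 * z) ≈ fromℕ 16 * (r * z)
          16≈4*4 = solve 2 (λ r z → :ℕ 4 :* r :* (:ℕ 4 :* z) := :ℕ 16 :* (r :* z)) ≈-refl

        16½<9 : fromℕ 16 * (1# / fromℕ 2) < fromℕ 9
        16½<9 = <-diff 1# 0<1 (≈-trans
          (+-congˡ (-‿cong (≈-trans (16½ (fromℕ 2 ⁻¹)) (*-congˡ (x*x⁻¹≈1 (0<fromℕ-suc 1))))))
          (solve 0 (:ℕ 9 :- :ℕ 8 :* :1 := :1) ≈-refl))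
          where
          16½ : ∀ h → fromℕ 16 * (1# * h) ≈ fromℕ 8 * (fromℕ 2 * h)
          16½ = solve 1 (λ h → :ℕ 16 :* (:1 :* h) := :ℕ 8 :* (:ℕ 2 :* h)) ≈-refl

-- Brooms and their occurrence as induced subgraphs

open Graph

≅-sym : ∀ {G H} → G ≅ H → H ≅ G
≅-sym {G} {H} (φ , adj) = ↔-sym φ , λ u v → mk⇔
  (λ a → Equivalence.from (adj _ _) (≡.subst₂ (Adj H) (≡.sym (strictlyInverseˡ u)) (≡.sym (strictlyInverseˡ v)) a))
  (λ a → ≡.subst₂ (Adj H) (strictlyInverseˡ u) (strictlyInverseˡ v) (Equivalence.to (adj _ _) a))
  where open Inverse φ

≅-trans : ∀ {G H K} → G ≅ H → H ≅ K → G ≅ K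
≅-trans (φ , adj) (ψ , adj′) = ψ ↔-∘ φ , λ u v → adj′ _ _ ⇔-∘ adj u v

Colourable-resp : ∀ {G H c} → G ≅ H → Colourable H c → Colourable G c
Colourable-resp (φ , adj) (f , proper) = f ∘ Inverse.to φ , λ a → proper (Equivalence.to (adj _ _) a)

ChromaticNumber-resp : ∀ {G H c} → G ≅ H → ChromaticNumber H c → ChromaticNumber G c
ChromaticNumber-resp {G} {H} G≅H (col , least) =
  Colourable-resp {G} {H} G≅H col , λ col′ → least (Colourable-resp {H} {G} (≅-sym {G} {H} G≅H) col′)

Connected-resp : ∀ {G H} → G ≅ H → Connected H → Connected G
Connected-resp {G} {H} G≅H conn u v = ≡.subst₂ (Star (Adj G)) (strictlyInverseʳ u) (strictlyInverseʳ v)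
  (Star.gmap from (Equivalence.to (proj₂ (≅-sym {G} {H} G≅H) _ _)) (conn (to u) (to v)))
  where open Inverse (proj₁ G≅H)

data BroomVertex (k : ℕ) : Set where
  core : Fin 4 → BroomVertex k
  leaf : Fin k → BroomVertex k

BroomAdj : ∀ {k} → BroomVertex k → BroomVertex k → Set
BroomAdj (core i)       (core j)       = i ≢ j
BroomAdj (core zero)    (leaf _)       = ⊤
BroomAdj (core (suc _)) (leaf _)       = ⊥
BroomAdj (leaf _)       (core zero)    = ⊤
BroomAdj (leaf _)       (core (suc _)) = ⊥
BroomAdj (leaf _)       (leaf _)       = ⊥

broom : ℕ → Graph
broom k = record
  { Vertex  = BroomVertex k
  ; Adj     = BroomAdj
  ; adj-sym = λ {u} {v} → symm u v
  ; irrefl  = λ { {u} refl → irr u }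
  }
  where
  symm : ∀ u v → BroomAdj u v → BroomAdj v u
  symm (core i)       (core j)       i≢j = i≢j ∘ ≡.sym
  symm (core zero)    (leaf _)       _   = tt
  symm (leaf _)       (core zero)    _   = tt

  irr : ∀ u → ¬ BroomAdj u u
  irr (core i) i≢i = i≢i refl

-- Leaves meet only `core zero` and may share the colour of another core vertex; conversely, a
-- proper colouring is injective on the core.
broom-chromatic : ∀ k → ChromaticNumber (broom k) 4
broom-chromatic k = (colour , λ {u} {v} → proper u v) , λ (f , f-proper) →
  Fin.injective⇒≤ {f = f ∘ core} λ {i} {j} eq → decidable-stable (i Fin.≟ j) λ i≢j → f-proper i≢j eq
  where
  colour : BroomVertex k → Fin 4
  colour (core i) = i
  colour (leaf _) = suc zero

  proper : ∀ u v → BroomAdj u v → colour u ≢ colour v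
  proper (core i)    (core j)    i≢j = i≢j
  proper (core zero) (leaf _)    _ ()
  proper (leaf _)    (core zero) _ ()

broom-connected : ∀ k → Connected (broom k)
broom-connected k u v = to-centre u ◅◅ from-centre v
  where
  to-centre : ∀ u → Star BroomAdj u (core zero)
  to-centre (core zero)    = Star.ε
  to-centre (core (suc i)) = (λ ()) ◅ Star.ε
  to-centre (leaf _)       = tt ◅ Star.ε

  from-centre : ∀ v → Star BroomAdj (core zero) v
  from-centre (core zero)    = Star.ε
  from-centre (core (suc i)) = (λ ()) ◅ Star.ε
  from-centre (leaf _)       = tt ◅ Star.ε

rank : ∀ {n} (A : Subset n) → Σ (Fin n) (_∈ A) → Fin ∣ A ∣
rank (outside ∷ A) (suc i , there i∈A) = rank A (i , i∈A)
rank (inside  ∷ A) (zero  , here)      = zero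
rank (inside  ∷ A) (suc i , there i∈A) = suc (rank A (i , i∈A))

select : ∀ {n} (A : Subset n) → Fin ∣ A ∣ → Σ (Fin n) (_∈ A)
select (outside ∷ A) r       = let i , i∈A = select A r in suc i , there i∈A
select (inside  ∷ A) zero    = zero , here
select (inside  ∷ A) (suc r) = let i , i∈A = select A r in suc i , there i∈A

rank-select : ∀ {n} (A : Subset n) r → rank A (select A r) ≡ r
rank-select (outside ∷ A) r       = rank-select A r
rank-select (inside  ∷ A) zero    = refl
rank-select (inside  ∷ A) (suc r) = ≡.cong suc (rank-select A r)

select-rank : ∀ {n} (A : Subset n) i → select A (rank A i) ≡ i
select-rank (outside ∷ A) (suc i , there i∈A) =
  ≡.cong (λ (i , i∈A) → suc i , there i∈A) (select-rank A (i , i∈A))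
select-rank (inside  ∷ A) (zero  , here)      = refl
select-rank (inside  ∷ A) (suc i , there i∈A) =
  ≡.cong (λ (i , i∈A) → suc i , there i∈A) (select-rank A (i , i∈A))

-- The leading `inside` entries of the first three neighbourhoods are the six edges of the K₄.
broom-induced : ∀ {n k} {S₁ S₂ S₃ S₄ : Subset n} {ω A} → Good k S₁ S₂ S₃ S₄ ω A →
  induced (graph ((inside ∷ inside ∷ inside ∷ S₁) ∷ (inside ∷ inside ∷ S₂) ∷ (inside ∷ S₃) ∷ S₄ ∷ ω))
          (_∈ inside ∷ inside ∷ inside ∷ inside ∷ A)
  ≅ broom k
broom-induced {S₁ = S₁} {S₂} {S₃} {S₄} {ω} {A} record
  { size = refl ; ⊆S₁ = ⊆S₁ ; ∩S₂ = ∩S₂ ; ∩S₃ = ∩S₃ ; ∩S₄ = ∩S₄ ; independent = independent } =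
  mk↔ₛ′ to from to-from from-to , adj
  where
  W = inside ∷ inside ∷ inside ∷ inside ∷ A
  ω′ = (inside ∷ inside ∷ inside ∷ S₁) ∷ (inside ∷ inside ∷ S₂) ∷ (inside ∷ S₃) ∷ S₄ ∷ ω

  to : Σ _ (_∈ W) → BroomVertex ∣ A ∣
  to (zero , _)                  = core zero
  to (suc zero , _)              = core (suc zero)
  to (suc (suc zero) , _)        = core (suc (suc zero))
  to (suc (suc (suc zero)) , _)  = core (suc (suc (suc zero)))
  to (suc (suc (suc (suc i))) , there (there (there (there i∈A)))) = leaf (rank A (i , i∈A))

  lift : Σ _ (_∈ A) → Σ _ (_∈ W)
  lift (i , i∈A) = suc (suc (suc (suc i))) , there (there (there (there i∈A)))

  from : BroomVertex ∣ A ∣ → Σ _ (_∈ W)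
  from (core zero)                   = zero , here
  from (core (suc zero))             = suc zero , there here
  from (core (suc (suc zero)))       = suc (suc zero) , there (there here)
  from (core (suc (suc (suc zero)))) = suc (suc (suc zero)) , there (there (there here))
  from (leaf r)                      = lift (select A r)

  to-from : ∀ v → to (from v) ≡ v
  to-from (core zero)                   = refl
  to-from (core (suc zero))             = refl
  to-from (core (suc (suc zero)))       = refl
  to-from (core (suc (suc (suc zero)))) = refl
  to-from (leaf r)                      = ≡.cong leaf (rank-select A r)

  from-to : ∀ u → from (to u) ≡ u
  from-to (zero , here)                                 = refl
  from-to (suc zero , there here)                       = refl
  from-to (suc (suc zero) , there (there here))         = refl
  from-to (suc (suc (suc zero)) , there (there (there here))) = refl
  from-to (suc (suc (suc (suc i))) , there (there (there (there i∈A)))) = ≡.cong lift (select-rank A (i , i∈A))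

  both : ∀ {P Q : Set} → P → Q → P ⇔ Q
  both p q = mk⇔ (λ _ → q) (λ _ → p)

  neither : ∀ {P Q : Set} → ¬ P → ¬ Q → P ⇔ Q
  neither ¬p ¬q = mk⇔ (λ p → contradiction p ¬p) (λ q → contradiction q ¬q)

  adj : ∀ u v → OutcomeAdj ω′ (proj₁ u) (proj₁ v) ⇔ BroomAdj (to u) (to v)
  adj (zero , _) (zero , _) = neither (λ ()) (λ i≢i → i≢i refl)
  adj (zero , _) (suc zero , _) = both here (λ ())
  adj (zero , _) (suc (suc zero) , _) = both (there here) (λ ())
  adj (zero , _) (suc (suc (suc zero)) , _) = both (there (there here)) (λ ())
  adj (zero , _) (suc (suc (suc (suc i))) , there (there (there (there i∈A)))) = both (there (there (there (⊆S₁ i∈A)))) tt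
  adj (suc zero , _) (zero , _) = both here (λ ())
  adj (suc zero , _) (suc zero , _) = neither (λ ()) (λ i≢i → i≢i refl)
  adj (suc zero , _) (suc (suc zero) , _) = both here (λ ())
  adj (suc zero , _) (suc (suc (suc zero)) , _) = both (there here) (λ ())
  adj (suc zero , _) (suc (suc (suc (suc i))) , there (there (there (there i∈A)))) =
    neither (λ { (there (there i∈S)) → ∩S₂ i∈A i∈S }) (λ ())
  adj (suc (suc zero) , _) (zero , _) = both (there here) (λ ())
  adj (suc (suc zero) , _) (suc zero , _) = both here (λ ())
  adj (suc (suc zero) , _) (suc (suc zero) , _) = neither (λ ()) (λ i≢i → i≢i refl)
  adj (suc (suc zero) , _) (suc (suc (suc zero)) , _) = both here (λ ())
  adj (suc (suc zero) , _) (suc (suc (suc (suc i))) , there (there (there (there i∈A)))) =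
    neither (λ { (there i∈S) → ∩S₃ i∈A i∈S }) (λ ())
  adj (suc (suc (suc zero)) , _) (zero , _) = both (there (there here)) (λ ())
  adj (suc (suc (suc zero)) , _) (suc zero , _) = both (there here) (λ ())
  adj (suc (suc (suc zero)) , _) (suc (suc zero) , _) = both here (λ ())
  adj (suc (suc (suc zero)) , _) (suc (suc (suc zero)) , _) = neither (λ ()) (λ i≢i → i≢i refl)
  adj (suc (suc (suc zero)) , _) (suc (suc (suc (suc i))) , there (there (there (there i∈A)))) =
    neither (∩S₄ i∈A) (λ ())
  adj (suc (suc (suc (suc i))) , there (there (there (there i∈A)))) (zero , _) = both (there (there (there (⊆S₁ i∈A)))) tt
  adj (suc (suc (suc (suc i))) , there (there (there (there i∈A)))) (suc zero , _) =
    neither (λ { (there (there i∈S)) → ∩S₂ i∈A i∈S }) (λ ())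
  adj (suc (suc (suc (suc i))) , there (there (there (there i∈A)))) (suc (suc zero) , _) =
    neither (λ { (there i∈S) → ∩S₃ i∈A i∈S }) (λ ())
  adj (suc (suc (suc (suc i))) , there (there (there (there i∈A)))) (suc (suc (suc zero)) , _) =
    neither (∩S₄ i∈A) (λ ())
  adj (suc (suc (suc (suc i))) , there (there (there (there i∈A)))) (suc (suc (suc (suc j))) , there (there (there (there j∈A)))) =
    neither (independent i∈A j∈A) (λ ())

induced-extend : ∀ {n S} {ω : Outcome n} {W : Subset n} →
  induced (graph (S ∷ ω)) (_∈ outside ∷ W) ≅ induced (graph ω) (_∈ W)
induced-extend = mk↔ₛ′
  (λ { (suc i , there i∈W) → i , i∈W }) (λ (i , i∈W) → suc i , there i∈W)
  (λ _ → refl) (λ { (suc i , there i∈W) → refl }) ,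
  λ { (suc i , there i∈W) (suc j , there j∈W) → mk⇔ (λ a → a) (λ a → a) }

ContainsBroom : ℕ → ∀ {n} → Outcome n → Set
ContainsBroom k {n} ω = Σ (Subset n) λ W → ∣ W ∣ ≡ 4 ℕ.+ k × induced (graph ω) (_∈ W) ≅ broom k

ContainsBroom-extend : ∀ {k n S} {ω : Outcome n} → ContainsBroom k ω → ContainsBroom k (S ∷ ω)
ContainsBroom-extend {k} {n} {S} {ω} (W , size , iso) =
  outside ∷ W , size , ≅-trans {induced (graph (S ∷ ω)) (_∈ outside ∷ W)} {induced (graph ω) (_∈ W)} {broom k} induced-extend iso

ContainsBroom-create : ∀ {k n} {S₁ S₂ S₃ S₄ : Subset n} {ω A} → Good k S₁ S₂ S₃ S₄ ω A →
  ContainsBroom k ((inside ∷ inside ∷ inside ∷ S₁) ∷ (inside ∷ inside ∷ S₂) ∷ (inside ∷ S₃) ∷ S₄ ∷ ω)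
ContainsBroom-create {A = A} good =
  inside ∷ inside ∷ inside ∷ inside ∷ A , ≡.cong (4 ℕ.+_) (Good.size good) , broom-induced good

-- Brooms as diameter graphs in three dimensions

module Geometry (em : ExcludedMiddle 0ℓ) (ℝ : Reals) where

  open OrderedField em ℝ
  open Classical em ℝ
  open Exponential em ℝ using (exp-surjective; exp-+; ½; 0<½; ½+½≈1; 0<exp; exp-cong; the-satisfies)
  open ≤-Reasoning

  -- The root is `exp (½ * y)` for some `y` with `exp y ≈ fromℕ 2`, so surjectivity of `exp`
  -- replaces a further completeness argument.
  √2-exists : ∃ λ d → 0# < d × d * d ≈ fromℕ 2
  √2-exists = from-log (exp-surjective (1≤fromℕ-suc 1))
    where
    from-log : (∃ λ y → 0# ≤ y × exp y ≈ fromℕ 2) → ∃ λ d → 0# < d × d * d ≈ fromℕ 2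
    from-log (y , 0≤y , ey≈2) = exp (½ * y) , 0<exp 0≤½y ,
      ≈-trans (≈-sym (exp-+ 0≤½y 0≤½y)) (≈-trans (exp-cong (+-nonneg 0≤½y 0≤½y) ½y+½y≈y) ey≈2)
      where
      0≤½y = *-nonneg (<⇒≤ 0<½) 0≤y
      ½y+½y≈y : ½ * y + ½ * y ≈ y
      ½y+½y≈y = ≈-trans (≈-sym (distribʳ y ½ ½)) (≈-trans (*-congʳ ½+½≈1) (*-identityˡ y))

  square-mono-< : ∀ {x y} → 0# ≤ x → x < y → x * x < y * y
  square-mono-< 0≤x x<y = ≤-<-trans (*-monoˡ-≤ 0≤x (<⇒≤ x<y)) (<-respˡ (*-comm _ _) (*-monoˡ-< (≤-<-trans 0≤x x<y) x<y))

  square-cancel-≤ : ∀ {x y} → 0# ≤ y → x * x ≤ y * y → x ≤ y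
  square-cancel-≤ 0≤y x²≤y² = ≮⇒≥ λ y<x → <⇒≱ (square-mono-< 0≤y y<x) x²≤y²

  square-cancel-< : ∀ {x y} → 0# ≤ x → 0# ≤ y → x * x < y * y → x < y
  square-cancel-< 0≤x 0≤y x²<y² = [ (λ y≤x → contradiction (*-mono-≤ 0≤y 0≤y y≤x y≤x) (<⇒≱ x²<y²)) , (λ x<y → x<y) ]′ (≤-<-connex _ _)

  sqrt-cases : ∀ s → (0# ≤ sqrt s × sqrt s * sqrt s ≈ s) ⊎ (¬ (∃ λ y → 0# ≤ y × y * y ≈ s) × sqrt s ≈ 0#)
  sqrt-cases s with em {∃ λ y → 0# ≤ y × y * y ≈ s}
  ... | yes (_ , root) = inj₁ root
  ... | no  ∄root      = inj₂ (∄root , ≈-refl)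

  vec : Carrier → Carrier → Carrier → Point 3
  vec x y z zero             = x
  vec x y z (suc zero)       = y
  vec x y z (suc (suc zero)) = z

  sqdist : ∀ {d} → Point d → Point d → Carrier
  sqdist u v = sum λ l → (u l - v l) * (u l - v l)

  -- Rational points of the open quarter of the unit circle, by the tangent
  -- half-angle parametrisation.
  module _ (i : ℕ) where

    private
      -- From 2 on, `m * m - 1#` is positive, which keeps the point off the ends of the arc.
      m = fromℕ (2 ℕ.+ i)
      m²+1 = m * m + 1#

      0<m : 0# < m
      0<m = 0<fromℕ-suc (1 ℕ.+ i)

      0<m²+1 : 0# < m²+1
      0<m²+1 = <-≤-trans 0<1 (≤-respʳ-≈ (+-comm 1# _) (x≤x+y (0≤x*x m)))

      r = m²+1 ⁻¹

      0<r : 0# < r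
      0<r = ⁻¹-pos 0<m²+1

      [m²+1]r≈1 : m²+1 * r ≈ 1#
      [m²+1]r≈1 = x*x⁻¹≈1 0<m²+1

    circle-x circle-y : Carrier
    circle-x = fromℕ 2 * m * r
    circle-y = (m * m - 1#) * r

    0<circle-x : 0# < circle-x
    0<circle-x = *-pos (*-pos (0<fromℕ-suc 1) 0<m) 0<r

    0<circle-y : 0# < circle-y
    0<circle-y = *-pos (<-diff ((1# + fromℕ i) * (fromℕ 3 + fromℕ i))
      (*-pos (0<fromℕ-suc i) (<-≤-trans (0<fromℕ-suc 2) (x≤x+y (0≤fromℕ i))))
      (solve 1 (λ i → (:1 :+ (:1 :+ i)) :* (:1 :+ (:1 :+ i)) :- :1 :- :0 := (:1 :+ i) :* (:ℕ 3 :+ i)) ≈-refl (fromℕ i))) 0<r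

    circle : circle-x * circle-x + circle-y * circle-y ≈ 1#
    circle = ≈-trans
      (solve 2 (λ m r → (:ℕ 2 :* m :* r) :* (:ℕ 2 :* m :* r) :+ ((m :* m :- :1) :* r) :* ((m :* m :- :1) :* r) :=
         ((m :* m :+ :1) :* r) :* ((m :* m :+ :1) :* r)) ≈-refl m r)
      (≈-trans (*-cong [m²+1]r≈1 [m²+1]r≈1) (*-identityˡ 1#))

    -- Recovers `m` from the point as (1 + y) / x, so that distinct leaves become distinct points.
    circle-parameter : m * circle-x ≈ 1# + circle-y
    circle-parameter = ≈-sym (≈-trans (+-congʳ (≈-sym [m²+1]r≈1))
      (solve 2 (λ m r → (m :* m :+ :1) :* r :+ (m :* m :- :1) :* r := m :* (:ℕ 2 :* m :* r)) ≈-refl m r))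

  circle-injective : ∀ {i j} → circle-x i ≈ circle-x j → circle-y i ≈ circle-y j → i ≡ j
  circle-injective {i} {j} x≈ y≈ = ℕ.+-cancelˡ-≡ 2 i j
    (ℕ.≤-antisym (fromℕ-cancel-≤ (≤-reflexive m≈)) (fromℕ-cancel-≤ (≤-reflexive (≈-sym m≈))))
    where
    m≈ : fromℕ (2 ℕ.+ i) ≈ fromℕ (2 ℕ.+ j)
    m≈ = *-cancelˡ-≈ (0<circle-x i) (≈-trans (*-comm _ _) (≈-trans (circle-parameter i)
      (≈-trans (+-congˡ y≈) (≈-trans (≈-sym (circle-parameter j)) (≈-trans (*-comm _ _) (*-congʳ (≈-sym x≈)))))))

  -- The core consists of alternate corners of the unit cube, mutually at squared distance 2. So is
  -- a leaf (x, y, 1) with x² + y² = 1 from the origin; its arc runs from (1, 0, 1) to (0, 1, 1),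
  -- two of the other core points.
  position : ∀ {k} → BroomVertex k → Point 3
  position (core zero)                   = vec 0# 0# 0#
  position (core (suc zero))             = vec 1# 1# 0#
  position (core (suc (suc zero)))       = vec 1# 0# 1#
  position (core (suc (suc (suc zero)))) = vec 0# 1# 1#
  position (leaf i)                      = vec (circle-x (toℕ i)) (circle-y (toℕ i)) 1#

  sqdist-sym : ∀ {x y z x′ y′ z′} → sqdist (vec x y z) (vec x′ y′ z′) ≈ sqdist (vec x′ y′ z′) (vec x y z)
  sqdist-sym = solve 6 (λ x y z a b c →
      (x :- a) :* (x :- a) :+ ((y :- b) :* (y :- b) :+ ((z :- c) :* (z :- c) :+ :0)) :=
      (a :- x) :* (a :- x) :+ ((b :- y) :* (b :- y) :+ ((c :- z) :* (c :- z) :+ :0))) ≈-refl _ _ _ _ _ _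

  sqdist-self : ∀ {x y z} → sqdist (vec x y z) (vec x y z) < fromℕ 2
  sqdist-self = <-diff _ (0<fromℕ-suc 1) (solve 3 (λ x y z →
      :ℕ 2 :- ((x :- x) :* (x :- x) :+ ((y :- y) :* (y :- y) :+ ((z :- z) :* (z :- z) :+ :0))) := :ℕ 2) ≈-refl _ _ _)

  private
    Far Near : Point 3 → Point 3 → Set
    Far  u v = sqdist u v ≈ fromℕ 2
    Near u v = sqdist u v < fromℕ 2

    module _ (i : ℕ) where

      private
        x = circle-x i
        y = circle-y i
        0<x = 0<circle-x i
        0<y = 0<circle-y i

      leaf-core₀ : Far (vec x y 1#) (vec 0# 0# 0#)
      leaf-core₀ = ≈-trans
        (solve 2 (λ x y → (x :- :0) :* (x :- :0) :+ ((y :- :0) :* (y :- :0) :+ ((:1 :- :0) :* (:1 :- :0) :+ :0)) :=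
           (x :* x :+ y :* y) :+ :1) ≈-refl x y)
        (≈-trans (+-congʳ (circle i)) (solve 0 (:1 :+ :1 := :ℕ 2) ≈-refl))

      1<x+y : 1# < x + y
      1<x+y = square-cancel-< 0≤1 (<⇒≤ (<-≤-trans 0<x (x≤x+y (<⇒≤ 0<y))))
        (<-diff _ (*-pos (0<fromℕ-suc 1) (*-pos 0<x 0<y)) (≈-trans (+-congˡ (-‿cong (≈-trans (*-identityˡ 1#) (≈-sym (circle i)))))
          (solve 2 (λ x y → (x :+ y) :* (x :+ y) :- (x :* x :+ y :* y) := :ℕ 2 :* (x :* y)) ≈-refl x y)))

      leaf-core₁ : Near (vec x y 1#) (vec 1# 1# 0#)
      leaf-core₁ = <-diff _ (*-pos (0<fromℕ-suc 1) (x<y⇒0<y-x 1<x+y)) (≈-trans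
        (solve 2 (λ x y → :ℕ 2 :- ((x :- :1) :* (x :- :1) :+ ((y :- :1) :* (y :- :1) :+ ((:1 :- :0) :* (:1 :- :0) :+ :0))) :=
           :ℕ 2 :* (x :+ y :- :1) :+ (:1 :- (x :* x :+ y :* y))) ≈-refl x y)
        (≈-trans (+-congˡ (≈-trans (+-congˡ (-‿cong (circle i))) (-‿inverseʳ 1#))) (+-identityʳ _)))

      leaf-core₂ : Near (vec x y 1#) (vec 1# 0# 1#)
      leaf-core₂ = <-diff _ (*-pos (0<fromℕ-suc 1) 0<x) (≈-trans
        (solve 2 (λ x y → :ℕ 2 :- ((x :- :1) :* (x :- :1) :+ ((y :- :0) :* (y :- :0) :+ ((:1 :- :1) :* (:1 :- :1) :+ :0))) :=
           :ℕ 2 :* x :+ (:1 :- (x :* x :+ y :* y))) ≈-refl x y)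
        (≈-trans (+-congˡ (≈-trans (+-congˡ (-‿cong (circle i))) (-‿inverseʳ 1#))) (+-identityʳ _)))

      leaf-core₃ : Near (vec x y 1#) (vec 0# 1# 1#)
      leaf-core₃ = <-diff _ (*-pos (0<fromℕ-suc 1) 0<y) (≈-trans
        (solve 2 (λ x y → :ℕ 2 :- ((x :- :0) :* (x :- :0) :+ ((y :- :1) :* (y :- :1) :+ ((:1 :- :1) :* (:1 :- :1) :+ :0))) :=
           :ℕ 2 :* y :+ (:1 :- (x :* x :+ y :* y))) ≈-refl x y)
        (≈-trans (+-congˡ (≈-trans (+-congˡ (-‿cong (circle i))) (-‿inverseʳ 1#))) (+-identityʳ _)))

      leaf-leaf : ∀ j → Near (vec x y 1#) (vec (circle-x j) (circle-y j) 1#)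
      leaf-leaf j = <-diff _ (*-pos (0<fromℕ-suc 1) (<-≤-trans (*-pos 0<x (0<circle-x j)) (x≤x+y (<⇒≤ (*-pos 0<y (0<circle-y j)))))) (≈-trans
        (solve 4 (λ x y a b → :ℕ 2 :- ((x :- a) :* (x :- a) :+ ((y :- b) :* (y :- b) :+ ((:1 :- :1) :* (:1 :- :1) :+ :0))) :=
           :ℕ 2 :* (x :* a :+ y :* b) :+ ((:1 :- (x :* x :+ y :* y)) :+ (:1 :- (a :* a :+ b :* b)))) ≈-refl x y (circle-x j) (circle-y j))
        (≈-trans (+-congˡ (≈-trans (+-cong (≈-trans (+-congˡ (-‿cong (circle i))) (-‿inverseʳ 1#))
                                           (≈-trans (+-congˡ (-‿cong (circle j))) (-‿inverseʳ 1#))) (+-identityʳ _))) (+-identityʳ _)))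

  -- Squared distances are polynomial in the coordinates. The strict alternative serves both to
  -- determine the diameter and to rule out further edges.
  broom-distances : ∀ {k} (u v : BroomVertex k) →
    (BroomAdj u v × sqdist (position u) (position v) ≈ fromℕ 2) ⊎
    (¬ BroomAdj u v × sqdist (position u) (position v) < fromℕ 2)
  broom-distances (core zero) (core zero) = inj₂ ((λ i≢i → i≢i refl) , sqdist-self)
  broom-distances (core zero) (core (suc zero)) = inj₁ ((λ ()) , solve 0
    ((:0 :- :1) :* (:0 :- :1) :+ ((:0 :- :1) :* (:0 :- :1) :+ ((:0 :- :0) :* (:0 :- :0) :+ :0)) := :ℕ 2) ≈-refl)
  broom-distances (core zero) (core (suc (suc zero))) = inj₁ ((λ ()) , solve 0
    ((:0 :- :1) :* (:0 :- :1) :+ ((:0 :- :0) :* (:0 :- :0) :+ ((:0 :- :1) :* (:0 :- :1) :+ :0)) := :ℕ 2) ≈-refl)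
  broom-distances (core zero) (core (suc (suc (suc zero)))) = inj₁ ((λ ()) , solve 0
    ((:0 :- :0) :* (:0 :- :0) :+ ((:0 :- :1) :* (:0 :- :1) :+ ((:0 :- :1) :* (:0 :- :1) :+ :0)) := :ℕ 2) ≈-refl)
  broom-distances (core (suc zero)) (core zero) = inj₁ ((λ ()) , solve 0
    ((:1 :- :0) :* (:1 :- :0) :+ ((:1 :- :0) :* (:1 :- :0) :+ ((:0 :- :0) :* (:0 :- :0) :+ :0)) := :ℕ 2) ≈-refl)
  broom-distances (core (suc zero)) (core (suc zero)) = inj₂ ((λ i≢i → i≢i refl) , sqdist-self)
  broom-distances (core (suc zero)) (core (suc (suc zero))) = inj₁ ((λ ()) , solve 0
    ((:1 :- :1) :* (:1 :- :1) :+ ((:1 :- :0) :* (:1 :- :0) :+ ((:0 :- :1) :* (:0 :- :1) :+ :0)) := :ℕ 2) ≈-refl)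
  broom-distances (core (suc zero)) (core (suc (suc (suc zero)))) = inj₁ ((λ ()) , solve 0
    ((:1 :- :0) :* (:1 :- :0) :+ ((:1 :- :1) :* (:1 :- :1) :+ ((:0 :- :1) :* (:0 :- :1) :+ :0)) := :ℕ 2) ≈-refl)
  broom-distances (core (suc (suc zero))) (core zero) = inj₁ ((λ ()) , solve 0
    ((:1 :- :0) :* (:1 :- :0) :+ ((:0 :- :0) :* (:0 :- :0) :+ ((:1 :- :0) :* (:1 :- :0) :+ :0)) := :ℕ 2) ≈-refl)
  broom-distances (core (suc (suc zero))) (core (suc zero)) = inj₁ ((λ ()) , solve 0
    ((:1 :- :1) :* (:1 :- :1) :+ ((:0 :- :1) :* (:0 :- :1) :+ ((:1 :- :0) :* (:1 :- :0) :+ :0)) := :ℕ 2) ≈-refl)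
  broom-distances (core (suc (suc zero))) (core (suc (suc zero))) = inj₂ ((λ i≢i → i≢i refl) , sqdist-self)
  broom-distances (core (suc (suc zero))) (core (suc (suc (suc zero)))) = inj₁ ((λ ()) , solve 0
    ((:1 :- :0) :* (:1 :- :0) :+ ((:0 :- :1) :* (:0 :- :1) :+ ((:1 :- :1) :* (:1 :- :1) :+ :0)) := :ℕ 2) ≈-refl)
  broom-distances (core (suc (suc (suc zero)))) (core zero) = inj₁ ((λ ()) , solve 0
    ((:0 :- :0) :* (:0 :- :0) :+ ((:1 :- :0) :* (:1 :- :0) :+ ((:1 :- :0) :* (:1 :- :0) :+ :0)) := :ℕ 2) ≈-refl)
  broom-distances (core (suc (suc (suc zero)))) (core (suc zero)) = inj₁ ((λ ()) , solve 0
    ((:0 :- :1) :* (:0 :- :1) :+ ((:1 :- :1) :* (:1 :- :1) :+ ((:1 :- :0) :* (:1 :- :0) :+ :0)) := :ℕ 2) ≈-refl)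
  broom-distances (core (suc (suc (suc zero)))) (core (suc (suc zero))) = inj₁ ((λ ()) , solve 0
    ((:0 :- :1) :* (:0 :- :1) :+ ((:1 :- :0) :* (:1 :- :0) :+ ((:1 :- :1) :* (:1 :- :1) :+ :0)) := :ℕ 2) ≈-refl)
  broom-distances (core (suc (suc (suc zero)))) (core (suc (suc (suc zero)))) = inj₂ ((λ i≢i → i≢i refl) , sqdist-self)
  broom-distances (core zero) (leaf i) = inj₁ (tt , ≈-trans sqdist-sym (leaf-core₀ (toℕ i)))
  broom-distances (core (suc zero)) (leaf i) = inj₂ ((λ ()) , <-respˡ sqdist-sym (leaf-core₁ (toℕ i)))
  broom-distances (core (suc (suc zero))) (leaf i) = inj₂ ((λ ()) , <-respˡ sqdist-sym (leaf-core₂ (toℕ i)))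
  broom-distances (core (suc (suc (suc zero)))) (leaf i) = inj₂ ((λ ()) , <-respˡ sqdist-sym (leaf-core₃ (toℕ i)))
  broom-distances (leaf i) (core zero) = inj₁ (tt , leaf-core₀ (toℕ i))
  broom-distances (leaf i) (core (suc zero)) = inj₂ ((λ ()) , leaf-core₁ (toℕ i))
  broom-distances (leaf i) (core (suc (suc zero))) = inj₂ ((λ ()) , leaf-core₂ (toℕ i))
  broom-distances (leaf i) (core (suc (suc (suc zero)))) = inj₂ ((λ ()) , leaf-core₃ (toℕ i))
  broom-distances (leaf i) (leaf j) = inj₂ ((λ ()) , leaf-leaf (toℕ i) (toℕ j))

  -- Distinct core points are at squared distance 2. Every core point has a coordinate 0, while all
  -- coordinates of a leaf are positive.
  position-injective : ∀ {k} (u v : BroomVertex k) → (∀ l → position u l ≈ position v l) → u ≡ v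
  position-injective (core i) (core j) eq = ≡.cong core (decidable-stable (i Fin.≟ j) λ i≢j →
    [ (λ (_ , ≈2) → contradiction (≈-trans (≈-sym ≈2) sqdist-0) (0<⇒≉0 (0<fromℕ-suc 1)))
    , (λ (¬adj , _) → ¬adj i≢j) ]′ (broom-distances (core i) (core j)))
    where
    x-y≈0 : ∀ l → position (core i) l - position (core j) l ≈ 0#
    x-y≈0 l = ≈-trans (+-congʳ (eq l)) (-‿inverseʳ _)
    sqdist-0 : sqdist (position (core i)) (position (core j)) ≈ 0#
    sqdist-0 = ≈-trans (+-cong (*-cong (x-y≈0 zero) (x-y≈0 zero)) (+-cong (*-cong (x-y≈0 (suc zero)) (x-y≈0 (suc zero)))
      (+-congʳ (*-cong (x-y≈0 (suc (suc zero))) (x-y≈0 (suc (suc zero)))))))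
      (solve 0 (:0 :* :0 :+ (:0 :* :0 :+ (:0 :* :0 :+ :0)) := :0) ≈-refl)
  position-injective (core zero)                   (leaf i) eq = contradiction (eq (suc (suc zero))) 0≉1
  position-injective (core (suc zero))             (leaf i) eq = contradiction (eq (suc (suc zero))) 0≉1
  position-injective (core (suc (suc zero)))       (leaf i) eq = contradiction (eq (suc zero)) (proj₂ (0<circle-y (toℕ i)))
  position-injective (core (suc (suc (suc zero)))) (leaf i) eq = contradiction (eq zero) (proj₂ (0<circle-x (toℕ i)))
  position-injective (leaf i) (core zero)                   eq = contradiction (≈-sym (eq (suc (suc zero)))) 0≉1
  position-injective (leaf i) (core (suc zero))             eq = contradiction (≈-sym (eq (suc (suc zero)))) 0≉1
  position-injective (leaf i) (core (suc (suc zero)))       eq = contradiction (≈-sym (eq (suc zero))) (proj₂ (0<circle-y (toℕ i)))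
  position-injective (leaf i) (core (suc (suc (suc zero)))) eq = contradiction (≈-sym (eq zero)) (proj₂ (0<circle-x (toℕ i)))
  position-injective (leaf i) (leaf j) eq = ≡.cong leaf (Fin.toℕ-injective (circle-injective (eq zero) (eq (suc zero))))

  module Realisation (k : ℕ) (√2 : Carrier) (0<√2 : 0# < √2) (√2*√2≈2 : √2 * √2 ≈ fromℕ 2) where

    sqrt-≈√2 : ∀ {s} → s ≈ fromℕ 2 → sqrt s ≈ √2
    sqrt-≈√2 {s} s≈2 = [ (λ (0≤r , r²≈s) → let r²≈√2² = ≈-trans r²≈s (≈-trans s≈2 (≈-sym √2*√2≈2)) in
                            antisym (square-cancel-≤ (<⇒≤ 0<√2) (≤-reflexive r²≈√2²)) (square-cancel-≤ 0≤r (≤-reflexive (≈-sym r²≈√2²))))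
                       , (λ (∄root , _) → contradiction (√2 , <⇒≤ 0<√2 , ≈-trans √2*√2≈2 (≈-sym s≈2)) ∄root)
                       ]′ (sqrt-cases s)

    -- Also true if s has no square root, since sqrt s is 0 then.
    sqrt-<√2 : ∀ {s} → s < fromℕ 2 → sqrt s < √2
    sqrt-<√2 {s} s<2 = [ (λ (0≤r , r²≈s) → square-cancel-< 0≤r (<⇒≤ 0<√2) (<-respˡ (≈-sym r²≈s) (<-respʳ (≈-sym √2*√2≈2) s<2)))
                       , (λ (_ , ≈0) → <-respˡ (≈-sym ≈0) 0<√2)
                       ]′ (sqrt-cases s)


    vertex : Fin (4 ℕ.+ k) → BroomVertex k
    vertex zero                      = core zero
    vertex (suc zero)                = core (suc zero)
    vertex (suc (suc zero))          = core (suc (suc zero))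
    vertex (suc (suc (suc zero)))    = core (suc (suc (suc zero)))
    vertex (suc (suc (suc (suc i)))) = leaf i

    index : BroomVertex k → Fin (4 ℕ.+ k)
    index (core i) = i Fin.↑ˡ k
    index (leaf i) = suc (suc (suc (suc i)))

    vertex-index : ∀ v → vertex (index v) ≡ v
    vertex-index (core zero)                   = refl
    vertex-index (core (suc zero))             = refl
    vertex-index (core (suc (suc zero)))       = refl
    vertex-index (core (suc (suc (suc zero)))) = refl
    vertex-index (leaf i)                      = refl

    index-vertex : ∀ i → index (vertex i) ≡ i
    index-vertex zero                      = refl
    index-vertex (suc zero)                = refl
    index-vertex (suc (suc zero))          = refl
    index-vertex (suc (suc (suc zero)))    = refl
    index-vertex (suc (suc (suc (suc i)))) = refl

    points : Fin (4 ℕ.+ k) → Point 3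
    points i = position (vertex i)

    private
      dist≤√2 : ∀ i j → dist (points i) (points j) ≤ √2
      dist≤√2 i j = [ (λ (_ , ≈2) → ≤-reflexive (sqrt-≈√2 ≈2)) , (λ (_ , <2) → <⇒≤ (sqrt-<√2 <2)) ]′
        (broom-distances (vertex i) (vertex j))

      attained : dist (points zero) (points (suc zero)) ≈ √2
      attained = sqrt-≈√2 ([ proj₂ , (λ (¬adj , _) → contradiction (λ ()) ¬adj) ]′
        (broom-distances {k} (core zero) (core (suc zero))))

      IsDiam : Carrier → Set
      IsDiam D = (∃₂ λ i j → D ≈ dist (points i) (points j)) × (∀ i j → dist (points i) (points j) ≤ D)

      diam-spec : IsDiam (diam points)
      diam-spec = the-satisfies 0# IsDiam (dist (points zero) (points (suc zero)) , (zero , suc zero , ≈-refl) ,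
        λ i j → ≤-respʳ-≈ (≈-sym attained) (dist≤√2 i j))

    diam≈√2 : diam points ≈ √2
    diam≈√2 = let (i , j , D≈) , ≤D = diam-spec in
      antisym (≤-respˡ-≈ (≈-sym D≈) (dist≤√2 i j)) (≤-respˡ-≈ attained (≤D zero (suc zero)))

    broom≅diameterGraph : broom k ≅ diameterGraph points
    broom≅diameterGraph = mk↔ₛ′ index vertex index-vertex vertex-index , λ u v → mk⇔ (to u v) (from u v)
      where
      distances : ∀ u v → (BroomAdj u v × dist (points (index u)) (points (index v)) ≈ √2) ⊎
                          (¬ BroomAdj u v × dist (points (index u)) (points (index v)) < √2)
      distances u v rewrite vertex-index u | vertex-index v =
        [ (λ (adj , ≈2) → inj₁ (adj , sqrt-≈√2 ≈2)) , (λ (¬adj , <2) → inj₂ (¬adj , sqrt-<√2 <2)) ]′ (broom-distances u v)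

      to : ∀ u v → BroomAdj u v → index u ≢ index v × dist (points (index u)) (points (index v)) ≈ diam points
      to u v adj = (λ eq → irrefl (broom k) (≡.trans (≡.sym (vertex-index u)) (≡.trans (≡.cong vertex eq) (vertex-index v))) adj) ,
        [ (λ (_ , ≈√2) → ≈-trans ≈√2 (≈-sym diam≈√2)) , (λ (¬adj , _) → contradiction adj ¬adj) ]′ (distances u v)

      from : ∀ u v → index u ≢ index v × dist (points (index u)) (points (index v)) ≈ diam points → BroomAdj u v
      from u v (_ , ≈diam) = [ proj₁ , (λ (_ , <√2) → contradiction (≈-trans ≈diam diam≈√2) (proj₂ <√2)) ]′ (distances u v)

    points-injective : ∀ {i j} → (∀ l → points i l ≈ points j l) → i ≡ j
    points-injective {i} {j} eq = ≡.trans (≡.sym (index-vertex i))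
      (≡.trans (≡.cong index (position-injective (vertex i) (vertex j) eq)) (index-vertex j))

  broom-diameter : ∀ {k G} → G ≅ broom k → IsDiameterGraph 3 G
  broom-diameter {k} {G} iso = realise √2-exists
    where
    realise : (∃ λ d → 0# < d × d * d ≈ fromℕ 2) → IsDiameterGraph 3 G
    realise (√2 , 0<√2 , √2*√2≈2) = 4 ℕ.+ k , points , points-injective ,
      ≅-trans {G} {broom k} {diameterGraph points} iso broom≅diameterGraph
      where open Realisation k √2 0<√2 √2*√2≈2

-- Choice of the parameters and the logarithmic bound

-- Each summand is at most n / 2: half of the vertices serve the attempts at a K₄, the other half
-- the blocks.
halves-fit : ∀ n K .{{_ : ℕ.NonZero (2 ℕ.* K)}} → n ℕ./ 8 ℕ.* 4 ℕ.+ K ℕ.* (n ℕ./ (2 ℕ.* K)) ℕ.≤ n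
halves-fit n K = ℕ.*-cancelˡ-≤ 2 (≡.subst₂ ℕ._≤_
  (solve 3 (λ M K N → M :* con 8 :+ N :* (con 2 :* K) := con 2 :* (M :* con 4 :+ K :* N)) refl (n ℕ./ 8) K (n ℕ./ (2 ℕ.* K)))
  (≡.cong (n ℕ.+_) (≡.sym (ℕ.+-identityʳ n)))
  (ℕ.+-mono-≤ (ℕ.m/n*n≤m n 8) (ℕ.m/n*n≤m n (2 ℕ.* K))))
  where open ℕ.+-*-Solver

module Asymptotics (em : ExcludedMiddle 0ℓ) (ℝ : Reals) where

  open OrderedField em ℝ
  open Classical em ℝ
  open Exponential em ℝ
  open Probability em ℝ
  open Geometry em ℝ
  open ≤-Reasoning

  -- `largestInduced` falls back to 0 unless a maximum exists, so a lower bound for it first has to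
  -- produce one. As `Q` is bounded by `n`, the climb ends within `n` steps.
  largest-exists : ∀ (Q : ℕ → Set) {n k} → (∀ {j} → Q j → j ℕ.≤ n) → 1 ℕ.≤ k → Q k → ∃ (IsLargestPositive Q)
  largest-exists Q {n} {k} Q≤n = climb n (ℕ.m≤n+m n k)
    where
    climb : ∀ gap {k} → n ℕ.≤ k ℕ.+ gap → 1 ℕ.≤ k → Q k → ∃ (IsLargestPositive Q)
    climb gap {k} n≤ 1≤k Qk with em {∃ λ j → k ℕ.< j × Q j}
    ... | no ∄j = k , 1≤k , Qk , λ {j} Qj → ℕ.≮⇒≥ λ k<j → ∄j (j , k<j , Qj)
    climb ℕ.zero {k} n≤ 1≤k Qk | yes (j , k<j , Qj) =
      contradiction (ℕ.≤-trans (Q≤n Qj) (≡.subst (n ℕ.≤_) (ℕ.+-identityʳ k) n≤)) (ℕ.<⇒≱ k<j)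
    climb (ℕ.suc gap) {k} n≤ 1≤k Qk | yes (j , k<j , Qj) =
      climb gap (ℕ.≤-trans n≤ (≡.subst (ℕ._≤ j ℕ.+ gap) (≡.sym (ℕ.+-suc k gap)) (ℕ.+-monoˡ-≤ gap k<j))) (ℕ.≤-trans 1≤k (ℕ.<⇒≤ k<j)) Qj

  module _ (n : ℕ) {p : Carrier} (0≤p : 0# ≤ p) (p≤1 : p ≤ 1#) where

    open RandomGraph p 0≤p p≤1

    ≤-largestInduced : ∀ (P : Graph → Set) {k} → 1 ℕ.≤ k →
      1# / fromℕ 2 < ℙ n p (λ ω → Σ (Subset n) λ W → ∣ W ∣ ≡ k × P (induced (graph ω) (_∈ W))) →
      k ℕ.≤ largestInduced P n p
    ≤-largestInduced P {k} 1≤k Qk =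
      proj₂ (proj₂ (the-satisfies 0 (IsLargestPositive Q) (largest-exists Q Q≤n 1≤k Qk))) Qk
      where
      Q : ℕ → Set
      Q k = 1# / fromℕ 2 < ℙ n p λ ω → Σ (Subset n) λ W → ∣ W ∣ ≡ k × P (induced (graph ω) (_∈ W))

      0≤1/2 : 0# ≤ 1# / fromℕ 2
      0≤1/2 = *-nonneg 0≤1 (<⇒≤ 0<½)

      -- More than `n` vertices cannot be chosen, so the event is empty and its probability 0.
      Q≤n : ∀ {j} → Q j → j ℕ.≤ n
      Q≤n {j} Qj = ℕ.≮⇒≥ λ n<j → <⇒≱ Qj (≤-trans
        (≤-respʳ-≈ (Expectation.⟨⟩-const (outcomes n) 0#) (Expectation.⟨⟩-mono (outcomes n) λ ω →
          [ (λ ((W , size , _) , _) → contradiction (≡.subst (ℕ._≤ n) size (Subset.∣p∣≤n W)) (ℕ.<⇒≱ n<j))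
          , (λ (_ , ≈0) → ≤-reflexive ≈0) ]′ (𝟙-cases _))) 0≤1/2)

    broom-likely⇒≤u : ∀ k → 1# / fromℕ 2 < ℙ n p (ContainsBroom k) → 4 ℕ.+ k ℕ.≤ u 3 n p × 4 ℕ.+ k ℕ.≤ u′ 3 n p
    broom-likely⇒≤u k likely =
      ≤-largestInduced (λ H → IsDiameterGraph 3 H × ChromaticNumber H 4) (s≤s z≤n)
        (weaken λ {ω} (W , size , iso) → let H = induced (graph ω) (_∈ W) in
          W , size , broom-diameter {G = H} iso , chromatic {H} iso) ,
      ≤-largestInduced (λ H → IsDiameterGraph 3 H × ChromaticNumber H 4 × Connected H) (s≤s z≤n)
        (weaken λ {ω} (W , size , iso) → let H = induced (graph ω) (_∈ W) in
          W , size , broom-diameter {G = H} iso , chromatic {H} iso , connected {H} iso)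
      where
      weaken : ∀ {A : Outcome n → Set} → (∀ {ω} → ContainsBroom k ω → A ω) → 1# / fromℕ 2 < ℙ n p A
      weaken broom⇒A = <-≤-trans likely (Expectation.⟨⟩-mono (outcomes n) λ ω → 𝟙-mono broom⇒A)

      chromatic : ∀ {H} → H ≅ broom k → ChromaticNumber H 4
      chromatic {H} iso = ChromaticNumber-resp {H} {broom k} iso (broom-chromatic k)

      connected : ∀ {H} → H ≅ broom k → Connected H
      connected {H} iso = Connected-resp {H} {broom k} iso (broom-connected k)

  -- In the application g = n^(ε / 60), and j is (1 - ε / 2) log (np) rounded down.
  module Parameters {p q g : Carrier} (0≤p : 0# ≤ p) (p≤1 : p ≤ 1#) (0≤q : 0# ≤ q) (q≤1 : q ≤ 1#)
    (32≤pg : fromℕ 32 ≤ p * g) (1≤qg² : 1# ≤ q * (g * g))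
    (j n : ℕ) (pj≤g² : p * fromℕ j ≤ g * g) (g¹⁵≤ : g ^ 15 ≤ fromℕ n * p * q ^ j)
    where

    private
      0<g : 0# < g
      0<g = *-cancelˡ-pos 0≤p (<-≤-trans (0<fromℕ-suc 31) 32≤pg)

      0≤g = <⇒≤ 0<g

      32≤g : fromℕ 32 ≤ g
      32≤g = ≤-trans 32≤pg (≤-respʳ-≈ (*-identityˡ g) (*-monoʳ-≤ 0≤g p≤1))

      1≤g : 1# ≤ g
      1≤g = ≤-trans (1≤fromℕ-suc 31) 32≤g

      1≤pg : 1# ≤ p * g
      1≤pg = ≤-trans (1≤fromℕ-suc 31) 32≤pg

      ≤*1≤ : ∀ {x y} → 0# ≤ x → 1# ≤ y → x ≤ x * y
      ≤*1≤ {x} 0≤x 1≤y = ≤-respˡ-≈ (*-identityʳ x) (*-monoˡ-≤ 0≤x 1≤y)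

      0≤n = 0≤fromℕ n
      0≤q^j = ^-nonneg j 0≤q

      division : ∀ m .{{_ : ℕ.NonZero m}} → fromℕ n ≤ fromℕ m * (1# + fromℕ (n ℕ./ m))
      division m = begin
        fromℕ n                               ≤⟨ fromℕ-mono-≤ n≤ ⟩
        fromℕ (m ℕ.* ℕ.suc (n ℕ./ m))         ≈⟨ fromℕ-* m (ℕ.suc (n ℕ./ m)) ⟩
        fromℕ m * fromℕ (ℕ.suc (n ℕ./ m))     ∎
        where
        n≤ : n ℕ.≤ m ℕ.* ℕ.suc (n ℕ./ m)
        n≤ = ≡.subst₂ ℕ._≤_ (≡.sym (ℕ.m≡m%n+[m/n]*n n m))
          (≡.trans (≡.cong (m ℕ.+_) (ℕ.*-comm (n ℕ./ m) m)) (≡.sym (ℕ.*-suc m (n ℕ./ m))))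
          (ℕ.+-monoˡ-≤ (n ℕ./ m ℕ.* m) (ℕ.<⇒≤ (ℕ.m%n<n n m)))

    K = ℕ.suc (j ℕ.+ j)
    M = n ℕ./ 8
    N = n ℕ./ (2 ℕ.* K)

    fits : M ℕ.* 4 ℕ.+ K ℕ.* N ℕ.≤ n
    fits = halves-fit n K

    -- Rounding n / 8 down costs at most 8 p⁶ ≤ 8, whence the constant 32 = 8 · 3 + 8.
    3≤p⁶M : fromℕ 3 ≤ p ^ 6 * fromℕ M
    3≤p⁶M = *-cancelˡ-≤ (0<fromℕ-suc 7) (begin
      fromℕ 8 * fromℕ 3                           ≈⟨ solve 0 (:ℕ 8 :* :ℕ 3 := :ℕ 32 :- :ℕ 8 :* :1) ≈-refl ⟩
      fromℕ 32 - fromℕ 8 * 1#                     ≤⟨ +-mono-≤ 32≤ (-‿anti-≤ (*-monoˡ-≤ (0≤fromℕ 8) p⁶≤1)) ⟩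
      p ^ 6 * (fromℕ 8 * (1# + fromℕ M)) - fromℕ 8 * p ^ 6
        ≈⟨ solve 3 (λ s e m → s :* (e :* (:1 :+ m)) :- e :* s := e :* (s :* m)) ≈-refl (p ^ 6) (fromℕ 8) (fromℕ M) ⟩
      fromℕ 8 * (p ^ 6 * fromℕ M)                 ∎)
      where
      p⁶≤1 : p ^ 6 ≤ 1#
      p⁶≤1 = ^-anti-≤ {m = 0} {n = 6} 0≤p p≤1 z≤n

      -- Five of the fifteen factors g are traded for factors p, by `1# ≤ p * g`.
      g¹⁰≤ : g ^ 10 ≤ p ^ 6 * fromℕ n
      g¹⁰≤ = *-cancelˡ-≤ (^-pos 5 0<g) (begin
        g ^ 5 * g ^ 10                    ≈⟨ ^-homo-* g 5 10 ⟨
        g ^ 15                            ≤⟨ g¹⁵≤ ⟩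
        fromℕ n * p * q ^ j               ≤⟨ *-monoˡ-≤ (*-nonneg 0≤n 0≤p) (^-anti-≤ {m = 0} {n = j} 0≤q q≤1 z≤n) ⟩
        fromℕ n * p * 1#                  ≤⟨ *-monoˡ-≤ (*-nonneg 0≤n 0≤p) (1≤^ 5 1≤pg) ⟩
        fromℕ n * p * (p * g) ^ 5         ≈⟨ *-congˡ (^-distrib-* p g 5) ⟩
        fromℕ n * p * (p ^ 5 * g ^ 5)     ≈⟨ solve 4 (λ n p s t → n :* p :* (s :* t) := t :* (p :* s :* n)) ≈-refl (fromℕ n) p (p ^ 5) (g ^ 5) ⟩
        g ^ 5 * (p ^ 6 * fromℕ n)         ∎)

      32≤ : fromℕ 32 ≤ p ^ 6 * (fromℕ 8 * (1# + fromℕ M))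
      32≤ = begin
        fromℕ 32                              ≤⟨ 32≤g ⟩
        g                                     ≤⟨ ≤*1≤ 0≤g (1≤^ 9 1≤g) ⟩
        g ^ 10                                ≤⟨ g¹⁰≤ ⟩
        p ^ 6 * fromℕ n                       ≤⟨ *-monoˡ-≤ (^-nonneg 6 0≤p) (division 8) ⟩
        p ^ 6 * (fromℕ 8 * (1# + fromℕ M))    ∎

    -- It suffices that T n ≥ 10 K² + 2 K, the last term covering the rounding of n / (2 K). Here K
    -- ≤ 3 g³ gives 10 K² + 2 K ≤ 12 K² ≤ 108 g⁶ ≤ g⁹, and q³ ≥ g⁻⁶ gives T n ≥ g⁹; this accounts
    -- for the exponent 15 = 6 + 9.
    5K≤ : fromℕ 5 * fromℕ K ≤ p * (q * (q * q)) * q ^ j * fromℕ N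
    5K≤ = *-cancelˡ-≤ 0<2K (begin
      2K * (fromℕ 5 * fromℕ K)                ≈⟨ solve 2 (λ t k → t :* (:ℕ 5 :* k) := t :* (:ℕ 5 :* k) :+ t :* :1 :- t :* :1) ≈-refl 2K (fromℕ K) ⟩
      2K * (fromℕ 5 * fromℕ K) + 2K * 1# - 2K * 1#
        ≤⟨ +-mono-≤ (≤-trans small large) (-‿anti-≤ (*-monoˡ-≤ (<⇒≤ 0<2K) T≤1)) ⟩
      T * (2K * (1# + fromℕ N)) - 2K * T      ≈⟨ solve 3 (λ t k n → t :* (k :* (:1 :+ n)) :- k :* t := k :* (t :* n)) ≈-refl T 2K (fromℕ N) ⟩
      2K * (T * fromℕ N)                      ∎)
      where
      T = p * (q * (q * q)) * q ^ j
      2K = fromℕ (2 ℕ.* K)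
      0<2K : 0# < 2K
      0<2K = 0<fromℕ-suc (j ℕ.+ j ℕ.+ (K ℕ.+ 0))

      0≤q³ = *-nonneg 0≤q (*-nonneg 0≤q 0≤q)

      T≤1 : T ≤ 1#
      T≤1 = ≤-respʳ-≈ (solve 0 (:1 :* (:1 :* (:1 :* :1)) :* :1 := :1) ≈-refl)
        (*-mono-≤ (*-nonneg 0≤p 0≤q³) 0≤q^j
          (*-mono-≤ 0≤p 0≤q³ p≤1 (*-mono-≤ 0≤q (*-nonneg 0≤q 0≤q) q≤1 (*-mono-≤ 0≤q 0≤q q≤1 q≤1)))
          (^-anti-≤ {m = 0} {n = j} 0≤q q≤1 z≤n))

      large : g ^ 9 ≤ T * (2K * (1# + fromℕ N))
      large = ≤-trans (*-cancelˡ-≤ (^-pos 6 0<g) (begin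
        g ^ 6 * g ^ 9                                  ≈⟨ ^-homo-* g 6 9 ⟨
        g ^ 15                                         ≤⟨ ≤*1≤ (^-nonneg 15 0≤g) (1≤^ 3 1≤qg²) ⟩
        g ^ 15 * (q * (g * g)) ^ 3                     ≤⟨ *-monoʳ-≤ (^-nonneg 3 (*-nonneg 0≤q (0≤x*x g))) g¹⁵≤ ⟩
        fromℕ n * p * q ^ j * (q * (g * g)) ^ 3
          ≈⟨ solve 5 (λ n p r q g → n :* p :* r :* (q :* (g :* g)) :^ 3 := g :^ 6 :* (p :* (q :* (q :* q)) :* r :* n)) ≈-refl (fromℕ n) p (q ^ j) q g ⟩
        g ^ 6 * (T * fromℕ n)                          ∎))
        (*-monoˡ-≤ (*-nonneg (*-nonneg 0≤p 0≤q³) 0≤q^j) (division (2 ℕ.* K)))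

      2K≈ : 2K ≈ fromℕ 2 * fromℕ K
      2K≈ = fromℕ-* 2 K

      K≤3g³ : fromℕ K ≤ fromℕ 3 * g ^ 3
      K≤3g³ = begin
        1# + fromℕ (j ℕ.+ j)          ≈⟨ +-congˡ (fromℕ-+ j j) ⟩
        1# + (fromℕ j + fromℕ j)      ≤⟨ +-mono-≤ (1≤^ 3 1≤g) (+-mono-≤ j≤g³ j≤g³) ⟩
        g ^ 3 + (g ^ 3 + g ^ 3)       ≈⟨ solve 1 (λ x → x :+ (x :+ x) := :ℕ 3 :* x) ≈-refl (g ^ 3) ⟩
        fromℕ 3 * g ^ 3               ∎
        where
        j≤g³ : fromℕ j ≤ g ^ 3
        j≤g³ = begin
          fromℕ j                     ≤⟨ ≤*1≤ (0≤fromℕ j) 1≤pg ⟩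
          fromℕ j * (p * g)           ≈⟨ solve 3 (λ j p g → j :* (p :* g) := g :* (p :* j)) ≈-refl (fromℕ j) p g ⟩
          g * (p * fromℕ j)           ≤⟨ *-monoˡ-≤ 0≤g pj≤g² ⟩
          g * (g * g)                 ≈⟨ solve 1 (λ g → g :* (g :* g) := g :^ 3) ≈-refl g ⟩
          g ^ 3                       ∎

      small : 2K * (fromℕ 5 * fromℕ K) + 2K * 1# ≤ g ^ 9
      small = begin
        2K * (fromℕ 5 * fromℕ K) + 2K * 1#
          ≈⟨ +-cong (*-congʳ 2K≈) (*-congʳ 2K≈) ⟩
        fromℕ 2 * fromℕ K * (fromℕ 5 * fromℕ K) + fromℕ 2 * fromℕ K * 1#
          ≤⟨ +-monoʳ-≤ _ (*-monoˡ-≤ (*-nonneg (0≤fromℕ 2) (0≤fromℕ K)) (1≤fromℕ-suc (j ℕ.+ j))) ⟩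
        fromℕ 2 * fromℕ K * (fromℕ 5 * fromℕ K) + fromℕ 2 * fromℕ K * fromℕ K
          ≈⟨ solve 1 (λ k → :ℕ 2 :* k :* (:ℕ 5 :* k) :+ :ℕ 2 :* k :* k := :ℕ 12 :* (k :* k)) ≈-refl (fromℕ K) ⟩
        fromℕ 12 * (fromℕ K * fromℕ K)
          ≤⟨ *-monoˡ-≤ (0≤fromℕ 12) (*-mono-≤ (0≤fromℕ K) (0≤fromℕ K) K≤3g³ K≤3g³) ⟩
        fromℕ 12 * (fromℕ 3 * g ^ 3 * (fromℕ 3 * g ^ 3))
          ≈⟨ solve 1 (λ x → :ℕ 12 :* (:ℕ 3 :* x :* (:ℕ 3 :* x)) := :ℕ 12 :* :ℕ 9 :* (x :* x)) ≈-refl (g ^ 3) ⟩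
        fromℕ 12 * fromℕ 9 * (g ^ 3 * g ^ 3)
          ≤⟨ *-monoʳ-≤ (*-nonneg (^-nonneg 3 0≤g) (^-nonneg 3 0≤g))
               (*-mono-≤ (0≤fromℕ 12) (0≤fromℕ 9) (≤-trans (fromℕ-mono-≤ (ℕ.m≤m+n 12 20)) 32≤g) (≤-trans (fromℕ-mono-≤ (ℕ.m≤m+n 9 23)) 32≤g)) ⟩
        g * g * (g ^ 3 * g ^ 3)
          ≤⟨ ≤*1≤ (*-nonneg (0≤x*x g) (*-nonneg (^-nonneg 3 0≤g) (^-nonneg 3 0≤g))) 1≤g ⟩
        g * g * (g ^ 3 * g ^ 3) * g
          ≈⟨ solve 1 (λ g → g :* g :* (g :^ 3 :* g :^ 3) :* g := g :^ 9) ≈-refl g ⟩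
        g ^ 9 ∎

  module _ (n : ℕ) {p : Carrier} (0≤p : 0# ≤ p) (p≤1 : p ≤ 1#) where

    open RandomGraph p 0≤p p≤1 using (q; 0≤q; q≤1; likely)

    -- In the application `a` is ln n and `g` is n^α. In `pg-large`, 32 is the constant of
    -- `Parameters`, and `α ⁻¹` is there for `a≤g²`.
    module _ {ε α a g : Carrier} (ε≤1 : ε ≤ 1#) (60α≈ε : fromℕ 60 * α ≈ ε) (0<α : 0# < α)
      (0≤a : 0# ≤ a) (exp-a : exp a ≈ fromℕ n) (exp-αa : exp (α * a) ≈ g)
      (pg-large : fromℕ 32 + α ⁻¹ ≤ p * g) (1≤qa : 1# ≤ q * a)
      where

      private
        0≤α = <⇒≤ 0<α

        60α≤1 : fromℕ 60 * α ≤ 1#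
        60α≤1 = ≤-respˡ-≈ (≈-sym 60α≈ε) ε≤1

        0≤αa = *-nonneg 0≤α 0≤a

        αa≤a : α * a ≤ a
        αa≤a = ≤-diff _ (*-nonneg (+-nonneg (x≤y⇒0≤y-x 60α≤1) (*-nonneg (0≤fromℕ 59) 0≤α)) 0≤a)
          (solve 2 (λ α a → a :- α :* a := (:1 :- :ℕ 60 :* α :+ :ℕ 59 :* α) :* a) ≈-refl α a)

        0<g : 0# < g
        0<g = <-respʳ exp-αa (0<exp 0≤αa)

        32≤pg : fromℕ 32 ≤ p * g
        32≤pg = ≤-trans (x≤x+y (<⇒≤ (⁻¹-pos 0<α))) pg-large

        1≤pg = ≤-trans (1≤fromℕ-suc 31) 32≤pg

        0<p : 0# < p
        0<p = *-cancelˡ-pos (<⇒≤ 0<g) (<-respʳ (*-comm p g) (1≤⇒0< 1≤pg))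

        -- This is n^(1 - α) ≤ n p, from p n^α ≥ 1.
        exp[a-αa]≤np : exp (a - α * a) ≤ fromℕ n * p
        exp[a-αa]≤np = ≤-respˡ-≈ (*-identityˡ _) (≤-trans
          (*-monoʳ-≤ (<⇒≤ (0<exp (x≤y⇒0≤y-x αa≤a))) 1≤pg)
          (≤-reflexive (≈-trans (*-assoc p g _) (≈-trans (*-congˡ (≈-trans (*-congʳ (≈-sym exp-αa))
            (≈-trans (≈-sym (exp-split 0≤αa αa≤a)) exp-a))) (*-comm p _)))))

      0<q : 0# < q
      0<q = *-cancelˡ-pos 0≤a (<-respʳ (*-comm q a) (1≤⇒0< 1≤qa))

      1≤np : 1# ≤ fromℕ n * p
      1≤np = ≤-trans (1≤exp (x≤y⇒0≤y-x αa≤a)) exp[a-αa]≤np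

      -- In the application `l` is ln (n p) and `b` is ln (1 / q), so `l / b` is the logarithm to
      -- the base 1 / q.
      module _ {l b : Carrier} (0≤l : 0# ≤ l) (exp-l : exp l ≈ fromℕ n * p) (0≤b : 0# ≤ b) (exp-b : q * exp b ≈ 1#) where

        private
          -- The inequality p ≤ ln (1 / (1 - p)), read off from `(1# - p) * exp p ≤ 1#`. It makes
          -- `b` positive and bounds p j by j b.
          p≤b : p ≤ b
          p≤b = exp-cancel-≤ 0≤b (*-cancelˡ-≤ 0<q (≤-trans ([1-x]exp≤1 0≤p p≤1) (≤-reflexive (≈-sym exp-b))))

          0<b = <-≤-trans 0<p p≤b

          l≤a : l ≤ a
          l≤a = exp-cancel-≤ 0≤a (≤-respˡ-≈ (≈-sym exp-l) (≤-respʳ-≈ (≈-trans (*-identityʳ _) (≈-sym exp-a))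
            (*-monoˡ-≤ (0≤fromℕ n) p≤1)))

          a-αa≤l : a - α * a ≤ l
          a-αa≤l = exp-cancel-≤ 0≤l (≤-respʳ-≈ (≈-sym exp-l) exp[a-αa]≤np)

          -- `l` is at least a - α a, and α ≤ 1/60 is below 1/2.
          a≤2l : a ≤ fromℕ 2 * l
          a≤2l = ≤-diff _ (+-nonneg (*-nonneg (0≤fromℕ 2) (x≤y⇒0≤y-x a-αa≤l))
              (*-nonneg (+-nonneg (x≤y⇒0≤y-x 60α≤1) (*-nonneg (0≤fromℕ 58) 0≤α)) 0≤a))
            (solve 3 (λ α a l → :ℕ 2 :* l :- a := :ℕ 2 :* (l :- (a :- α :* a)) :+ (:1 :- :ℕ 60 :* α :+ :ℕ 58 :* α) :* a) ≈-refl α a l)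

          -- Both α a ≤ exp (α a) = g and α⁻¹ ≤ g. It converts the lower bound on q ln n into
          -- `1# ≤ q * (g * g)`.
          a≤g² : a ≤ g * g
          a≤g² = begin
            a                  ≈⟨ *-identityˡ a ⟨
            1# * a             ≈⟨ *-congʳ (≈-trans (*-comm _ _) (x*x⁻¹≈1 0<α)) ⟨
            α ⁻¹ * α * a       ≈⟨ *-assoc _ _ _ ⟩
            α ⁻¹ * (α * a)     ≤⟨ *-mono-≤ (<⇒≤ (⁻¹-pos 0<α)) 0≤αa α⁻¹≤g (≤-trans (x≤exp 0≤αa) (≤-reflexive exp-αa)) ⟩
            g * g              ∎
            where
            α⁻¹≤g : α ⁻¹ ≤ g
            α⁻¹≤g = ≤-trans (≤-respʳ-≈ (+-comm _ _) (x≤x+y (0≤fromℕ 32)))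
              (≤-trans pg-large (≤-respʳ-≈ (*-identityˡ g) (*-monoʳ-≤ (<⇒≤ 0<g) p≤1)))

          L = l / b

          Lb≈l : L * b ≈ l
          Lb≈l = ≈-trans (*-assoc _ _ _) (≈-trans (*-congˡ (≈-trans (*-comm _ _) (x*x⁻¹≈1 0<b))) (*-identityʳ l))

          0≤2-ε : 0# ≤ fromℕ 2 - ε
          0≤2-ε = x≤y⇒0≤y-x (≤-trans ε≤1 (1≤fromℕ-suc 1))

        0≤L : 0# ≤ l / b
        0≤L = *-nonneg 0≤l (<⇒≤ (⁻¹-pos 0<b))

        private
          half = floor (*-nonneg (<⇒≤ 0<½) (*-nonneg 0≤2-ε 0≤L))
          j = proj₁ half

          2½x≈x : ∀ x → fromℕ 2 * (½ * x) ≈ x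
          2½x≈x x = ≈-trans (≈-sym (*-assoc _ _ _)) (≈-trans (*-congʳ 2½≈1) (*-identityˡ x))

          2j≤ : fromℕ 2 * fromℕ j ≤ (fromℕ 2 - ε) * L
          2j≤ = ≤-respʳ-≈ (2½x≈x _) (*-monoˡ-≤ (0≤fromℕ 2) (proj₁ (proj₂ half)))

          ≤2+2j : (fromℕ 2 - ε) * L ≤ fromℕ 2 * fromℕ (ℕ.suc j)
          ≤2+2j = ≤-respˡ-≈ (2½x≈x _) (*-monoˡ-≤ (0≤fromℕ 2) (<⇒≤ (proj₂ (proj₂ half))))

          -- Doubled: 2 j b ≤ (2 - ε) l by the choice of `j`, and 30 α a ≤ 60 α l = ε l because a ≤
          -- 2 l. This is the origin of the 60 in α.
          jb+15αa≤l : fromℕ j * b + fromℕ 15 * (α * a) ≤ l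
          jb+15αa≤l = *-cancelˡ-≤ (0<fromℕ-suc 1) (begin
            fromℕ 2 * (fromℕ j * b + fromℕ 15 * (α * a))
              ≈⟨ solve 4 (λ j b α a → :ℕ 2 :* (j :* b :+ :ℕ 15 :* (α :* a)) := :ℕ 2 :* j :* b :+ :ℕ 30 :* α :* a) ≈-refl (fromℕ j) b α a ⟩
            fromℕ 2 * fromℕ j * b + fromℕ 30 * α * a
              ≤⟨ +-mono-≤ (*-monoʳ-≤ 0≤b 2j≤) (*-monoˡ-≤ (*-nonneg (0≤fromℕ 30) 0≤α) a≤2l) ⟩
            (fromℕ 2 - ε) * L * b + fromℕ 30 * α * (fromℕ 2 * l)
              ≈⟨ +-cong (≈-trans (*-assoc _ _ _) (*-congˡ Lb≈l)) (≈-trans (double α l) (*-congʳ 60α≈ε)) ⟩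
            (fromℕ 2 - ε) * l + ε * l
              ≈⟨ solve 2 (λ e l → (:ℕ 2 :- e) :* l :+ e :* l := :ℕ 2 :* l) ≈-refl ε l ⟩
            fromℕ 2 * l ∎)
            where
            double : ∀ α l → fromℕ 30 * α * (fromℕ 2 * l) ≈ fromℕ 60 * α * l
            double = solve 2 (λ α l → :ℕ 30 :* α :* (:ℕ 2 :* l) := :ℕ 60 :* α :* l) ≈-refl

          0≤jb = *-nonneg (0≤fromℕ j) 0≤b
          0≤15αa = *-nonneg (0≤fromℕ 15) 0≤αa

          pj≤g² : p * fromℕ j ≤ g * g
          pj≤g² = begin
            p * fromℕ j      ≤⟨ *-monoʳ-≤ (0≤fromℕ j) p≤b ⟩
            b * fromℕ j      ≈⟨ *-comm _ _ ⟩
            fromℕ j * b      ≤⟨ ≤-trans (x≤x+y 0≤15αa) jb+15αa≤l ⟩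
            l                ≤⟨ ≤-trans l≤a a≤g² ⟩
            g * g            ∎

          -- The exponential of `jb+15αa≤l`, as q^j exp (j b) = 1.
          g¹⁵≤ : g ^ 15 ≤ fromℕ n * p * q ^ j
          g¹⁵≤ = begin
            g ^ 15                             ≈⟨ ≈-trans (*-congʳ (≈-trans (^-congˡ j exp-b) (1^n≈1 j))) (*-identityˡ _) ⟨
            (q * exp b) ^ j * g ^ 15           ≈⟨ *-congʳ (^-distrib-* q (exp b) j) ⟩
            q ^ j * exp b ^ j * g ^ 15         ≈⟨ *-assoc _ _ _ ⟩
            q ^ j * (exp b ^ j * g ^ 15)       ≈⟨ *-congˡ (*-cong (exp-times 0≤b j) (≈-trans (exp-times 0≤αa 15) (^-congˡ 15 exp-αa))) ⟨
            q ^ j * (exp (fromℕ j * b) * exp (fromℕ 15 * (α * a)))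
                                               ≈⟨ *-congˡ (exp-+ 0≤jb 0≤15αa) ⟨
            q ^ j * exp (fromℕ j * b + fromℕ 15 * (α * a))
                                               ≤⟨ *-monoˡ-≤ (^-nonneg j 0≤q) (exp-mono-≤ (+-nonneg 0≤jb 0≤15αa) jb+15αa≤l) ⟩
            q ^ j * exp l                      ≈⟨ ≈-trans (*-comm _ _) (*-congʳ exp-l) ⟩
            fromℕ n * p * q ^ j                ∎

          1≤qg² = ≤-trans 1≤qa (*-monoˡ-≤ 0≤q a≤g²)

          open Parameters 0≤p p≤1 0≤q q≤1 32≤pg 1≤qg² j n pj≤g² g¹⁵≤

          broom-likely : 1# / fromℕ 2 < ℙ n p (ContainsBroom K)
          broom-likely = likely (ContainsBroom K)
            (λ broom → ContainsBroom-extend {k = K} (ContainsBroom-extend {k = K} (ContainsBroom-extend {k = K} (ContainsBroom-extend {k = K} broom))))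
            ContainsBroom-create
            (*-pos 0<p (*-pos 0<q (*-pos 0<q 0<q))) 0<q {N} {M} {j} ℕ.≤-refl (s≤s z≤n) 5K≤ 3≤p⁶M n fits

          -- As K = 2 j + 1, the left side is K + 1: the four core vertices make up for rounding `j`
          -- down.
          2+2j≤4+K : fromℕ 2 * fromℕ (ℕ.suc j) ≤ fromℕ (4 ℕ.+ K)
          2+2j≤4+K = ≤-respˡ-≈ (fromℕ-* 2 (ℕ.suc j)) (fromℕ-mono-≤ 2+2j≤)
            where
            2+2j≤ : 2 ℕ.* ℕ.suc j ℕ.≤ 4 ℕ.+ K
            2+2j≤ = s≤s (≡.subst (ℕ._≤ 3 ℕ.+ K) (≡.trans (≡.sym (ℕ.+-suc j j)) (≡.cong (λ i → j ℕ.+ ℕ.suc i) (≡.sym (ℕ.+-identityʳ j)))) (ℕ.m≤n+m K 3))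

        log-bound : (fromℕ 2 - ε) * (l / b) ≤ fromℕ (u 3 n p) × (fromℕ 2 - ε) * (l / b) ≤ fromℕ (u′ 3 n p)
        log-bound = ≤-trans ≤4+K (fromℕ-mono-≤ (proj₁ ≤u)) , ≤-trans ≤4+K (fromℕ-mono-≤ (proj₂ ≤u))
          where
          ≤4+K = ≤-trans ≤2+2j 2+2j≤4+K
          ≤u = broom-likely⇒≤u n 0≤p p≤1 K broom-likely

  module _ {ε : Carrier} (0<ε : 0# < ε) (ε≤1 : ε ≤ 1#) where

    α : Carrier
    α = ε / fromℕ 60

    0<α : 0# < α
    0<α = *-pos 0<ε (⁻¹-pos (0<fromℕ-suc 59))

    60α≈ε : fromℕ 60 * α ≈ ε
    60α≈ε = ≈-trans (swap (fromℕ 60) ε _) (≈-trans (*-congˡ (x*x⁻¹≈1 (0<fromℕ-suc 59))) (*-identityʳ ε))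
      where
      swap : ∀ x y z → x * (y * z) ≈ y * (x * z)
      swap = solve 3 (λ x y z → x :* (y :* z) := y :* (x :* z)) ≈-refl

    -- The conclusion includes `0# ≤ L` so that the bound for a smaller ε implies the bound for a
    -- larger one.
    large-bound : ∀ n {p} → 0# ≤ p → p ≤ 1# → 1 ℕ.≤ n →
      fromℕ 32 + α ⁻¹ < p * fromℕ n ^ʳ α → 1# < (1# - p) * ln (fromℕ n) →
      let L = log (1# / (1# - p)) (fromℕ n * p) in
      0# ≤ L × (fromℕ 2 - ε) * L ≤ fromℕ (u 3 n p) × (fromℕ 2 - ε) * L ≤ fromℕ (u′ 3 n p)
    large-bound n {p} 0≤p p≤1 1≤n pg-large 1<qa =
      0≤L n 0≤p p≤1 ε≤1 60α≈ε 0<α 0≤a exp-a ≈-refl (<⇒≤ pg-large) (<⇒≤ 1<qa) 0≤l exp-l 0≤b exp-b ,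
      log-bound n 0≤p p≤1 ε≤1 60α≈ε 0<α 0≤a exp-a ≈-refl (<⇒≤ pg-large) (<⇒≤ 1<qa) 0≤l exp-l 0≤b exp-b
      where
      q = 1# - p
      1≤n′ : 1# ≤ fromℕ n
      1≤n′ = ≤-respˡ-≈ (+-identityʳ 1#) (fromℕ-mono-≤ 1≤n)
      0≤a = 0≤ln 1≤n′
      exp-a = exp-ln 1≤n′

      1≤np′ = 1≤np n 0≤p p≤1 ε≤1 60α≈ε 0<α 0≤a exp-a ≈-refl (<⇒≤ pg-large) (<⇒≤ 1<qa)
      0≤l = 0≤ln 1≤np′
      exp-l = exp-ln 1≤np′

      0<q′ = 0<q n 0≤p p≤1 ε≤1 60α≈ε 0<α 0≤a exp-a ≈-refl (<⇒≤ pg-large) (<⇒≤ 1<qa)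
      q*1/q≈1 : q * (1# / q) ≈ 1#
      q*1/q≈1 = ≈-trans (*-congˡ (*-identityˡ _)) (x*x⁻¹≈1 0<q′)
      1≤1/q : 1# ≤ 1# / q
      1≤1/q = *-cancelˡ-≤ 0<q′ (≤-respʳ-≈ (≈-sym q*1/q≈1) (≤-respˡ-≈ (≈-sym (*-identityʳ q))
        (RandomGraph.q≤1 p 0≤p p≤1)))
      0≤b = 0≤ln 1≤1/q
      exp-b = ≈-trans (*-congˡ (exp-ln 1≤1/q)) q*1/q≈1

theorem22 : (em : ExcludedMiddle 0ℓ) (ℝ : Reals) →
  let open Reals ℝ
      open Classical em ℝ
  in
  (p : ℕ → Carrier) →
  (∀ n → 0# ≤ p n × p n ≤ 1#) →
  (∀ α → 0# < α → TendsToInfinity (λ n → p n * fromℕ n ^ʳ α)) →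
  TendsToInfinity (λ n → (1# - p n) * ln (fromℕ n)) →
  ∀ ε → 0# < ε →
  ∃ λ n₀ → ∀ n → n₀ ℕ.≤ n →
    let bound = (fromℕ 2 - ε) * log (1# / (1# - p n)) (fromℕ n * p n)
    in bound ≤ fromℕ (u 3 n (p n)) × bound ≤ fromℕ (u′ 3 n (p n))
theorem22 em ℝ p 0≤p≤1 pn^α→∞ q-ln→∞ ε 0<ε = conclude (truncate (total ε 1#))
  where
  open OrderedField em ℝ
  open Classical em ℝ
  open Asymptotics em ℝ

  -- Replacing ε by min (ε, 1) keeps 2 - ε nonnegative and α at most 1/60; the claim becomes
  -- stronger, as the logarithm is nonnegative.
  truncate : ε ≤ 1# ⊎ 1# ≤ ε → ∃ λ ε′ → 0# < ε′ × ε′ ≤ 1# × ε′ ≤ ε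
  truncate (inj₁ ε≤1) = ε , 0<ε , ε≤1 , ≤-refl
  truncate (inj₂ 1≤ε) = 1# , 0<1 , ≤-refl , 1≤ε

  conclude : (∃ λ ε′ → 0# < ε′ × ε′ ≤ 1# × ε′ ≤ ε) → ∃ λ n₀ → ∀ n → n₀ ℕ.≤ n →
    let bound = (fromℕ 2 - ε) * log (1# / (1# - p n)) (fromℕ n * p n)
    in bound ≤ fromℕ (u 3 n (p n)) × bound ≤ fromℕ (u′ 3 n (p n))
  -- `ℕ.suc` ensures n ≥ 1, where `exp-ln` and `0≤ln` apply to `ln (fromℕ n)`.
  conclude (ε′ , 0<ε′ , ε′≤1 , ε′≤ε) = ℕ.suc (proj₁ g-large ℕ.+ proj₁ q-large) , λ n n₀≤n →
    let 0≤L , u-bound , u′-bound = large-bound 0<ε′ ε′≤1 n (proj₁ (0≤p≤1 n)) (proj₂ (0≤p≤1 n))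
          (ℕ.≤-trans (s≤s z≤n) n₀≤n)
          (proj₂ g-large n (ℕ.≤-trans (ℕ.m≤m+n _ _) (ℕ.≤-trans (ℕ.n≤1+n _) n₀≤n)))
          (proj₂ q-large n (ℕ.≤-trans (ℕ.m≤n+m _ _) (ℕ.≤-trans (ℕ.n≤1+n _) n₀≤n)))
        weaken = *-monoʳ-≤ 0≤L (+-monoʳ-≤ (fromℕ 2) (-‿anti-≤ ε′≤ε))
    in ≤-trans weaken u-bound , ≤-trans weaken u′-bound
    where
    g-large = pn^α→∞ (α 0<ε′ ε′≤1) (0<α 0<ε′ ε′≤1) (fromℕ 32 + α 0<ε′ ε′≤1 ⁻¹)
    q-large = q-ln→∞ 1#
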